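{- Let $m\ge 2$ and let $I_2(m)$ be the dihedral Coxeter group with generators $1,2$ and $m(1,2)=m$, with Hecke algebra $H_m^I$. Let $H_0$ be the trivial subalgebra and $H_c$ ($c=1,2$) the parabolic subalgebra generated by $T_c$. Let $\eta_c$ (resp. $\epsilon_c$), $c=0,1,2$, be the character of $H_m^I$ induced from the trivial (resp. sign) representation of $H_c$. Then $\eta_0(T_e)=\epsilon_0(T_e)=2m$ and $\eta_c(T_e)=\epsilon_c(T_e)=m$ for $c=1,2$. If $w$ has even length $\ell\ge 2$, then $$\eta_0(T_w)=\epsilon_0(T_w)=\sum_{j=0}^{\ell/2-1}\frac{\ell}{\ell-j}\binom{\ell-j}{j}q^j(q-1)^{\ell-2j},$$ and if $w$ has odd length $\ell$, then $$\eta_0(T_w)=\epsilon_0(T_w)=mq^{(\ell+1)/2}-mq^{(\ell-1)/2}+\sum_{j=0}^{(\ell-3)/2}\frac{\ell}{\ell-j}\binom{\ell-j}{j}q^j(q-1)^{\ell-2j}.$$ Now let $c\in\{1,2\}$. If $w$ has even length $\ell\ge2$, then $$\eta_c(T_w)=\sum_{j=1}^{\ell/2}\binom{\ell/2+j-1}{2j-1}q^{\ell/2+1-j}(q-1)^{2j-1}+\sum_{j=1}^{\ell/2-1}\binom{\ell/2+j-1}{2j}q^{\ell/2-j}(q-1)^{2j},$$ $$\epsilon_c(T_w)=-\sum_{j=1}^{\ell/2}\binom{\ell/2+j-1}{2j-1}q^{\ell/2-j}(q-1)^{2j-1}+\sum_{j=1}^{\ell/2-1}\binom{\ell/2+j-1}{2j}q^{\ell/2-j}(q-1)^{2j}.$$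 If $w$ has odd length $\ell$, then $\eta_c(T_w)=A+\sum_{j=2}^{(\ell-1)/2}\binom{(\ell-1)/2+j-1}{2j-1}q^{(\ell+1)/2-j}(q-1)^{2j-1}+\sum_{j=1}^{(\ell-1)/2}\binom{(\ell-1)/2+j}{2j}q^{(\ell+1)/2-j}(q-1)^{2j}$, where $A=\frac{m+1}{2}q^{(\ell+1)/2}-\frac{m-1}{2}q^{(\ell-1)/2}$ if $m$ is odd, $A=(\frac m2+1)q^{(\ell+1)/2}-(\frac m2-1)q^{(\ell-1)/2}$ if $m$ is even and $w\sim c$, and $A=\frac m2q^{(\ell+1)/2}-\frac m2q^{(\ell-1)/2}$ if $m$ is even and $w\not\sim c$; and $\epsilon_c(T_w)=B+\sum_{j=2}^{(\ell-1)/2}\binom{(\ell-1)/2+j-1}{2j-1}q^{(\ell+1)/2-j}(q-1)^{2j-1}-\sum_{j=1}^{(\ell-1)/2}\binom{(\ell-1)/2+j}{2j}q^{(\ell-1)/2-j}(q-1)^{2j}$, where $B=\frac{m-1}{2}q^{(\ell+1)/2}-\frac{m+1}{2}q^{(\ell-1)/2}$ if $m$ is odd, $B=(\frac m2-1)q^{(\ell+1)/2}-(\frac m2+1)q^{(\ell-1)/2}$ if $m$ is even and $w\sim c$, and $B=\frac m2q^{(\ell+1)/2}-\frac m2q^{(\ell-1)/2}$ if $m$ is even and $w\not\sim c$. Here $w\sim v$ means that $w$ and $v$ are conjugate in $I_2(m)$.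
   Context: $I_2(m)$ is the dihedral group of order $2m$ generated by involutions $1,2$ with $(12)^m=e$ (equivalently the alternating words $121\cdots$ and $212\cdots$ of length $m$ are equal). $H_m^I$ is the $\mathbb{C}[q^{1/2},q^{ -1/2}]$-algebra generated by $T_1,T_2$ with $T_i^2=(q-1)T_i+q$ and $T_1T_2T_1\cdots=T_2T_1T_2\cdots$ ($m$ factors each); $T_w$ is the product of the $T_i$ along a reduced expression of $w$. The trivial representation of a parabolic subalgebra sends $T_u\mapsto q^{\ell(u)}$, the sign representation sends $T_u\mapsto(-1)^{\ell(u)}$, and induction from $H_c$ is $H_m^I\otimes_{H_c}(-)$. -}

module Defs where

open import Level using (Level)
open import Data.Nat as ℕ using (ℕ; zero; suc; _∸_; _<ᵇ_; _<?_)
open import Data.Nat.Combinatorics using (_C_)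
open import Data.Fin as Fin using (Fin; toℕ; fromℕ<)
open import Data.Fin.Properties as FinP using ()
open import Data.Bool using (Bool; true; false; if_then_else_)
open import Data.List using (List; []; _∷_; _++_; map; foldr; reverse; allFin)
open import Data.List using () renaming ([_] to [_]ᴸ)
open import Data.Product using (Σ; _,_) renaming (_×_ to _×ₚ_)
open import Relation.Nullary using (Dec; yes; no)
open import Relation.Binary.PropositionalEquality using (_≡_; refl; cong)
open import Algebra.Bundles using (CommutativeRing)
import Algebra.Bundles
import Algebra.Definitions.RawSemiring as RawSemiringDefs

data Gen : Set where
  s₁ s₂ : Gen

other : Gen → Gen
other s₁ = s₂
other s₂ = s₁

_≟G_ : (s t : Gen) → Dec (s ≡ t)
s₁ ≟G s₁ = yes refl
s₁ ≟G s₂ = no λ ()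
s₂ ≟G s₁ = no λ ()
s₂ ≟G s₂ = yes refl

-- Elements of I₂(m) as their (canonical) reduced words:
--   e        : the identity (empty word),
--   alt s i  : the alternating word  s t s t …  (t = other s) of length
--              toℕ i + 1  (which is < m),
--   w₀       : the longest element, of length m (here the two alternating
--              words of length m are identified: this is the braid relation
--              (12)^m = e).
-- For m ≥ 2 this set has exactly 2m elements.
data El (m : ℕ) : Set where
  e   : El m
  alt : Gen → Fin (m ∸ 1) → El m
  w₀  : El m

module Dihedral (m : ℕ) where

  altList : Gen → ℕ → List Gen
  altList s zero    = []
  altList s (suc n) = s ∷ altList (other s) n

  word : El m → List Gen
  word e         = []
  word (alt s i) = altList s (suc (toℕ i))
  word w₀        = altList s₁ m

  len : El m → ℕ
  len e         = 0
  len (alt s i) = suc (toℕ i)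
  len w₀        = m

  -- the element given by the alternating word starting with s of length n (n ≤ m)
  mkWord : Gen → ℕ → El m
  mkWord s zero = e
  mkWord s (suc n) with n <? (m ∸ 1)
  ... | yes p = alt s (fromℕ< p)
  ... | no _  = w₀

  leftMul : Gen → El m → El m
  leftMul t e = mkWord t 1
  leftMul t (alt s i) with t ≟G s
  ... | yes _ = mkWord (other s) (toℕ i)
  ... | no  _ = mkWord t (suc (suc (toℕ i)))
  leftMul t w₀ = mkWord (other t) (m ∸ 1)

  gen : Gen → El m
  gen c = leftMul c e

  _·_ : El m → El m → El m
  x · y = foldr leftMul y (word x)

  inv : El m → El m
  inv x = foldr leftMul e (reverse (word x))

  _∼_ : El m → El m → Set
  w ∼ v = Σ (El m) λ g → (g · w) · inv g ≡ v

  allEl : List (El m)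
  allEl = e ∷ (map (alt s₁) (allFin (m ∸ 1)) ++ map (alt s₂) (allFin (m ∸ 1)) ++ [ w₀ ]ᴸ)

  _≟E_ : (x y : El m) → Dec (x ≡ y)
  e ≟E e = yes refl
  e ≟E alt _ _ = no λ ()
  e ≟E w₀ = no λ ()
  alt _ _ ≟E e = no λ ()
  alt s i ≟E alt t j with s ≟G t | i FinP.≟ j
  ... | yes refl | yes refl = yes refl
  ... | no s≢t | _ = no λ { refl → s≢t refl }
  ... | _ | no i≢j = no λ { refl → i≢j refl }
  alt _ _ ≟E w₀ = no λ ()
  w₀ ≟E e = no λ ()
  w₀ ≟E alt _ _ = no λ ()
  w₀ ≟E w₀ = yes refl

data Par : Set where
  H₀  : Par
  H[_] : Gen → Par

data Rep : Set where
  trivial sign : Rep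

-- The Hecke algebra H_m^I over a commutative ring R with parameter q, realised
-- as the free R-module with basis {T_x : x ∈ I₂(m)} (coefficient functions
-- El m → R), with T_s T_x = T_{sx} if ℓ(sx) > ℓ(x) and
-- T_s T_x = (q-1) T_x + q T_{sx} otherwise.  All structure constants lie in
-- ℤ[q], so the statement for all commutative R and all q ∈ R contains the
-- generic statement (R = ℂ[q^{±1/2}], q the parameter).

module Hecke {a ℓ : Level} (R : CommutativeRing a ℓ) (m : ℕ) (q : CommutativeRing.Carrier R) where
  open CommutativeRing R
  open RawSemiringDefs (Algebra.Bundles.Semiring.rawSemiring semiring) using (_×_; _^_)
  open Dihedral m public

  H : Set a
  H = El m → Carrier

  sumEl : (El m → Carrier) → Carrier
  sumEl f = foldr (λ x acc → f x + acc) 0# allEl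

  T : El m → H
  T x y with x ≟E y
  ... | yes _ = 1#
  ... | no  _ = 0#

  TgenT : Gen → El m → H
  TgenT s x y = if len x <ᵇ len (leftMul s x)
                then T (leftMul s x) y
                else (q - 1#) * T x y + q * T (leftMul s x) y

  Tgen· : Gen → H → H
  Tgen· s h y = sumEl λ x → h x * TgenT s x y

  -- left multiplication by T_w = T_{s_1} ⋯ T_{s_k} for the reduced word of w
  mulT : El m → H → H
  mulT w h = foldr Tgen· h (word w)

  -- value of the one-dimensional representation of H_c on T_c
  -- (trivial: T_u ↦ q^{ℓ(u)}, sign: T_u ↦ (-1)^{ℓ(u)})
  onTc : Rep → Carrier
  onTc trivial = q
  onTc sign    = - 1#

  -- Decomposition x = d u with d a minimal left coset representative of
  -- W_P and u ∈ W_P; returns d and whether u = c (true) or u = e (false).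
  decomp : Par → El m → El m ×ₚ Bool
  decomp H₀    x = x , false
  decomp H[ c ] x = if len (x · gen c) <ᵇ len x then (x · gen c , true) else (x , false)

  -- Character of the induced module H ⊗_{H_P} V_ρ at T_w: H is a free right
  -- H_P-module with basis {T_d : d minimal coset rep.}, so the induced module
  -- has basis {T_d ⊗ 1}, and T_w (T_d ⊗ 1) = Σ_x [T_w T_d]_x T_{d(x)} ρ(T_{u(x)}) ⊗ 1.
  -- Its trace is  Σ_x [T_w T_{d(x)}]_x · ρ(T_{u(x)}).
  indChar : Rep → Par → El m → Carrier
  indChar ρ P w = sumEl λ x → weight (decomp P x) x
    where
    weight : El m ×ₚ Bool → El m → Carrier
    weight (d , u) x = mulT w (T d) x * (if u then onTc ρ else 1#)

  η ε : Par → El m → Carrier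
  η = indChar trivial
  ε = indChar sign

  Σ[_⋯<_] : ℕ → ℕ → (ℕ → Carrier) → Carrier
  Σ[ a ⋯< b ] f = go (b ∸ a)
    where
    go : ℕ → Carrier
    go zero    = 0#
    go (suc n) = f (a ℕ.+ n) + go n

  -- ℕ-division (only used with non-zero divisor; the quotients below are exact)
  _div_ : ℕ → ℕ → ℕ
  n div zero    = 0
  n div (suc d) = n ℕ./ suc d

  lucas : ℕ → ℕ → ℕ
  lucas l j = (l ℕ.* ((l ∸ j) C j)) div (l ∸ j)

  q-1 : Carrier
  q-1 = q - 1#

  -- η₀, ε₀ at T_w, ℓ(w) = 2k ≥ 2
  F₀even : ℕ → Carrier
  F₀even k = Σ[ 0 ⋯< k ] λ j → lucas (2 ℕ.* k) j × (q ^ j * q-1 ^ (2 ℕ.* k ∸ 2 ℕ.* j))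

  -- η₀, ε₀ at T_w, ℓ(w) = 2k+1
  F₀odd : ℕ → Carrier
  F₀odd k = (m × q ^ (k ℕ.+ 1) - m × q ^ k)
            + (Σ[ 0 ⋯< k ] λ j → lucas (2 ℕ.* k ℕ.+ 1) j × (q ^ j * q-1 ^ (2 ℕ.* k ℕ.+ 1 ∸ 2 ℕ.* j)))

  -- η_c at T_w, ℓ(w) = 2k ≥ 2
  Fηeven : ℕ → Carrier
  Fηeven k = (Σ[ 1 ⋯< k ℕ.+ 1 ] λ j → ((k ℕ.+ j ∸ 1) C (2 ℕ.* j ∸ 1)) × (q ^ (k ℕ.+ 1 ∸ j) * q-1 ^ (2 ℕ.* j ∸ 1)))
           + (Σ[ 1 ⋯< k ] λ j → ((k ℕ.+ j ∸ 1) C (2 ℕ.* j)) × (q ^ (k ∸ j) * q-1 ^ (2 ℕ.* j)))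

  -- ε_c at T_w, ℓ(w) = 2k ≥ 2
  Fεeven : ℕ → Carrier
  Fεeven k = (- (Σ[ 1 ⋯< k ℕ.+ 1 ] λ j → ((k ℕ.+ j ∸ 1) C (2 ℕ.* j ∸ 1)) × (q ^ (k ∸ j) * q-1 ^ (2 ℕ.* j ∸ 1))))
           + (Σ[ 1 ⋯< k ] λ j → ((k ℕ.+ j ∸ 1) C (2 ℕ.* j)) × (q ^ (k ∸ j) * q-1 ^ (2 ℕ.* j)))

  -- η_c at T_w, ℓ(w) = 2k+1, given the leading term A
  Fηodd : Carrier → ℕ → Carrier
  Fηodd A k = A
            + (Σ[ 2 ⋯< k ℕ.+ 1 ] λ j → ((k ℕ.+ j ∸ 1) C (2 ℕ.* j ∸ 1)) × (q ^ (k ℕ.+ 1 ∸ j) * q-1 ^ (2 ℕ.* j ∸ 1)))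
            + (Σ[ 1 ⋯< k ℕ.+ 1 ] λ j → ((k ℕ.+ j) C (2 ℕ.* j)) × (q ^ (k ℕ.+ 1 ∸ j) * q-1 ^ (2 ℕ.* j)))

  -- ε_c at T_w, ℓ(w) = 2k+1, given the leading term B
  Fεodd : Carrier → ℕ → Carrier
  Fεodd B k = B
            + (Σ[ 2 ⋯< k ℕ.+ 1 ] λ j → ((k ℕ.+ j ∸ 1) C (2 ℕ.* j ∸ 1)) × (q ^ (k ℕ.+ 1 ∸ j) * q-1 ^ (2 ℕ.* j ∸ 1)))
            - (Σ[ 1 ⋯< k ℕ.+ 1 ] λ j → ((k ℕ.+ j) C (2 ℕ.* j)) × (q ^ (k ∸ j) * q-1 ^ (2 ℕ.* j)))

  lead : ℕ → ℕ → ℕ → Carrier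
  lead a b k = a × q ^ (k ℕ.+ 1) - b × q ^ k

  ι : ℕ → Carrier
  ι n = n × 1#

{-# OPTIONS --safe #-}

-- T_s acts on the module induced from H_c along a path: the minimal coset
-- representatives d_0, …, d_{m-1} have one element in each length, T_s joins
-- d_l to d_{l+1} for alternate l, and acts by the scalar ρ (q for the trivial,
-- -1 for the sign representation) at a free end.  Only ρ² = (q-1)ρ + q is used.
-- For ℓ(w) = 2k the diagonal entries of T_w telescope to ρ²ᵏ - qᵏ.  Moving the
-- first letter of an odd word to its end gives, by cyclicity of the trace,
-- tr(2k+3) = (q-1) tr(2k+2) + q tr(2k+1), so odd words reduce to the trace of
-- their middle letter.  Since T_c has trace q + (-1) on H_c, the characters
-- satisfy η₀ = ε₀ = η_c + ε_c.  The binomial sums are the values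
-- (qⁿ - (-1)ⁿ)/(q+1) of the recursion G(n+1) = (q-1) G(n) + q G(n-1).
module Submission where

open import Defs
open import Level using (Level; _⊔_)
open import Data.Nat as ℕ using (ℕ; zero; suc; _≤_; _<_; _+_; _*_; _∸_; z≤n; s≤s; z<s; _<ᵇ_)
import Data.Nat.Properties as ℕₚ
open import Data.Nat.Combinatorics using (_C_; nCn≡1; nC1≡n; k>n⇒nCk≡0; nCk+nC[k+1]≡[n+1]C[k+1]; nCk≡nC[n∸k])
open import Data.Nat.DivMod using (m*n/n≡m)
open import Data.Nat.Solver using (module +-*-Solver)
import Data.Integer as ℤ
import Data.Integer.Properties as ℤₚ
import Data.Sign as Sign
open import Data.Bool using (Bool; true; false; not; _xor_; if_then_else_)
open import Data.Bool.Properties using (T-≡; xor-assoc; xor-comm; xor-identityʳ)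
open import Data.Fin as Fin using (Fin; toℕ; fromℕ<)
open import Data.Fin.Properties using (toℕ-fromℕ<; fromℕ<-toℕ; toℕ<n)
open import Data.List using (List; []; _∷_; _++_; foldr; reverse; map; tabulate; allFin)
open import Data.List.Properties using (unfold-reverse; foldr-++; map-tabulate; ∷-injectiveˡ)
import Data.Maybe as Maybe
open import Data.Product using (_×_; _,_; ∃; proj₁; proj₂)
open import Data.Sum using (_⊎_; inj₁; inj₂)
open import Function using (_∘_; id)
open import Function.Bundles using (Equivalence)
open import Relation.Nullary using (¬_; Dec; yes; no; contradiction)
open import Relation.Nullary.Decidable using (dec⇒maybe)
open import Relation.Binary.PropositionalEquality as ≡ using (_≡_; _≢_; refl)
open import Algebra.Bundles using (CommutativeRing; RawRing)
open import Algebra.Solver.Ring.AlmostCommutativeRing using (_-Raw-AlmostCommutative⟶_; fromCommutativeRing)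
import Algebra.Solver.Ring
import Algebra.Properties.CommutativeSemigroup
import Algebra.Properties.Ring
import Algebra.Properties.Semiring.Exp
import Algebra.Properties.Semiring.Mult
import Algebra.Properties.Semiring.Mult.TCOptimised
import Relation.Binary.Reasoning.Setoid

-- Put `m = N + 1`, so that the path has the vertices 0, ..., N. The diagonal entry of an even word
-- at vertex l is read in two ways. If the first letter raises l, the word is consumed from the
-- left: the entry climbs to the top end, picks up `ρ` there and comes back. If the first letter
-- lowers l, the last letter raises it, because the length is even, and letters are absorbed from
-- the right into the basis vector until that reaches the top. Both cases are thus settled at the
-- same end, the entry depends only on the distance of l from it, and the bound on the length keeps
-- the rest of the word away from the bottom. The obstacle is that a lowering letter branches into a
-- descent and a stay; a suitable difference of entries removes the branching. `R` is arbitrary, so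
-- `q + 1` cannot be cancelled, and the binomial sums are tied together by linear identities
-- instead. For even m the leading coefficients depend on the middle letter of w. That letter is an
-- invariant of the conjugacy class: the parity of the number of letters `c` survives both the braid
-- relation and conjugation.

-- Ring normalisation over an arbitrary commutative ring, with integer coefficients.

module IntegerCoefficients {a ℓ : Level} (R : CommutativeRing a ℓ) where
  open ℤ using (ℤ; +_; -[1+_]; _⊖_; _◃_)
  open CommutativeRing R renaming (_+_ to _⊕_; _*_ to _⊛_; refl to ≈-refl)
  open Algebra.Properties.Ring ring
  open Algebra.Properties.Semiring.Mult.TCOptimised semiring renaming (_×_ to _⋆_)
  open Relation.Binary.Reasoning.Setoid setoid

  ⟦_⟧ᶻ : ℤ → Carrier
  ⟦ + n ⟧ᶻ      = n ⋆ 1#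
  ⟦ -[1+ n ] ⟧ᶻ = - (suc n ⋆ 1#)

  ⊖-homo : ∀ m n → ⟦ m ⊖ n ⟧ᶻ ≈ m ⋆ 1# - n ⋆ 1#
  ⊖-homo m zero = sym (trans (+-congˡ -0#≈0#) (+-identityʳ _))
  ⊖-homo zero (suc n) = sym (+-identityˡ _)
  ⊖-homo (suc m) (suc n) = begin
    ⟦ suc m ⊖ suc n ⟧ᶻ                     ≡⟨ ≡.cong ⟦_⟧ᶻ (ℤₚ.[1+m]⊖[1+n]≡m⊖n m n) ⟩
    ⟦ m ⊖ n ⟧ᶻ                             ≈⟨ ⊖-homo m n ⟩
    m ⋆ 1# - n ⋆ 1#                        ≈⟨ +-congʳ (+-identityˡ _) ⟨
    (0# ⊕ m ⋆ 1#) - n ⋆ 1#                 ≈⟨ +-congʳ (+-congʳ (-‿inverseʳ 1#)) ⟨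
    ((1# - 1#) ⊕ m ⋆ 1#) - n ⋆ 1#          ≈⟨ +-congʳ (trans (+-assoc _ _ _) (trans (+-congˡ (+-comm _ _)) (sym (+-assoc _ _ _)))) ⟩
    ((1# ⊕ m ⋆ 1#) - 1#) - n ⋆ 1#          ≈⟨ +-assoc _ _ _ ⟩
    (1# ⊕ m ⋆ 1#) ⊕ (- 1# - n ⋆ 1#)        ≈⟨ +-congˡ (-‿+-comm _ _) ⟩
    (1# ⊕ m ⋆ 1#) - (1# ⊕ n ⋆ 1#)          ≈⟨ +-cong (×-homo-+ 1# 1 m) (-‿cong (×-homo-+ 1# 1 n)) ⟨
    suc m ⋆ 1# - suc n ⋆ 1#                ∎

  ⟦⟧ᶻ-+-homo : ∀ i j → ⟦ i ℤ.+ j ⟧ᶻ ≈ ⟦ i ⟧ᶻ ⊕ ⟦ j ⟧ᶻ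
  ⟦⟧ᶻ-+-homo (+ m)    (+ n)    = ×-homo-+ 1# m n
  ⟦⟧ᶻ-+-homo (+ m)    -[1+ n ] = ⊖-homo m (suc n)
  ⟦⟧ᶻ-+-homo -[1+ m ] (+ n)    = trans (⊖-homo n (suc m)) (+-comm _ _)
  ⟦⟧ᶻ-+-homo -[1+ m ] -[1+ n ] = begin
    - (suc (suc (m + n)) ⋆ 1#)     ≡⟨ ≡.cong (λ k → - (k ⋆ 1#)) (ℕₚ.+-suc (suc m) n) ⟨
    - ((suc m + suc n) ⋆ 1#)       ≈⟨ -‿cong (×-homo-+ 1# (suc m) (suc n)) ⟩
    - (suc m ⋆ 1# ⊕ suc n ⋆ 1#)    ≈⟨ -‿+-comm _ _ ⟨
    - (suc m ⋆ 1#) - (suc n ⋆ 1#)  ∎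

  ◃⁻-homo : ∀ n → ⟦ Sign.- ◃ n ⟧ᶻ ≈ - (n ⋆ 1#)
  ◃⁻-homo zero    = sym -0#≈0#
  ◃⁻-homo (suc n) = ≈-refl

  ◃⁺-homo : ∀ n → ⟦ Sign.+ ◃ n ⟧ᶻ ≈ n ⋆ 1#
  ◃⁺-homo zero    = ≈-refl
  ◃⁺-homo (suc n) = ≈-refl

  ⟦⟧ᶻ-*-homo : ∀ i j → ⟦ i ℤ.* j ⟧ᶻ ≈ ⟦ i ⟧ᶻ ⊛ ⟦ j ⟧ᶻ
  ⟦⟧ᶻ-*-homo (+ m) (+ n) = trans (◃⁺-homo (m * n)) (×1-homo-* m n)
  ⟦⟧ᶻ-*-homo (+ m) -[1+ n ] = begin
    ⟦ Sign.- ◃ (m * suc n) ⟧ᶻ   ≈⟨ ◃⁻-homo (m * suc n) ⟩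
    - ((m * suc n) ⋆ 1#)        ≈⟨ -‿cong (×1-homo-* m (suc n)) ⟩
    - (m ⋆ 1# ⊛ suc n ⋆ 1#)     ≈⟨ -‿distribʳ-* _ _ ⟩
    m ⋆ 1# ⊛ - (suc n ⋆ 1#)     ∎
  ⟦⟧ᶻ-*-homo -[1+ m ] (+ n) = begin
    ⟦ Sign.- ◃ (suc m * n) ⟧ᶻ   ≈⟨ ◃⁻-homo (suc m * n) ⟩
    - ((suc m * n) ⋆ 1#)        ≈⟨ -‿cong (×1-homo-* (suc m) n) ⟩
    - (suc m ⋆ 1# ⊛ n ⋆ 1#)     ≈⟨ -‿distribˡ-* _ _ ⟩
    - (suc m ⋆ 1#) ⊛ n ⋆ 1#     ∎
  ⟦⟧ᶻ-*-homo -[1+ m ] -[1+ n ] = begin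
    (suc m * suc n) ⋆ 1#                ≈⟨ ×1-homo-* (suc m) (suc n) ⟩
    suc m ⋆ 1# ⊛ suc n ⋆ 1#             ≈⟨ -‿involutive _ ⟨
    - - (suc m ⋆ 1# ⊛ suc n ⋆ 1#)       ≈⟨ -‿cong (-‿distribʳ-* _ _) ⟩
    - (suc m ⋆ 1# ⊛ - (suc n ⋆ 1#))     ≈⟨ -‿distribˡ-* _ _ ⟩
    - (suc m ⋆ 1#) ⊛ - (suc n ⋆ 1#)     ∎

  ⟦⟧ᶻ-neg-homo : ∀ i → ⟦ ℤ.- i ⟧ᶻ ≈ - ⟦ i ⟧ᶻ
  ⟦⟧ᶻ-neg-homo (+ zero)  = sym -0#≈0#
  ⟦⟧ᶻ-neg-homo (+ suc n) = ≈-refl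
  ⟦⟧ᶻ-neg-homo -[1+ n ]  = sym (-‿involutive _)

  -- Coefficients are taken in ℤ because cancelling terms requires deciding equality of
  -- coefficients, which is impossible in a general `R`.
  ℤ-rawRing : RawRing _ _
  ℤ-rawRing = record
    { _≈_ = _≡_ ; _+_ = ℤ._+_ ; _*_ = ℤ._*_ ; -_ = ℤ.-_ ; 0# = ℤ.0ℤ ; 1# = ℤ.1ℤ }

  homomorphism : ℤ-rawRing -Raw-AlmostCommutative⟶ fromCommutativeRing R
  homomorphism = record
    { ⟦_⟧    = ⟦_⟧ᶻ
    ; +-homo = ⟦⟧ᶻ-+-homo
    ; *-homo = ⟦⟧ᶻ-*-homo
    ; -‿homo = ⟦⟧ᶻ-neg-homo
    ; 0-homo = ≈-refl
    ; 1-homo = ≈-refl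
    }

  open Algebra.Solver.Ring ℤ-rawRing (fromCommutativeRing R) homomorphism
    (λ i j → Maybe.map (λ i≡j → reflexive (≡.cong ⟦_⟧ᶻ i≡j)) (dec⇒maybe (i ℤₚ.≟ j)))
    public using (Polynomial; solve; _:=_; _:+_; _:*_; _:-_; :-_; con)

  :0 :1 : ∀ {n} → Polynomial n
  :0 = con ℤ.0ℤ
  :1 = con ℤ.1ℤ

-- Finite sums and the Kronecker delta.

module Sums {a ℓ : Level} (R : CommutativeRing a ℓ) where
  open CommutativeRing R renaming (_+_ to _⊕_; _*_ to _⊛_; refl to ≈-refl)
  open Algebra.Properties.Ring ring
  open Relation.Binary.Reasoning.Setoid setoid
  open IntegerCoefficients R

  -- The last term is added first, so that this unfolds in step with the accumulator inside
  -- `Σ[_⋯<_]`.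
  ∑ : ℕ → (ℕ → Carrier) → Carrier
  ∑ zero    f = 0#
  ∑ (suc n) f = f n ⊕ ∑ n f

  ∑-cong : ∀ n {f g} → (∀ i → i < n → f i ≈ g i) → ∑ n f ≈ ∑ n g
  ∑-cong zero    f≈g = ≈-refl
  ∑-cong (suc n) f≈g = +-cong (f≈g n ℕₚ.≤-refl) (∑-cong n (λ i i<n → f≈g i (ℕₚ.m<n⇒m<1+n i<n)))

  ∑-zero : ∀ n → ∑ n (λ _ → 0#) ≈ 0#
  ∑-zero zero    = ≈-refl
  ∑-zero (suc n) = trans (+-identityˡ _) (∑-zero n)

  ∑-+ : ∀ n f g → ∑ n (λ i → f i ⊕ g i) ≈ ∑ n f ⊕ ∑ n g
  ∑-+ zero    f g = sym (+-identityˡ _)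
  ∑-+ (suc n) f g = trans (+-congˡ (∑-+ n f g))
    (solve 4 (λ x y s t → (x :+ y) :+ (s :+ t) := (x :+ s) :+ (y :+ t)) ≈-refl _ _ _ _)

  ∑-*ˡ : ∀ n x f → ∑ n (λ i → x ⊛ f i) ≈ x ⊛ ∑ n f
  ∑-*ˡ zero    x f = sym (zeroʳ x)
  ∑-*ˡ (suc n) x f = trans (+-congˡ (∑-*ˡ n x f)) (sym (distribˡ x _ _))

  ∑-swap : ∀ m n (f : ℕ → ℕ → Carrier) → ∑ m (λ i → ∑ n (f i)) ≈ ∑ n (λ j → ∑ m (λ i → f i j))
  ∑-swap zero    n f = sym (∑-zero n)
  ∑-swap (suc m) n f = trans (+-congˡ (∑-swap m n f)) (sym (∑-+ n (f m) _))

  ∑-first : ∀ n f → ∑ (suc n) f ≈ f 0 ⊕ ∑ n (f ∘ suc)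
  ∑-first zero    f = ≈-refl
  ∑-first (suc n) f = trans (+-congˡ (∑-first n f))
    (solve 3 (λ x y s → x :+ (y :+ s) := y :+ (x :+ s)) ≈-refl _ _ _)

  ∑-reverse : ∀ n f → ∑ n f ≈ ∑ n (λ i → f (n ∸ suc i))
  ∑-reverse zero    f = ≈-refl
  ∑-reverse (suc n) f = trans (+-congˡ (∑-reverse n f)) (sym (∑-first n _))

  -- Recursion on both arguments, rather than a test for equality, lets `δ (suc j) (suc l)` compute
  -- to `δ j l`, which is the shift along the path.
  δ : ℕ → ℕ → Carrier
  δ zero    zero    = 1#
  δ zero    (suc l) = 0#
  δ (suc j) zero    = 0#
  δ (suc j) (suc l) = δ j l

  δ-refl : ∀ j → δ j j ≈ 1#
  δ-refl zero    = ≈-refl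
  δ-refl (suc j) = δ-refl j

  δ-≢ : ∀ {j l} → j ≢ l → δ j l ≈ 0#
  δ-≢ {zero}  {zero}  j≢l with () ← j≢l refl
  δ-≢ {zero}  {suc l} j≢l = ≈-refl
  δ-≢ {suc j} {zero}  j≢l = ≈-refl
  δ-≢ {suc j} {suc l} j≢l = δ-≢ (j≢l ∘ ≡.cong suc)

  ∑-δ : ∀ n (f : ℕ → Carrier) {l} → l < n → ∑ n (λ j → f j ⊛ δ j l) ≈ f l
  ∑-δ (suc n) f {l} l<1+n with l ℕₚ.≟ n
  ... | yes refl = begin
    f n ⊛ δ n n ⊕ ∑ n (λ j → f j ⊛ δ j n)  ≈⟨ +-cong (trans (*-congˡ (δ-refl n)) (*-identityʳ _))
                                               (trans (∑-cong n (λ j j<n → trans (*-congˡ (δ-≢ (ℕₚ.<⇒≢ j<n))) (zeroʳ _))) (∑-zero n)) ⟩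
    f n ⊕ 0#                               ≈⟨ +-identityʳ _ ⟩
    f n                                    ∎
  ... | no l≢n = begin
    f n ⊛ δ n l ⊕ ∑ n (λ j → f j ⊛ δ j l)  ≈⟨ +-cong (trans (*-congˡ (δ-≢ (l≢n ∘ ≡.sym))) (zeroʳ _))
                                               (∑-δ n f (ℕₚ.≤∧≢⇒< (ℕₚ.≤-pred l<1+n) l≢n)) ⟩
    0# ⊕ f l                               ≈⟨ +-identityˡ _ ⟩
    f l                                    ∎

-- The binomial sums as members of a second order recursion.

module BinomialSums {a ℓ : Level} (R : CommutativeRing a ℓ) (q : CommutativeRing.Carrier R) where
  open CommutativeRing R renaming (_+_ to _⊕_; _*_ to _⊛_; refl to ≈-refl)
  open Algebra.Properties.Ring ring
  open Algebra.Properties.CommutativeSemigroup *-commutativeSemigroup using (x∙yz≈y∙xz)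
  open Algebra.Properties.Semiring.Mult semiring renaming (_×_ to _⋆_)
  open Algebra.Properties.Semiring.Exp semiring
  open Relation.Binary.Reasoning.Setoid setoid
  open IntegerCoefficients R
  open Sums R

  p : Carrier
  p = q - 1#

  ⋆-factor : ∀ n {x y z} → x ≈ y ⊛ z → n ⋆ x ≈ y ⊛ (n ⋆ z)
  ⋆-factor n {x} {y} {z} x≈yz = trans (×-congʳ n x≈yz) (sym (×-comm-* n y z))

  -- `A k` is G(2k) and `B k` is G(2k+1), where G(0) = 0, G(1) = 1 and G(n+1) = p G(n) + q G(n-1).
  -- The lemmas `A-suc` and `B-suc` are the two parities of this recursion.
  A B : ℕ → Carrier
  A k = ∑ k       (λ i → ((k + i) C suc (2 * i)) ⋆ (q ^ (k ∸ suc i) ⊛ p ^ suc (2 * i)))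
  B k = ∑ (suc k) (λ i → ((k + i) C (2 * i))     ⋆ (q ^ (k ∸ i) ⊛ p ^ (2 * i)))

  -- Pascal's rule splits every coefficient in two. In the half that becomes `q ⊛ A k` the top
  -- summand carries C(2k, 2k+1) = 0, which restores the shorter range.
  A-suc : ∀ k → A (suc k) ≈ q ⊛ A k ⊕ p ⊛ B k
  A-suc k = begin
    A (suc k)
      ≈⟨ ∑-cong (suc k) (λ i i<1+k → trans (×-congˡ (≡.sym (nCk+nC[k+1]≡[n+1]C[k+1] (k + i) (2 * i)))) (trans (×-homo-+ _ ((k + i) C (2 * i)) ((k + i) C suc (2 * i))) (+-comm _ _))) ⟩
    ∑ (suc k) (λ i → f i ⊕ g i)
      ≈⟨ ∑-+ (suc k) f g ⟩
    ∑ (suc k) f ⊕ ∑ (suc k) g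
      ≈⟨ +-cong (trans (+-cong top≈0 (trans (∑-cong k step) (∑-*ˡ k q _))) (+-identityˡ _))
                (trans (∑-cong (suc k) (λ i _ → step′ i)) (∑-*ˡ (suc k) p _)) ⟩
    q ⊛ A k ⊕ p ⊛ B k ∎
    where
    f g : ℕ → Carrier
    f i = ((k + i) C suc (2 * i)) ⋆ (q ^ (k ∸ i) ⊛ p ^ suc (2 * i))
    g i = ((k + i) C (2 * i)) ⋆ (q ^ (k ∸ i) ⊛ p ^ suc (2 * i))
    top≈0 : f k ≈ 0#
    top≈0 = ×-congˡ (k>n⇒nCk≡0 (s≤s (ℕₚ.+-monoʳ-≤ k (ℕₚ.m≤m+n k 0))))
    step : ∀ i → i < k → f i ≈ q ⊛ (((k + i) C suc (2 * i)) ⋆ (q ^ (k ∸ suc i) ⊛ p ^ suc (2 * i)))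
    step i i<k rewrite ≡.sym (ℕₚ.suc-pred (k ∸ i) ⦃ ℕ.>-nonZero (ℕₚ.m<n⇒0<n∸m i<k) ⦄)
                     | ℕₚ.pred[m∸n]≡m∸[1+n] k i =
      ⋆-factor ((k + i) C suc (2 * i)) (*-assoc _ _ _)
    step′ : ∀ i → g i ≈ p ⊛ (((k + i) C (2 * i)) ⋆ (q ^ (k ∸ i) ⊛ p ^ (2 * i)))
    step′ i = ⋆-factor ((k + i) C (2 * i)) (x∙yz≈y∙xz (q ^ (k ∸ i)) p (p ^ (2 * i)))

  -- Pascal's rule again, but the summand i = 0 has lower index 0 and cannot be split; it is taken
  -- off first and put back among the terms `h` afterwards.
  B-suc : ∀ k → B (suc k) ≈ q ⊛ B k ⊕ p ⊛ A (suc k)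
  B-suc k = begin
    B (suc k)
      ≈⟨ ∑-first (suc k) _ ⟩
    h 0 ⊕ ∑ (suc k) (λ i → ((suc k + suc i) C (2 * suc i)) ⋆ (q ^ (k ∸ i) ⊛ p ^ (2 * suc i)))
      ≈⟨ +-congˡ (trans (∑-cong (suc k) (λ i _ → pascal i)) (∑-+ (suc k) (h ∘ suc) g)) ⟩
    h 0 ⊕ (∑ (suc k) (h ∘ suc) ⊕ ∑ (suc k) g)
      ≈⟨ trans (sym (+-assoc _ _ _)) (+-cong (sym (∑-first (suc k) h)) (∑-*ˡ (suc k) p _)) ⟩
    (h (suc k) ⊕ ∑ (suc k) h) ⊕ p ⊛ A (suc k)
      ≈⟨ +-congʳ (trans (+-congʳ top≈0) (+-identityˡ _)) ⟩
    ∑ (suc k) h ⊕ p ⊛ A (suc k)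
      ≈⟨ +-congʳ (trans (∑-cong (suc k) (λ i i≤k → step i (ℕₚ.≤-pred i≤k))) (∑-*ˡ (suc k) q _)) ⟩
    q ⊛ B k ⊕ p ⊛ A (suc k) ∎
    where
    h g : ℕ → Carrier
    h i = ((k + i) C (2 * i)) ⋆ (q ^ (suc k ∸ i) ⊛ p ^ (2 * i))
    g i = p ⊛ (((suc k + i) C suc (2 * i)) ⋆ (q ^ (k ∸ i) ⊛ p ^ suc (2 * i)))
    top≈0 : h (suc k) ≈ 0#
    top≈0 = ×-congˡ (k>n⇒nCk≡0 (s≤s (ℕₚ.+-monoʳ-≤ k (ℕₚ.m≤m+n (suc k) 0))))
    pascal : ∀ i → ((suc k + suc i) C (2 * suc i)) ⋆ (q ^ (k ∸ i) ⊛ p ^ (2 * suc i)) ≈ h (suc i) ⊕ g i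
    pascal i = begin
      ((suc k + suc i) C (2 * suc i)) ⋆ t (2 * suc i)
        ≡⟨ ≡.cong₂ (λ n x → (suc n C x) ⋆ t x) (ℕₚ.+-suc k i) (ℕₚ.*-suc 2 i) ⟩
      (suc (suc k + i) C suc (suc (2 * i))) ⋆ t (2 + 2 * i)
        ≡⟨ ≡.cong (_⋆ t (2 + 2 * i)) (nCk+nC[k+1]≡[n+1]C[k+1] (suc k + i) (suc (2 * i))) ⟨
      ((suc k + i) C suc (2 * i) + (suc k + i) C (2 + 2 * i)) ⋆ t (2 + 2 * i)
        ≈⟨ ×-homo-+ _ ((suc k + i) C suc (2 * i)) _ ⟩
      ((suc k + i) C suc (2 * i)) ⋆ t (2 + 2 * i) ⊕ ((suc k + i) C (2 + 2 * i)) ⋆ t (2 + 2 * i)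
        ≈⟨ +-comm _ _ ⟩
      ((suc k + i) C (2 + 2 * i)) ⋆ t (2 + 2 * i) ⊕ ((suc k + i) C suc (2 * i)) ⋆ t (2 + 2 * i)
        ≈⟨ +-cong (reflexive (≡.cong₂ (λ n x → (n C x) ⋆ t x) (≡.sym (ℕₚ.+-suc k i)) (≡.sym (ℕₚ.*-suc 2 i))))
                  (⋆-factor ((suc k + i) C suc (2 * i)) (x∙yz≈y∙xz (q ^ (k ∸ i)) p (p ^ suc (2 * i)))) ⟩
      h (suc i) ⊕ g i ∎
      where
      t : ℕ → Carrier
      t x = q ^ (k ∸ i) ⊛ p ^ x
    step : ∀ i → i ≤ k → h i ≈ q ⊛ (((k + i) C (2 * i)) ⋆ (q ^ (k ∸ i) ⊛ p ^ (2 * i)))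
    step i i≤k rewrite ℕₚ.+-∸-assoc 1 i≤k = ⋆-factor ((k + i) C (2 * i)) (*-assoc _ _ _)

  -- Written as a power of `q ⊛ q` because the traces produce powers of `ρ ⊛ ρ`, and this is their
  -- value at `ρ = q`.
  q²^ : ℕ → Carrier
  q²^ k = (q ⊛ q) ^ k

  -- In closed form A k = (q²ᵏ - 1) / (q + 1) and B k = (q²ᵏ⁺¹ + 1) / (q + 1);
  -- the next four identities say this without dividing by q + 1.
  qA+1≈B : ∀ k → q ⊛ A k ⊕ 1# ≈ B k
  A+1≈qB : ∀ k → A (suc k) ⊕ 1# ≈ q ⊛ B k

  qA+1≈B zero = solve 1 (λ x → x :* :0 :+ :1 := (:1 :* :1 :+ :0) :+ :0) ≈-refl q
  qA+1≈B (suc k) = begin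
    q ⊛ A (suc k) ⊕ 1#                 ≈⟨ solve 2 (λ q x → q :* x :+ :1 := (x :+ :1) :+ (q :- :1) :* x) ≈-refl q (A (suc k)) ⟩
    (A (suc k) ⊕ 1#) ⊕ p ⊛ A (suc k)   ≈⟨ +-congʳ (A+1≈qB k) ⟩
    q ⊛ B k ⊕ p ⊛ A (suc k)            ≈⟨ B-suc k ⟨
    B (suc k)                          ∎
  A+1≈qB k = begin
    A (suc k) ⊕ 1#                     ≈⟨ +-congʳ (A-suc k) ⟩
    (q ⊛ A k ⊕ p ⊛ B k) ⊕ 1#           ≈⟨ solve 3 (λ q x y → (q :* x :+ (q :- :1) :* y) :+ :1 := (q :* x :+ :1) :+ (q :- :1) :* y) ≈-refl q (A k) (B k) ⟩
    (q ⊛ A k ⊕ 1#) ⊕ p ⊛ B k           ≈⟨ +-congʳ (qA+1≈B k) ⟩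
    B k ⊕ p ⊛ B k                      ≈⟨ solve 2 (λ q y → y :+ (q :- :1) :* y := q :* y) ≈-refl q (B k) ⟩
    q ⊛ B k                            ∎

  A+B≈q²ᵏ : ∀ k → A k ⊕ B k ≈ q²^ k
  A+B≈q²ᵏ⁺¹ : ∀ k → A (suc k) ⊕ B k ≈ q ⊛ q²^ k
  A+B≈q²ᵏ zero = solve 0 (:0 :+ ((:1 :* :1 :+ :0) :+ :0) := :1) ≈-refl
  A+B≈q²ᵏ (suc k) = begin
    A (suc k) ⊕ B (suc k)                        ≈⟨ +-congˡ (B-suc k) ⟩
    A (suc k) ⊕ (q ⊛ B k ⊕ p ⊛ A (suc k))        ≈⟨ solve 3 (λ q x y → x :+ (q :* y :+ (q :- :1) :* x) := q :* (x :+ y)) ≈-refl q (A (suc k)) (B k) ⟩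
    q ⊛ (A (suc k) ⊕ B k)                        ≈⟨ *-congˡ (A+B≈q²ᵏ⁺¹ k) ⟩
    q ⊛ (q ⊛ q²^ k)                              ≈⟨ *-assoc q q (q²^ k) ⟨
    q²^ (suc k)                                  ∎
  A+B≈q²ᵏ⁺¹ k = begin
    A (suc k) ⊕ B k                  ≈⟨ +-congʳ (A-suc k) ⟩
    (q ⊛ A k ⊕ p ⊛ B k) ⊕ B k        ≈⟨ solve 3 (λ q x y → (q :* x :+ (q :- :1) :* y) :+ y := q :* (x :+ y)) ≈-refl q (A k) (B k) ⟩
    q ⊛ (A k ⊕ B k)                  ≈⟨ *-congˡ (A+B≈q²ᵏ k) ⟩
    q ⊛ q²^ k                        ∎

-- Binomial coefficients and truncated subtraction in ℕ.

nC0≡1 : ∀ n → n C 0 ≡ 1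
nC0≡1 n = ≡.trans (nCk≡nC[n∸k] {0} {n} z≤n) (nCn≡1 n)

-- The absorption identity, by induction through Pascal's rule. It is what makes the quotient in
-- `lucas` exact.
[1+k]*[1+n]C[1+k]≡[1+n]*nCk : ∀ n k → suc k * (suc n C suc k) ≡ suc n * (n C k)
[1+k]*[1+n]C[1+k]≡[1+n]*nCk zero    zero    = refl
[1+k]*[1+n]C[1+k]≡[1+n]*nCk zero    (suc k) = ≡.trans (≡.cong (suc (suc k) *_) (k>n⇒nCk≡0 (s≤s (s≤s (z≤n {k}))))) (≡.trans (ℕₚ.*-zeroʳ (suc (suc k))) (≡.sym (≡.trans (ℕₚ.*-identityˡ _) (k>n⇒nCk≡0 (s≤s (z≤n {k}))))))
[1+k]*[1+n]C[1+k]≡[1+n]*nCk (suc n) zero    = ≡.trans (ℕₚ.*-identityˡ _) (≡.trans (nC1≡n (suc (suc n))) (≡.sym (≡.trans (≡.cong (suc (suc n) *_) (nC0≡1 (suc n))) (ℕₚ.*-identityʳ _))))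
[1+k]*[1+n]C[1+k]≡[1+n]*nCk (suc n) (suc k) = begin
  suc (suc k) * (suc (suc n) C suc (suc k))
    ≡⟨ ≡.cong (suc (suc k) *_) (nCk+nC[k+1]≡[n+1]C[k+1] (suc n) (suc k)) ⟨
  suc (suc k) * (x + y)
    ≡⟨ +-*-Solver.solve 3 (λ k x y → (con 2 :+ k) :* (x :+ y) := (x :+ (con 1 :+ k) :* x) :+ (con 2 :+ k) :* y) refl k x y ⟩
  (x + suc k * x) + suc (suc k) * y
    ≡⟨ ≡.cong₂ (λ s t → (x + s) + t) ([1+k]*[1+n]C[1+k]≡[1+n]*nCk n k) ([1+k]*[1+n]C[1+k]≡[1+n]*nCk n (suc k)) ⟩
  (x + suc n * (n C k)) + suc n * (n C suc k)
    ≡⟨ ℕₚ.+-assoc x _ _ ⟩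
  x + (suc n * (n C k) + suc n * (n C suc k))
    ≡⟨ ≡.cong (x +_) (ℕₚ.*-distribˡ-+ (suc n) (n C k) (n C suc k)) ⟨
  x + suc n * (n C k + n C suc k)
    ≡⟨ ≡.cong (λ s → x + suc n * s) (nCk+nC[k+1]≡[n+1]C[k+1] n k) ⟩
  suc (suc n) * x ∎
  where
  open ≡.≡-Reasoning
  open +-*-Solver using (con; _:+_; _:*_; _:=_)
  x y : ℕ
  x = suc n C suc k
  y = suc n C suc (suc k)

k+[1+i]∸1 : ∀ k i → k + suc i ∸ 1 ≡ k + i
k+[1+i]∸1 k i = ≡.cong (_∸ 1) (ℕₚ.+-suc k i)

2*[1+i]∸1 : ∀ i → 2 * suc i ∸ 1 ≡ suc (2 * i)
2*[1+i]∸1 i = ≡.cong (_∸ 1) (ℕₚ.*-suc 2 i)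

k+1∸[1+i] : ∀ {k i} → i < k → k + 1 ∸ suc i ≡ suc (k ∸ suc i)
k+1∸[1+i] {k} {i} i<k = ≡.trans (≡.cong (_∸ suc i) (ℕₚ.+-comm k 1)) (ℕₚ.+-∸-assoc 1 i<k)

module _ where
  open ≡.≡-Reasoning
  open +-*-Solver using (solve; con; _:+_; _:*_; _:=_)

  -- The left side is the numerator of a Lucas coefficient with denominator `suc t`; absorption
  -- turns the part with factor `suc j` into a multiple of `suc t`.
  [[1+t]+[1+j]]*[1+t]C[1+j] : ∀ t j → (suc t + suc j) * (suc t C suc j) ≡ (suc t C suc j + t C j) * suc t
  [[1+t]+[1+j]]*[1+t]C[1+j] t j = begin
    (suc t + suc j) * (suc t C suc j)                     ≡⟨ ℕₚ.*-distribʳ-+ (suc t C suc j) (suc t) (suc j) ⟩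
    suc t * (suc t C suc j) + suc j * (suc t C suc j)     ≡⟨ ≡.cong (suc t * (suc t C suc j) +_) ([1+k]*[1+n]C[1+k]≡[1+n]*nCk t j) ⟩
    suc t * (suc t C suc j) + suc t * (t C j)             ≡⟨ ℕₚ.*-distribˡ-+ (suc t) (suc t C suc j) (t C j) ⟨
    suc t * (suc t C suc j + t C j)                       ≡⟨ ℕₚ.*-comm (suc t) _ ⟩
    (suc t C suc j + t C j) * suc t                       ∎

  2*[i+d]∸i : ∀ i d → 2 * (i + d) ∸ i ≡ (i + d) + d
  2*[i+d]∸i i d = ≡.trans
    (≡.cong (_∸ i) (solve 2 (λ i d → con 2 :* (i :+ d) := i :+ (i :+ d :+ d)) refl i d))
    (ℕₚ.m+n∸m≡n i _)

  1+2*[i+d]∸i : ∀ i d → suc (2 * (i + d)) ∸ i ≡ suc ((i + d) + d)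
  1+2*[i+d]∸i i d = ≡.trans
    (≡.cong (_∸ i) (solve 2 (λ i d → con 1 :+ con 2 :* (i :+ d) := i :+ (con 1 :+ (i :+ d :+ d))) refl i d))
    (ℕₚ.m+n∸m≡n i _)

  2*[i+d]∸2*i : ∀ i d → 2 * (i + d) ∸ 2 * i ≡ 2 * d
  2*[i+d]∸2*i i d = ≡.trans (≡.cong (_∸ 2 * i) (ℕₚ.*-distribˡ-+ 2 i d)) (ℕₚ.m+n∸m≡n (2 * i) (2 * d))

  1+2*[i+d]∸2*i : ∀ i d → suc (2 * (i + d)) ∸ 2 * i ≡ suc (2 * d)
  1+2*[i+d]∸2*i i d = ≡.trans
    (≡.cong (_∸ 2 * i) (solve 2 (λ i d → con 1 :+ con 2 :* (i :+ d) := con 2 :* i :+ (con 1 :+ con 2 :* d)) refl i d))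
    (ℕₚ.m+n∸m≡n (2 * i) _)

  [i+d+d]C2d : ∀ i d → ((i + d) + d) C (2 * d) ≡ ((i + d) + d) C i
  [i+d+d]C2d i d = begin
    ((i + d) + d) C (2 * d)                    ≡⟨ ≡.cong (_C (2 * d)) eq ⟩
    (i + 2 * d) C (2 * d)                      ≡⟨ nCk≡nC[n∸k] (ℕₚ.m≤n+m (2 * d) i) ⟩
    (i + 2 * d) C (i + 2 * d ∸ 2 * d)          ≡⟨ ≡.cong₂ _C_ (≡.sym eq) (ℕₚ.m+n∸n≡m i (2 * d)) ⟩
    ((i + d) + d) C i                          ∎
    where
    eq : (i + d) + d ≡ i + 2 * d
    eq = solve 2 (λ i d → i :+ d :+ d := i :+ con 2 :* d) refl i d

  [1+i+d+d]C[1+2d] : ∀ i d → suc ((i + d) + d) C suc (2 * d) ≡ suc ((i + d) + d) C i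
  [1+i+d+d]C[1+2d] i d = begin
    suc ((i + d) + d) C suc (2 * d)                     ≡⟨ ≡.cong (_C suc (2 * d)) eq ⟩
    (i + suc (2 * d)) C suc (2 * d)                     ≡⟨ nCk≡nC[n∸k] (ℕₚ.m≤n+m (suc (2 * d)) i) ⟩
    (i + suc (2 * d)) C (i + suc (2 * d) ∸ suc (2 * d)) ≡⟨ ≡.cong₂ _C_ (≡.sym eq) (ℕₚ.m+n∸n≡m i (suc (2 * d))) ⟩
    suc ((i + d) + d) C i                               ∎
    where
    eq : suc ((i + d) + d) ≡ i + suc (2 * d)
    eq = solve 2 (λ i d → con 1 :+ (i :+ d :+ d) := i :+ (con 1 :+ con 2 :* d)) refl i d

-- Evaluation of the sums in the statement.

module ClosedForms {a ℓ : Level} (R : CommutativeRing a ℓ) (q : CommutativeRing.Carrier R) (m : ℕ) where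
  open CommutativeRing R renaming (_+_ to _⊕_; _*_ to _⊛_; refl to ≈-refl)
  open Algebra.Properties.Ring ring
  open Algebra.Properties.Semiring.Mult semiring renaming (_×_ to _⋆_)
  open Algebra.Properties.Semiring.Exp semiring
  open Relation.Binary.Reasoning.Setoid setoid
  open IntegerCoefficients R
  open Sums R
  open BinomialSums R q
  open Hecke R m q using (Σ[_⋯<_]; lucas; F₀even; F₀odd; Fηeven; Fεeven; Fηodd; Fεodd; lead)

  mutual
    Σ⋯-cong : ∀ a b {f g} → (∀ i → i < b ∸ a → f (a + i) ≈ g i) → Σ[ a ⋯< b ] f ≈ ∑ (b ∸ a) g
    Σ⋯-cong a b {f} {g} f≈g with b ∸ a
    ... | n = partialSum a b f g n f≈g

    -- The accumulator of Σ[_⋯<_] is local to it, so its name is left to unification.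
    partialSum : ∀ a b f g n → (∀ i → i < n → f (a + i) ≈ g i) → _ ≈ ∑ n g
    partialSum a b f g zero    f≈g = ≈-refl
    partialSum a b f g (suc n) f≈g =
      +-cong (f≈g n ℕₚ.≤-refl) (partialSum a b f g n (λ i i<n → f≈g i (ℕₚ.m<n⇒m<1+n i<n)))

  lucas-zero : ∀ n → lucas (suc n) 0 ≡ 1
  lucas-zero n = ≡.trans (≡.cong (ℕ._/ suc n) (≡.trans (≡.cong (suc n *_) (nC0≡1 (suc n))) (ℕₚ.*-comm (suc n) 1)))
    (m*n/n≡m 1 (suc n))

  -- The familiar form C(l-j, j) + C(l-j-1, j-1) of the Lucas coefficient. With the length written
  -- as this sum the divisor becomes `suc t`, visibly nonzero.
  lucas-suc : ∀ t j → lucas (suc t + suc j) (suc j) ≡ suc t C suc j + t C j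
  lucas-suc t j rewrite ℕₚ.m+n∸n≡m (suc t) (suc j) =
    ≡.trans (≡.cong (ℕ._/ suc t) ([[1+t]+[1+j]]*[1+t]C[1+j] t j)) (m*n/n≡m (suc t C suc j + t C j) (suc t))

  -- A term of the Fibonacci polynomial G(n+1), indexed by the exponent of `q` as in the sums for
  -- η₀, whereas `A` and `B` are indexed by the exponent of `p`.
  fibTerm : ℕ → ℕ → Carrier
  fibTerm n j = ((n ∸ j) C j) ⋆ (q ^ j ⊛ p ^ (n ∸ 2 * j))

  term-cong : ∀ {n n′ c c′ x x′ y y′} → n ≡ n′ → c ≡ c′ → x ≡ x′ → y ≡ y′ →
              (n C c) ⋆ (q ^ x ⊛ p ^ y) ≈ (n′ C c′) ⋆ (q ^ x′ ⊛ p ^ y′)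
  term-cong refl refl refl refl = ≈-refl

  fibTerm-mirror : ∀ {n n′} c c′ {x x′ y y′} → n ≡ n′ → n C c ≡ n C c′ → x ≡ x′ → y ≡ y′ →
                   (n C c) ⋆ (q ^ x ⊛ p ^ y) ≈ (n′ C c′) ⋆ (q ^ x′ ⊛ p ^ y′)
  fibTerm-mirror c c′ refl nCc≡nCc′ refl refl = ×-congˡ nCc≡nCc′

  -- The same terms in reverse order: after `i ↦ k ∸ i` the two lower indices are complementary, so
  -- the symmetry of binomial coefficients applies. Writing k = i + d removes the truncated
  -- subtractions.
  ∑fibTerm-even : ∀ k → ∑ (suc k) (fibTerm (2 * k)) ≈ B k
  ∑fibTerm-even k = sym (trans (∑-reverse (suc k) _) (∑-cong (suc k) (λ i i≤k → term i (ℕₚ.≤-pred i≤k))))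
    where
    term : ∀ i → i ≤ k → ((k + (k ∸ i)) C (2 * (k ∸ i))) ⋆ (q ^ (k ∸ (k ∸ i)) ⊛ p ^ (2 * (k ∸ i))) ≈ fibTerm (2 * k) i
    term i i≤k with ℕₚ.m≤n⇒∃[o]m+o≡n i≤k
    ... | d , refl rewrite ℕₚ.m+n∸m≡n i d =
      fibTerm-mirror (2 * d) i (≡.sym (2*[i+d]∸i i d)) ([i+d+d]C2d i d) (ℕₚ.m+n∸n≡m i d) (≡.sym (2*[i+d]∸2*i i d))

  ∑fibTerm-odd : ∀ k → ∑ (suc k) (fibTerm (suc (2 * k))) ≈ A (suc k)
  ∑fibTerm-odd k = sym (trans (∑-reverse (suc k) _) (∑-cong (suc k) (λ i i≤k → term i (ℕₚ.≤-pred i≤k))))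
    where
    term : ∀ i → i ≤ k → (suc (k + (k ∸ i)) C suc (2 * (k ∸ i))) ⋆ (q ^ (k ∸ (k ∸ i)) ⊛ p ^ suc (2 * (k ∸ i))) ≈ fibTerm (suc (2 * k)) i
    term i i≤k with ℕₚ.m≤n⇒∃[o]m+o≡n i≤k
    ... | d , refl rewrite ℕₚ.m+n∸m≡n i d =
      fibTerm-mirror (suc (2 * d)) i (≡.sym (1+2*[i+d]∸i i d)) ([1+i+d+d]C[1+2d] i d) (ℕₚ.m+n∸n≡m i d) (≡.sym (1+2*[i+d]∸2*i i d))

  -- The polynomial identity L(n+2) = G(n+3) + q G(n+1): the two binomials of `lucas-suc` feed the
  -- two sums, the second one shifted by one index. The bound i ≤ n makes the subtractions genuine.
  ∑lucas : ∀ n k → (∀ i → i < k → i ≤ n) →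
    ∑ (suc k) (λ j → lucas (2 + n) j ⋆ (q ^ j ⊛ p ^ (2 + n ∸ 2 * j)))
      ≈ ∑ (suc k) (fibTerm (2 + n)) ⊕ q ⊛ ∑ k (fibTerm n)
  ∑lucas n k k≤n = begin
    ∑ (suc k) l                                                     ≈⟨ ∑-first k l ⟩
    l 0 ⊕ ∑ k (l ∘ suc)                                             ≈⟨ +-cong (×-congˡ (≡.trans (lucas-zero (suc n)) (≡.sym (nC0≡1 (2 + n))))) (∑-cong k (λ i i<k → term i (k≤n i i<k))) ⟩
    f 0 ⊕ ∑ k (λ i → f (suc i) ⊕ q ⊛ fibTerm n i)                   ≈⟨ +-congˡ (trans (∑-+ k _ _) (+-congˡ (∑-*ˡ k q _))) ⟩
    f 0 ⊕ (∑ k (f ∘ suc) ⊕ q ⊛ ∑ k (fibTerm n))                     ≈⟨ trans (sym (+-assoc _ _ _)) (+-congʳ (sym (∑-first k f))) ⟩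
    ∑ (suc k) f ⊕ q ⊛ ∑ k (fibTerm n)                               ∎
    where
    l f : ℕ → Carrier
    l j = lucas (2 + n) j ⋆ (q ^ j ⊛ p ^ (2 + n ∸ 2 * j))
    f = fibTerm (2 + n)
    lucas≡ : ∀ i → i ≤ n → lucas (2 + n) (suc i) ≡ (suc n ∸ i) C suc i + (n ∸ i) C i
    lucas≡ i i≤n with ℕₚ.m≤n⇒∃[o]m+o≡n i≤n
    ... | t , refl = ≡.trans (≡.cong (λ x → lucas x (suc i)) (≡.cong suc (≡.trans (≡.cong suc (ℕₚ.+-comm i t)) (≡.sym (ℕₚ.+-suc t i)))))
      (≡.trans (lucas-suc t i) (≡.cong₂ (λ x y → x C suc i + y C i)
        (≡.sym (≡.trans (≡.cong (_∸ i) (≡.sym (ℕₚ.+-suc i t))) (ℕₚ.m+n∸m≡n i (suc t)))) (≡.sym (ℕₚ.m+n∸m≡n i t))))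
    term : ∀ i → i ≤ n → l (suc i) ≈ f (suc i) ⊕ q ⊛ fibTerm n i
    term i i≤n = begin
      l (suc i)
        ≈⟨ ×-congˡ (lucas≡ i i≤n) ⟩
      ((suc n ∸ i) C suc i + (n ∸ i) C i) ⋆ (q ^ suc i ⊛ p ^ (2 + n ∸ 2 * suc i))
        ≈⟨ ×-homo-+ _ ((suc n ∸ i) C suc i) ((n ∸ i) C i) ⟩
      f (suc i) ⊕ ((n ∸ i) C i) ⋆ (q ^ suc i ⊛ p ^ (2 + n ∸ 2 * suc i))
        ≈⟨ +-congˡ (⋆-factor ((n ∸ i) C i) (trans (*-assoc _ _ _) (*-congˡ (*-congˡ (reflexive (≡.cong (λ x → p ^ (2 + n ∸ x)) (ℕₚ.*-suc 2 i))))))) ⟩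
      f (suc i) ⊕ q ⊛ fibTerm n i ∎

  lucas-2k-k : ∀ k → lucas (2 * suc k) (suc k) ≡ 2
  lucas-2k-k k = ≡.trans (≡.cong (λ n → lucas (suc k + n) (suc k)) (ℕₚ.+-identityʳ (suc k)))
    (≡.trans (lucas-suc k k) (≡.cong₂ _+_ (nCn≡1 (suc k)) (nCn≡1 k)))

  lucas-[2k+1]-k : ∀ k → lucas (2 * suc k + 1) (suc k) ≡ 2 * suc k + 1
  lucas-[2k+1]-k k = ≡.trans (≡.cong (λ n → lucas n (suc k)) eq)
    (≡.trans (lucas-suc (suc k) k) (≡.trans (≡.cong₂ _+_ ([1+n]Cn (suc k)) ([1+n]Cn k)) (≡.trans (ℕₚ.+-suc (suc (suc k)) k) (≡.sym (≡.trans eq (ℕₚ.+-suc (suc (suc k)) k))))))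
    where
    eq : 2 * suc k + 1 ≡ suc (suc k) + suc k
    eq = ≡.trans (ℕₚ.+-comm (2 * suc k) 1) (≡.cong (λ n → suc (suc k + n)) (ℕₚ.+-identityʳ (suc k)))
    [1+n]Cn : ∀ n → suc n C n ≡ suc n
    [1+n]Cn n = ≡.trans (nCk≡nC[n∸k] (ℕₚ.n≤1+n n)) (≡.trans (≡.cong (suc n C_) (ℕₚ.m+n∸n≡m 1 n)) (nC1≡n (suc n)))

  -- The full Lucas sum is q^(2k) + 1. The sum in the statement stops just short of its last term,
  -- which is 2 q^k. The right side is grouped as the values of η_c and ε_c.
  F₀even-closed : ∀ k → 1 ≤ k → F₀even k ≈ (q²^ k - q ^ k) ⊕ (1# - q ^ k)
  F₀even-closed (suc k) _ = begin
    F₀even (suc k)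
      ≈⟨ Σ⋯-cong 0 (suc k) (λ _ _ → ≈-refl) ⟩
    ∑ (suc k) l
      ≈⟨ solve 2 (λ x s → s := (x :+ s) :- x) ≈-refl (l (suc k)) _ ⟩
    ∑ (2 + k) l - l (suc k)
      ≈⟨ +-cong total (-‿cong top) ⟩
    (q²^ (suc k) ⊕ 1#) - (q ^ suc k ⊕ q ^ suc k)
      ≈⟨ solve 2 (λ s x → (s :+ :1) :- (x :+ x) := (s :- x) :+ (:1 :- x)) ≈-refl (q²^ (suc k)) (q ^ suc k) ⟩
    (q²^ (suc k) - q ^ suc k) ⊕ (1# - q ^ suc k) ∎
    where
    l : ℕ → Carrier
    l j = lucas (2 * suc k) j ⋆ (q ^ j ⊛ p ^ (2 * suc k ∸ 2 * j))
    top : l (suc k) ≈ q ^ suc k ⊕ q ^ suc k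
    top = begin
      l (suc k)                                       ≈⟨ ×-cong (lucas-2k-k k) (*-congˡ (reflexive (≡.cong (p ^_) (ℕₚ.n∸n≡0 (2 * suc k))))) ⟩
      2 ⋆ (q ^ suc k ⊛ 1#)                            ≈⟨ solve 1 (λ x → x :* :1 :+ (x :* :1 :+ :0) := x :+ x) ≈-refl (q ^ suc k) ⟩
      q ^ suc k ⊕ q ^ suc k                           ∎
    total : ∑ (2 + k) l ≈ q²^ (suc k) ⊕ 1#
    total = begin
      ∑ (2 + k) l
        ≈⟨ reflexive (≡.cong (λ n → ∑ (2 + k) (λ j → lucas n j ⋆ (q ^ j ⊛ p ^ (n ∸ 2 * j)))) (ℕₚ.*-suc 2 k)) ⟩
      ∑ (2 + k) (λ j → lucas (2 + 2 * k) j ⋆ (q ^ j ⊛ p ^ (2 + 2 * k ∸ 2 * j)))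
        ≈⟨ ∑lucas (2 * k) (suc k) (λ i i<1+k → ℕₚ.≤-trans (ℕₚ.≤-pred i<1+k) (ℕₚ.m≤m+n k _)) ⟩
      ∑ (2 + k) (fibTerm (2 + 2 * k)) ⊕ q ⊛ ∑ (suc k) (fibTerm (2 * k))
        ≈⟨ +-cong (reflexive (≡.cong (λ n → ∑ (2 + k) (fibTerm n)) (≡.sym (ℕₚ.*-suc 2 k)))) (*-congˡ (∑fibTerm-even k)) ⟩
      ∑ (2 + k) (fibTerm (2 * suc k)) ⊕ q ⊛ B k
        ≈⟨ +-cong (∑fibTerm-even (suc k)) (sym (A+1≈qB k)) ⟩
      B (suc k) ⊕ (A (suc k) ⊕ 1#)
        ≈⟨ solve 2 (λ x y → y :+ (x :+ :1) := (x :+ y) :+ :1) ≈-refl (A (suc k)) (B (suc k)) ⟩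
      (A (suc k) ⊕ B (suc k)) ⊕ 1#
        ≈⟨ +-congʳ (A+B≈q²ᵏ (suc k)) ⟩
      q²^ (suc k) ⊕ 1# ∎

  -- Here the full Lucas sum is q^(2k+1) - 1, and the omitted term j = k has the coefficient 2k+1.
  F₀odd-closed : ∀ k → F₀odd k ≈ (m ⋆ q ^ (k + 1) - m ⋆ q ^ k) ⊕ ((q ⊛ q²^ k - 1#) - (2 * k + 1) ⋆ (q ^ k ⊛ p))
  F₀odd-closed zero = +-congˡ (solve 1 (λ q → :0 := (q :* :1 :- :1) :- (:1 :* (q :- :1) :+ :0)) ≈-refl q)
  F₀odd-closed (suc k) = +-congˡ (begin
    Σ[ 0 ⋯< suc k ] l
      ≈⟨ Σ⋯-cong 0 (suc k) (λ _ _ → ≈-refl) ⟩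
    ∑ (suc k) l
      ≈⟨ solve 2 (λ x s → s := (x :+ s) :- x) ≈-refl (l (suc k)) _ ⟩
    ∑ (2 + k) l - l (suc k)
      ≈⟨ +-cong total (-‿cong top) ⟩
    (q ⊛ q²^ (suc k) - 1#) - (2 * suc k + 1) ⋆ (q ^ suc k ⊛ p) ∎)
    where
    l : ℕ → Carrier
    l j = lucas (2 * suc k + 1) j ⋆ (q ^ j ⊛ p ^ (2 * suc k + 1 ∸ 2 * j))
    2k+3 : 2 * suc k + 1 ≡ 2 + suc (2 * k)
    2k+3 = ≡.trans (ℕₚ.+-comm (2 * suc k) 1) (≡.cong suc (ℕₚ.*-suc 2 k))
    top : l (suc k) ≈ (2 * suc k + 1) ⋆ (q ^ suc k ⊛ p)
    top = ×-cong (lucas-[2k+1]-k k) (*-congˡ (trans (reflexive (≡.cong (p ^_) (ℕₚ.m+n∸m≡n (2 * suc k) 1))) (*-identityʳ p)))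
    total : ∑ (2 + k) l ≈ q ⊛ q²^ (suc k) - 1#
    total = begin
      ∑ (2 + k) l
        ≈⟨ reflexive (≡.cong (λ n → ∑ (2 + k) (λ j → lucas n j ⋆ (q ^ j ⊛ p ^ (n ∸ 2 * j)))) 2k+3) ⟩
      ∑ (2 + k) (λ j → lucas (2 + suc (2 * k)) j ⋆ (q ^ j ⊛ p ^ (2 + suc (2 * k) ∸ 2 * j)))
        ≈⟨ ∑lucas (suc (2 * k)) (suc k) (λ i i<1+k → ℕₚ.≤-trans (ℕₚ.<⇒≤ i<1+k) (s≤s (ℕₚ.m≤m+n k _))) ⟩
      ∑ (2 + k) (fibTerm (2 + suc (2 * k))) ⊕ q ⊛ ∑ (suc k) (fibTerm (suc (2 * k)))
        ≈⟨ +-cong (reflexive (≡.cong (λ n → ∑ (2 + k) (fibTerm (suc n))) (≡.sym (ℕₚ.*-suc 2 k)))) (*-congˡ (∑fibTerm-odd k)) ⟩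
      ∑ (2 + k) (fibTerm (suc (2 * suc k))) ⊕ q ⊛ A (suc k)
        ≈⟨ +-congʳ (∑fibTerm-odd (suc k)) ⟩
      A (2 + k) ⊕ q ⊛ A (suc k)
        ≈⟨ solve 2 (λ x y → x :+ y := (x :+ (y :+ :1)) :- :1) ≈-refl _ _ ⟩
      (A (2 + k) ⊕ (q ⊛ A (suc k) ⊕ 1#)) - 1#
        ≈⟨ +-congʳ (trans (+-congˡ (qA+1≈B (suc k))) (A+B≈q²ᵏ⁺¹ (suc k))) ⟩
      q ⊛ q²^ (suc k) - 1# ∎

  private
    <⇒< : ∀ k {i} → i < k + 1 ∸ 1 → i < k
    <⇒< k {i} = ≡.subst (i <_) (ℕₚ.m+n∸n≡m k 1)

    ∑[k+1∸1] : ∀ k f → ∑ (k + 1 ∸ 1) f ≈ ∑ k f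
    ∑[k+1∸1] k f = reflexive (≡.cong (λ n → ∑ n f) (ℕₚ.m+n∸n≡m k 1))

    b : ℕ → ℕ → Carrier
    b k i = ((k + i) C (2 * i)) ⋆ (q ^ (k ∸ i) ⊛ p ^ (2 * i))

    b-zero : ∀ k → b k 0 ≈ q ^ k
    b-zero k = trans (×-congˡ (nC0≡1 (k + 0))) (solve 1 (λ x → x :* :1 :+ :0 := x) ≈-refl (q ^ k))

  qA-sum : ∀ k → Σ[ 1 ⋯< k + 1 ] (λ j → ((k + j ∸ 1) C (2 * j ∸ 1)) ⋆ (q ^ (k + 1 ∸ j) ⊛ p ^ (2 * j ∸ 1))) ≈ q ⊛ A k
  qA-sum k = trans (Σ⋯-cong 1 (k + 1) (λ i i< → term i (<⇒< k i<))) (trans (∑[k+1∸1] k _) (∑-*ˡ k q _))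
    where
    term : ∀ i → i < k → ((k + suc i ∸ 1) C (2 * suc i ∸ 1)) ⋆ (q ^ (k + 1 ∸ suc i) ⊛ p ^ (2 * suc i ∸ 1))
                         ≈ q ⊛ (((k + i) C suc (2 * i)) ⋆ (q ^ (k ∸ suc i) ⊛ p ^ suc (2 * i)))
    term i i<k = trans (term-cong (k+[1+i]∸1 k i) (2*[1+i]∸1 i) (k+1∸[1+i] i<k) (2*[1+i]∸1 i))
      (⋆-factor ((k + i) C suc (2 * i)) (*-assoc _ _ _))

  A-sum : ∀ k → Σ[ 1 ⋯< k + 1 ] (λ j → ((k + j ∸ 1) C (2 * j ∸ 1)) ⋆ (q ^ (k ∸ j) ⊛ p ^ (2 * j ∸ 1))) ≈ A k
  A-sum k = trans (Σ⋯-cong 1 (k + 1) (λ i _ → term-cong {x = k ∸ suc i} (k+[1+i]∸1 k i) (2*[1+i]∸1 i) refl (2*[1+i]∸1 i))) (∑[k+1∸1] k _)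

  -- The added power of `q` is the absent term j = 0; with it the sum runs over the full range of
  -- `B k`.
  qB-sum : ∀ k → Σ[ 1 ⋯< suc k ] (λ j → ((suc k + j ∸ 1) C (2 * j)) ⋆ (q ^ (suc k ∸ j) ⊛ p ^ (2 * j))) ⊕ q ^ suc k ≈ q ⊛ B k
  qB-sum k = begin
    Σ[ 1 ⋯< suc k ] _ ⊕ q ^ suc k                 ≈⟨ +-congʳ (trans (Σ⋯-cong 1 (suc k) term) (∑-*ˡ k q _)) ⟩
    q ⊛ ∑ k (b k ∘ suc) ⊕ q ⊛ q ^ k               ≈⟨ solve 3 (λ q x s → q :* s :+ q :* x := q :* (x :+ s)) ≈-refl q (q ^ k) _ ⟩
    q ⊛ (q ^ k ⊕ ∑ k (b k ∘ suc))                 ≈⟨ *-congˡ (trans (+-congʳ (sym (b-zero k))) (sym (∑-first k (b k)))) ⟩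
    q ⊛ B k                                       ∎
    where
    term : ∀ i → i < k → ((k + suc i) C (2 * suc i)) ⋆ (q ^ (k ∸ i) ⊛ p ^ (2 * suc i)) ≈ q ⊛ b k (suc i)
    term i i<k = trans (term-cong {n = k + suc i} {c = 2 * suc i} {y = 2 * suc i} refl refl (ℕₚ.+-∸-assoc 1 i<k) refl)
      (⋆-factor ((k + suc i) C (2 * suc i)) (*-assoc _ _ _))

  -- The added multiple of `q ^ k ⊛ p` is the absent term j = 1, whose coefficient is C(k, 1) = k.
  -- The leading terms in the statement have absorbed it.
  qA-sum-tail : ∀ k → Σ[ 2 ⋯< k + 1 ] (λ j → ((k + j ∸ 1) C (2 * j ∸ 1)) ⋆ (q ^ (k + 1 ∸ j) ⊛ p ^ (2 * j ∸ 1))) ⊕ k ⋆ (q ^ k ⊛ p) ≈ q ⊛ A k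
  qA-sum-tail zero    = solve 1 (λ q → :0 :+ :0 := q :* :0) ≈-refl q
  qA-sum-tail (suc k) = begin
    Σ[ 2 ⋯< suc k + 1 ] _ ⊕ suc k ⋆ (q ^ suc k ⊛ p)
      ≈⟨ +-cong (trans (Σ⋯-cong 2 (suc k + 1) (λ i i< → term i (<⇒< k i<))) (trans (∑[k+1∸1] k _) (∑-*ˡ k q _))) first ⟩
    q ⊛ ∑ k (a′ ∘ suc) ⊕ q ⊛ a′ 0
      ≈⟨ solve 3 (λ q x s → q :* s :+ q :* x := q :* (x :+ s)) ≈-refl q (a′ 0) _ ⟩
    q ⊛ (a′ 0 ⊕ ∑ k (a′ ∘ suc))
      ≈⟨ *-congˡ (∑-first k a′) ⟨
    q ⊛ A (suc k) ∎
    where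
    a′ : ℕ → Carrier
    a′ i = ((suc k + i) C suc (2 * i)) ⋆ (q ^ (k ∸ i) ⊛ p ^ suc (2 * i))
    first : suc k ⋆ (q ^ suc k ⊛ p) ≈ q ⊛ a′ 0
    first = trans (×-cong (≡.sym (≡.trans (≡.cong (_C 1) (ℕₚ.+-identityʳ (suc k))) (nC1≡n (suc k)))) (*-congˡ (sym (*-identityʳ p))))
      (⋆-factor ((suc k + 0) C 1) (*-assoc q (q ^ k) _))
    term : ∀ i → i < k → ((suc k + (2 + i) ∸ 1) C (2 * (2 + i) ∸ 1)) ⋆ (q ^ (suc k + 1 ∸ (2 + i)) ⊛ p ^ (2 * (2 + i) ∸ 1)) ≈ q ⊛ a′ (suc i)
    term i i<k = trans (term-cong {x = suc k + 1 ∸ (2 + i)} (k+[1+i]∸1 (suc k) (suc i)) (2*[1+i]∸1 (suc i)) (k+1∸[1+i] i<k) (2*[1+i]∸1 (suc i)))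
      (⋆-factor ((suc k + suc i) C suc (2 * suc i)) (*-assoc _ _ _))

  qB-sum-tail : ∀ k → Σ[ 1 ⋯< k + 1 ] (λ j → ((k + j) C (2 * j)) ⋆ (q ^ (k + 1 ∸ j) ⊛ p ^ (2 * j))) ⊕ q ⊛ q ^ k ≈ q ⊛ B k
  qB-sum-tail k = begin
    Σ[ 1 ⋯< k + 1 ] _ ⊕ q ⊛ q ^ k               ≈⟨ +-congʳ (trans (Σ⋯-cong 1 (k + 1) (λ i i< → term i (<⇒< k i<))) (trans (∑[k+1∸1] k _) (∑-*ˡ k q _))) ⟩
    q ⊛ ∑ k (b k ∘ suc) ⊕ q ⊛ q ^ k             ≈⟨ solve 3 (λ q x s → q :* s :+ q :* x := q :* (x :+ s)) ≈-refl q (q ^ k) _ ⟩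
    q ⊛ (q ^ k ⊕ ∑ k (b k ∘ suc))               ≈⟨ *-congˡ (trans (+-congʳ (sym (b-zero k))) (sym (∑-first k (b k)))) ⟩
    q ⊛ B k                                     ∎
    where
    term : ∀ i → i < k → ((k + suc i) C (2 * suc i)) ⋆ (q ^ (k + 1 ∸ suc i) ⊛ p ^ (2 * suc i)) ≈ q ⊛ b k (suc i)
    term i i<k = trans (term-cong {n = k + suc i} {c = 2 * suc i} {y = 2 * suc i} refl refl (k+1∸[1+i] i<k) refl)
      (⋆-factor ((k + suc i) C (2 * suc i)) (*-assoc _ _ _))

  B-sum-tail : ∀ k → Σ[ 1 ⋯< k + 1 ] (λ j → ((k + j) C (2 * j)) ⋆ (q ^ (k ∸ j) ⊛ p ^ (2 * j))) ⊕ q ^ k ≈ B k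
  B-sum-tail k = begin
    Σ[ 1 ⋯< k + 1 ] _ ⊕ q ^ k       ≈⟨ +-cong (trans (Σ⋯-cong 1 (k + 1) (λ _ _ → ≈-refl)) (∑[k+1∸1] k (b k ∘ suc))) (sym (b-zero k)) ⟩
    ∑ k (b k ∘ suc) ⊕ b k 0         ≈⟨ trans (+-comm _ _) (sym (∑-first k (b k))) ⟩
    B k                             ∎

  Fηeven-closed : ∀ k → 1 ≤ k → Fηeven k ≈ q²^ k - q ^ k
  Fηeven-closed (suc k) _ = begin
    Fηeven (suc k)
      ≈⟨ solve 3 (λ x y z → x :+ y := (x :+ (y :+ z)) :- z) ≈-refl _ _ (q ^ suc k) ⟩
    _ - q ^ suc k
      ≈⟨ +-congʳ (+-cong (qA-sum (suc k)) (trans (qB-sum k) (sym (A+1≈qB k)))) ⟩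
    (q ⊛ A (suc k) ⊕ (A (suc k) ⊕ 1#)) - q ^ suc k
      ≈⟨ +-congʳ (solve 2 (λ x y → x :+ (y :+ :1) := y :+ (x :+ :1)) ≈-refl _ _) ⟩
    (A (suc k) ⊕ (q ⊛ A (suc k) ⊕ 1#)) - q ^ suc k
      ≈⟨ +-congʳ (trans (+-congˡ (qA+1≈B (suc k))) (A+B≈q²ᵏ (suc k))) ⟩
    q²^ (suc k) - q ^ suc k ∎

  Fεeven-closed : ∀ k → 1 ≤ k → Fεeven k ≈ 1# - q ^ k
  Fεeven-closed (suc k) _ = begin
    Fεeven (suc k)
      ≈⟨ solve 3 (λ x y z → (:- x) :+ y := ((y :+ z) :- x) :- z) ≈-refl _ _ (q ^ suc k) ⟩
    _ - q ^ suc k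
      ≈⟨ +-congʳ (+-cong (trans (qB-sum k) (sym (A+1≈qB k))) (-‿cong (A-sum (suc k)))) ⟩
    ((A (suc k) ⊕ 1#) - A (suc k)) - q ^ suc k
      ≈⟨ +-congʳ (solve 1 (λ x → (x :+ :1) :- x := :1) ≈-refl _) ⟩
    1# - q ^ suc k ∎

  Fηodd-closed : ∀ x k → Fηodd x k ≈ x ⊕ ((q ⊛ q²^ k - q ⊛ q ^ k) - k ⋆ (q ^ k ⊛ p))
  Fηodd-closed x k = begin
    Fηodd x k
      ≈⟨ solve 5 (λ x s t y z → x :+ s :+ t := x :+ (((s :+ y) :+ (t :+ z) :- z) :- y)) ≈-refl x _ _ (k ⋆ (q ^ k ⊛ p)) (q ⊛ q ^ k) ⟩
    x ⊕ ((_ - q ⊛ q ^ k) - k ⋆ (q ^ k ⊛ p))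
      ≈⟨ +-congˡ (+-congʳ (+-congʳ (trans (+-cong (qA-sum-tail k) (qB-sum-tail k)) (trans (sym (distribˡ q (A k) (B k))) (*-congˡ (A+B≈q²ᵏ k)))))) ⟩
    x ⊕ ((q ⊛ q²^ k - q ⊛ q ^ k) - k ⋆ (q ^ k ⊛ p)) ∎

  Fεodd-closed : ∀ x k → Fεodd x k ≈ x ⊕ ((q ^ k - 1#) - k ⋆ (q ^ k ⊛ p))
  Fεodd-closed x k = begin
    Fεodd x k
      ≈⟨ solve 5 (λ x s t y z → x :+ s :- t := x :+ ((z :- ((t :+ z) :- (s :+ y))) :- y)) ≈-refl x _ _ (k ⋆ (q ^ k ⊛ p)) (q ^ k) ⟩
    x ⊕ ((q ^ k - (_ - _)) - k ⋆ (q ^ k ⊛ p))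
      ≈⟨ +-congˡ (+-congʳ (+-congˡ (-‿cong (+-cong (trans (B-sum-tail k) (sym (qA+1≈B k))) (-‿cong (qA-sum-tail k)))))) ⟩
    x ⊕ ((q ^ k - ((q ⊛ A k ⊕ 1#) - q ⊛ A k)) - k ⋆ (q ^ k ⊛ p))
      ≈⟨ solve 4 (λ x z s y → x :+ ((z :- ((s :+ :1) :- s)) :- y) := x :+ ((z :- :1) :- y)) ≈-refl x (q ^ k) (q ⊛ A k) (k ⋆ (q ^ k ⊛ p)) ⟩
    x ⊕ ((q ^ k - 1#) - k ⋆ (q ^ k ⊛ p)) ∎

-- Letters of alternating words.

other-involutive : ∀ s → other (other s) ≡ s
other-involutive s₁ = refl
other-involutive s₂ = refl

other-≢ : ∀ s → other s ≢ s
other-≢ s₁ ()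
other-≢ s₂ ()

≢⇒≡other : ∀ {s t} → s ≢ t → s ≡ other t
≢⇒≡other {s₁} {s₁} s≢t = contradiction refl s≢t
≢⇒≡other {s₁} {s₂} s≢t = refl
≢⇒≡other {s₂} {s₁} s≢t = refl
≢⇒≡other {s₂} {s₂} s≢t = contradiction refl s≢t

-- Positions count from 0, so `letter s k` is the middle letter of the alternating word of length
-- 2k+1 that starts with `s`.
letter : Gen → ℕ → Gen
letter s zero    = s
letter s (suc n) = other (letter s n)

letter-other : ∀ s n → letter (other s) n ≡ letter s (suc n)
letter-other s zero    = refl
letter-other s (suc n) = ≡.cong other (letter-other s n)

letter-+ : ∀ s m n → letter s (m + n) ≡ letter (letter s m) n
letter-+ s zero    n = refl
letter-+ s (suc m) n = ≡.trans (≡.cong other (letter-+ s m n)) (≡.sym (letter-other (letter s m) n))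

letter-2* : ∀ s k → letter s (2 * k) ≡ s
letter-2* s zero    = refl
letter-2* s (suc k) = ≡.trans (≡.cong (letter s) (ℕₚ.*-suc 2 k)) (≡.trans (other-involutive _) (letter-2* s k))

i+[1+2*[1+s]] : ∀ i s → i + suc (2 * suc s) ≡ 2 + (i + suc (2 * s))
i+[1+2*[1+s]] i s = ≡.trans (≡.cong (λ x → i + suc x) (ℕₚ.*-suc 2 s)) (≡.trans (ℕₚ.+-suc i _) (≡.cong suc (ℕₚ.+-suc i _)))

2*[i+1+s] : ∀ i s → 2 * (i + suc s) ≡ i + suc (i + suc (2 * s))
2*[i+1+s] i s = solve 2 (λ i s → con 2 :* (i :+ (con 1 :+ s)) := i :+ (con 1 :+ (i :+ (con 1 :+ con 2 :* s)))) refl i s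
  where open +-*-Solver

-- The module induced from H_c as a path with N + 1 vertices.

module PathModule {a ℓ : Level} (R : CommutativeRing a ℓ)
  (q ρ : CommutativeRing.Carrier R) (N : ℕ) (c : Gen) where
  open CommutativeRing R renaming (_+_ to _⊕_; _*_ to _⊛_; refl to ≈-refl)
  open Algebra.Properties.Ring ring
  open Algebra.Properties.Semiring.Mult semiring renaming (_×_ to _⋆_)
  open Algebra.Properties.Semiring.Exp semiring
  open Relation.Binary.Reasoning.Setoid setoid
  open IntegerCoefficients R
  open Sums R

  p : Carrier
  p = q - 1#

  Vect : Set a
  Vect = ℕ → Carrier

  infix 4 _≋_
  _≋_ : Vect → Vect → Set ℓ
  f ≋ g = ∀ l → l ≤ N → f l ≈ g l

  -- The first letter of the minimal representative of length l, hence the one that steps from l to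
  -- l - 1. At l = 0 it is `c`, which fixes the vertex; at l = N it is the opposite letter that does
  -- so.
  downLetter : ℕ → Gen
  downLetter = letter c

  up down : Vect → Vect
  up f l with l ℕₚ.<? N
  ... | yes _ = q ⊛ f (suc l)
  ... | no  _ = ρ ⊛ f l
  down f zero    = ρ ⊛ f 0
  down f (suc l) = f l ⊕ p ⊛ f (suc l)

  -- The transpose of T_s on the induced module, whose basis T_{d_0}, …, T_{d_N}
  -- is a path; only the entries f 0, …, f N are meaningful.
  act : Gen → Vect → Vect
  act s f l with s ≟G downLetter l
  ... | yes _ = down f l
  ... | no  _ = up f l

  altAct : Gen → ℕ → Vect → Vect
  altAct s zero    f = f
  altAct s (suc n) f = act s (altAct (other s) n f)

  up-< : ∀ f {l} → l < N → up f l ≡ q ⊛ f (suc l)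
  up-< f {l} l<N with l ℕₚ.<? N
  ... | yes _   = refl
  ... | no  l≮N = contradiction l<N l≮N

  up-top : ∀ f → up f N ≡ ρ ⊛ f N
  up-top f with N ℕₚ.<? N
  ... | yes N<N = contradiction N<N (ℕₚ.<-irrefl refl)
  ... | no  _   = refl

  act-down : ∀ {s} f l → s ≡ downLetter l → act s f l ≡ down f l
  act-down {s} f l s≡ with s ≟G downLetter l
  ... | yes _  = refl
  ... | no  s≢ = contradiction s≡ s≢

  act-up : ∀ {s} f l → s ≡ other (downLetter l) → act s f l ≡ up f l
  act-up {s} f l s≡ with s ≟G downLetter l
  ... | yes s≡′ = contradiction (≡.trans (≡.sym s≡) s≡′) (other-≢ (downLetter l))
  ... | no  _   = refl

  -- Linearity only up to `≋`: the entries 0, ..., N of `F f` are determined by those of `f`, so `F`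
  -- has a finite matrix in the basis `δ 0`, ..., `δ N`, and the cyclicity of the trace can be read
  -- off from it.
  record IsLinear (F : Vect → Vect) : Set (a ⊔ ℓ) where
    field
      cong    : ∀ {f g} → f ≋ g → F f ≋ F g
      +-homo  : ∀ f g → F (λ l → f l ⊕ g l) ≋ (λ l → F f l ⊕ F g l)
      ⊛-homo  : ∀ x f → F (λ l → x ⊛ f l) ≋ (λ l → x ⊛ F f l)

    0-homo : F (λ _ → 0#) ≋ (λ _ → 0#)
    0-homo l l≤N = trans (cong (λ _ _ → sym (zeroˡ 0#)) l l≤N) (trans (⊛-homo 0# _ l l≤N) (zeroˡ _))

    ∑-homo : ∀ n (x : Vect) (f : ℕ → Vect) → F (λ l → ∑ n (λ j → x j ⊛ f j l)) ≋ (λ l → ∑ n (λ j → x j ⊛ F (f j) l))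
    ∑-homo zero    x f l l≤N = 0-homo l l≤N
    ∑-homo (suc n) x f l l≤N = trans (+-homo _ _ l l≤N) (+-cong (⊛-homo (x n) (f n) l l≤N) (∑-homo n x f l l≤N))

    matrix : ∀ f → F f ≋ (λ l → ∑ (suc N) (λ j → f j ⊛ F (δ j) l))
    matrix f l l≤N = trans (cong (λ i i≤N → sym (∑-δ (suc N) f (s≤s i≤N))) l l≤N) (∑-homo (suc N) f δ l l≤N)

  open IsLinear

  act-linear : ∀ s → IsLinear (act s)
  act-linear s = record { cong = act-cong ; +-homo = act-+ ; ⊛-homo = act-⊛ }
    where
    act-cong : ∀ {f g} → f ≋ g → act s f ≋ act s g
    act-cong f≋g l l≤N with s ≟G downLetter l
    act-cong f≋g zero    l≤N   | yes _ = *-congˡ (f≋g 0 l≤N)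
    act-cong f≋g (suc l) 1+l≤N | yes _ = +-cong (f≋g l (ℕₚ.<⇒≤ 1+l≤N)) (*-congˡ (f≋g (suc l) 1+l≤N))
    act-cong f≋g l       l≤N   | no  _ with l ℕₚ.<? N
    ... | yes l<N = *-congˡ (f≋g (suc l) l<N)
    ... | no  _   = *-congˡ (f≋g l l≤N)
    act-+ : ∀ f g → act s (λ l → f l ⊕ g l) ≋ (λ l → act s f l ⊕ act s g l)
    act-+ f g l l≤N with s ≟G downLetter l
    act-+ f g zero    l≤N | yes _ = distribˡ _ _ _
    act-+ f g (suc l) l≤N | yes _ =
      solve 5 (λ p x y s t → (x :+ y) :+ p :* (s :+ t) := (x :+ p :* s) :+ (y :+ p :* t)) ≈-refl p (f l) (g l) (f (suc l)) (g (suc l))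
    act-+ f g l       l≤N | no  _ with l ℕₚ.<? N
    ... | yes _ = distribˡ _ _ _
    ... | no  _ = distribˡ _ _ _
    act-⊛ : ∀ x f → act s (λ l → x ⊛ f l) ≋ (λ l → x ⊛ act s f l)
    act-⊛ x f l l≤N with s ≟G downLetter l
    act-⊛ x f zero    l≤N | yes _ = x∙yz≈y∙xz ρ x (f 0)
      where open Algebra.Properties.CommutativeSemigroup *-commutativeSemigroup using (x∙yz≈y∙xz)
    act-⊛ x f (suc l) l≤N | yes _ =
      solve 4 (λ p x s t → x :* s :+ p :* (x :* t) := x :* (s :+ p :* t)) ≈-refl p x (f l) (f (suc l))
    act-⊛ x f l       l≤N | no  _ with l ℕₚ.<? N
    ... | yes _ = solve 3 (λ q x s → q :* (x :* s) := x :* (q :* s)) ≈-refl q x (f (suc l))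
    ... | no  _ = solve 3 (λ q x s → q :* (x :* s) := x :* (q :* s)) ≈-refl ρ x (f l)

  ∘-linear : ∀ {F G} → IsLinear F → IsLinear G → IsLinear (F ∘ G)
  ∘-linear {F} {G} F-lin G-lin = record
    { cong   = cong F-lin ∘ cong G-lin
    ; +-homo = λ f g l l≤N → trans (cong F-lin (+-homo G-lin f g) l l≤N) (+-homo F-lin _ _ l l≤N)
    ; ⊛-homo = λ x f l l≤N → trans (cong F-lin (⊛-homo G-lin x f) l l≤N) (⊛-homo F-lin x _ l l≤N)
    }

  altAct-linear : ∀ s n → IsLinear (altAct s n)
  altAct-linear s zero    = record { cong = λ f≋g → f≋g ; +-homo = λ _ _ _ _ → ≈-refl ; ⊛-homo = λ _ _ _ _ → ≈-refl }
  altAct-linear s (suc n) = ∘-linear (act-linear s) (altAct-linear (other s) n)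

  altAct-last : ∀ s n f → altAct s (suc n) f ≡ altAct s n (act (letter s n) f)
  altAct-last s zero    f = refl
  altAct-last s (suc n) f = ≡.cong (act s) (≡.trans (altAct-last (other s) n f)
    (≡.cong (λ t → altAct (other s) n (act t f)) (letter-other s n)))

  trace : (Vect → Vect) → Carrier
  trace F = ∑ (suc N) (λ l → F (δ l) l)

  trace-cong : ∀ {F G} → (∀ f → F f ≋ G f) → trace F ≈ trace G
  trace-cong F≋G = ∑-cong (suc N) (λ l l<1+N → F≋G (δ l) l (ℕₚ.≤-pred l<1+N))

  trace-comm : ∀ {F G} → IsLinear F → IsLinear G → trace (F ∘ G) ≈ trace (G ∘ F)
  trace-comm {F} {G} F-lin G-lin = begin
    trace (F ∘ G)
      ≈⟨ ∑-cong (suc N) (λ l l≤N → matrix F-lin (G (δ l)) l (ℕₚ.≤-pred l≤N)) ⟩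
    ∑ (suc N) (λ l → ∑ (suc N) (λ j → G (δ l) j ⊛ F (δ j) l))
      ≈⟨ ∑-swap (suc N) (suc N) _ ⟩
    ∑ (suc N) (λ j → ∑ (suc N) (λ l → G (δ l) j ⊛ F (δ j) l))
      ≈⟨ ∑-cong (suc N) (λ _ _ → ∑-cong (suc N) (λ _ _ → *-comm _ _)) ⟩
    ∑ (suc N) (λ j → ∑ (suc N) (λ l → F (δ j) l ⊛ G (δ l) j))
      ≈⟨ ∑-cong (suc N) (λ j j≤N → matrix G-lin (F (δ j)) j (ℕₚ.≤-pred j≤N)) ⟨
    trace (G ∘ F) ∎

  tr : Gen → ℕ → Carrier
  tr s n = trace (altAct s n)

  -- Diagonal entries and traces of alternating words.

  module Quadratic (ρ²≈pρ+q : ρ ⊛ ρ ≈ p ⊛ ρ ⊕ q) where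

    -- Along an edge `up` and `down` compose to the Hecke relation by themselves; at a free end the
    -- relation is exactly the hypothesis on `ρ`.
    act² : ∀ s f → act s (act s f) ≋ (λ l → p ⊛ act s f l ⊕ q ⊛ f l)
    act² s f l l≤N with s ≟G downLetter l
    act² s f zero l≤N | yes s≡ = begin
      ρ ⊛ act s f 0            ≡⟨ ≡.cong (ρ ⊛_) (act-down f 0 s≡) ⟩
      ρ ⊛ (ρ ⊛ f 0)            ≈⟨ *-assoc ρ ρ (f 0) ⟨
      (ρ ⊛ ρ) ⊛ f 0            ≈⟨ *-congʳ ρ²≈pρ+q ⟩
      (p ⊛ ρ ⊕ q) ⊛ f 0        ≈⟨ solve 4 (λ p ρ q x → (p :* ρ :+ q) :* x := p :* (ρ :* x) :+ q :* x) ≈-refl p ρ q (f 0) ⟩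
      p ⊛ (ρ ⊛ f 0) ⊕ q ⊛ f 0  ∎
    act² s f (suc l) l<N | yes s≡ = begin
      act s f l ⊕ p ⊛ act s f (suc l)
        ≡⟨ ≡.cong₂ (λ x y → x ⊕ p ⊛ y) (≡.trans (act-up f l s≡) (up-< f l<N)) (act-down f (suc l) s≡) ⟩
      q ⊛ f (suc l) ⊕ p ⊛ (f l ⊕ p ⊛ f (suc l))
        ≈⟨ +-comm _ _ ⟩
      p ⊛ (f l ⊕ p ⊛ f (suc l)) ⊕ q ⊛ f (suc l) ∎
    act² s f l l≤N | no s≢ with l ℕₚ.<? N
    ... | yes l<N = begin
      q ⊛ act s f (suc l)                    ≡⟨ ≡.cong (q ⊛_) (act-down f (suc l) (≢⇒≡other s≢)) ⟩
      q ⊛ (f l ⊕ p ⊛ f (suc l))              ≈⟨ solve 4 (λ q p x y → q :* (x :+ p :* y) := p :* (q :* y) :+ q :* x) ≈-refl q p (f l) (f (suc l)) ⟩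
      p ⊛ (q ⊛ f (suc l)) ⊕ q ⊛ f l          ∎
    ... | no l≮N with ℕₚ.≤-antisym l≤N (ℕₚ.≮⇒≥ l≮N)
    ... | refl = begin
      ρ ⊛ act s f N            ≡⟨ ≡.cong (ρ ⊛_) (≡.trans (act-up f N (≢⇒≡other s≢)) (up-top f)) ⟩
      ρ ⊛ (ρ ⊛ f N)            ≈⟨ *-assoc ρ ρ (f N) ⟨
      (ρ ⊛ ρ) ⊛ f N            ≈⟨ *-congʳ ρ²≈pρ+q ⟩
      (p ⊛ ρ ⊕ q) ⊛ f N        ≈⟨ solve 4 (λ p ρ q x → (p :* ρ :+ q) :* x := p :* (ρ :* x) :+ q :* x) ≈-refl p ρ q (f N) ⟩
      p ⊛ (ρ ⊛ f N) ⊕ q ⊛ f N  ∎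

    -- Moving the first letter to the end (trace-comm) turns s … s into … s s.
    tr-odd-step : ∀ s k → tr s (3 + 2 * k) ≈ p ⊛ tr (other s) (2 + 2 * k) ⊕ q ⊛ tr (other s) (1 + 2 * k)
    tr-odd-step s k = begin
      trace (act s ∘ altAct (other s) (2 + 2 * k))
        ≈⟨ trace-comm (act-linear s) (altAct-linear (other s) (2 + 2 * k)) ⟩
      trace (altAct (other s) (2 + 2 * k) ∘ act s)
        ≈⟨ trace-cong (λ f l l≤N → trans (reflexive (≡.cong (λ h → h l) (last (act s f)))) (trans (cong lin (act² s f) l l≤N)
             (trans (+-homo lin _ _ l l≤N) (+-cong (trans (⊛-homo lin p _ l l≤N) (*-congˡ (reflexive (≡.cong (λ h → h l) (≡.sym (last f)))))) (⊛-homo lin q _ l l≤N))))) ⟩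
      ∑ (suc N) (λ l → p ⊛ altAct (other s) (2 + 2 * k) (δ l) l ⊕ q ⊛ altAct (other s) (1 + 2 * k) (δ l) l)
        ≈⟨ trans (∑-+ (suc N) _ _) (+-cong (∑-*ˡ (suc N) p _) (∑-*ˡ (suc N) q _)) ⟩
      p ⊛ tr (other s) (2 + 2 * k) ⊕ q ⊛ tr (other s) (1 + 2 * k) ∎
      where
      lin : IsLinear (altAct (other s) (1 + 2 * k))
      lin = altAct-linear (other s) (1 + 2 * k)
      last : ∀ f → altAct (other s) (2 + 2 * k) f ≡ altAct (other s) (1 + 2 * k) (act s f)
      last f = ≡.trans (altAct-last (other s) (1 + 2 * k) f)
        (≡.cong (λ t → altAct (other s) (1 + 2 * k) (act t f)) (≡.trans (≡.cong other (letter-2* (other s) k)) (other-involutive s)))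

    -- Entry l of a word of length n applied to f, whose first letter raises l (`X`) or lowers l
    -- (`Y`). After a move the next letter continues in the same direction; after a stay it turns
    -- around. So `X` climbs without branching, while `Y` branches into a descent and a turn.
    X Y : ℕ → ℕ → Vect → Carrier
    X n l f = altAct (other (downLetter l)) n f l
    Y n l f = altAct (downLetter l) n f l

    X-step : ∀ n {l} f → l < N → X (suc n) l f ≈ q ⊛ X n (suc l) f
    X-step n {l} f l<N = reflexive (≡.trans (act-up _ l refl) (up-< _ l<N))

    X-top : ∀ n f → X (suc n) N f ≈ ρ ⊛ Y n N f
    X-top n f = reflexive (≡.trans (act-up _ N refl) (≡.trans (up-top _)
      (≡.cong (λ s → ρ ⊛ altAct s n f N) (other-involutive (downLetter N)))))

    Y-step : ∀ n l f → Y (suc n) (suc l) f ≈ Y n l f ⊕ p ⊛ X n (suc l) f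
    Y-step n l f = reflexive (≡.trans (act-down _ (suc l) refl)
      (≡.cong (λ s → altAct s n f l ⊕ p ⊛ X n (suc l) f) (other-involutive (downLetter l))))

    X-iterate : ∀ n l f → l + n ≤ N → X n l f ≈ q ^ n ⊛ f (l + n)
    X-iterate zero    l f l≤N = trans (reflexive (≡.cong f (≡.sym (ℕₚ.+-identityʳ l)))) (sym (*-identityˡ _))
    X-iterate (suc n) l f l+n<N rewrite ℕₚ.+-suc l n = begin
      X (suc n) l f                  ≈⟨ X-step n f (ℕₚ.m+n≤o⇒m≤o (suc l) l+n<N) ⟩
      q ⊛ X n (suc l) f              ≈⟨ *-congˡ (X-iterate n (suc l) f l+n<N) ⟩
      q ⊛ (q ^ n ⊛ f (suc l + n))    ≈⟨ *-assoc _ _ _ ⟨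
      q ^ suc n ⊛ f (suc l + n)      ∎

    l+[1+i]≡N⇒l<N : ∀ {l i} → l + suc i ≡ N → l < N
    l+[1+i]≡N⇒l<N {l} {i} eq = ℕₚ.≤-trans (ℕₚ.m<m+n l z<s) (ℕₚ.≤-reflexive eq)

    -- Of the letters, i climb to the top with a factor `q` each, one fixes the top with factor `ρ`,
    -- and r remain, the first of which goes down.
    X-reflect : ∀ i r {l} f → l + i ≡ N → X (i + suc r) l f ≈ q ^ i ⊛ (ρ ⊛ Y r N f)
    X-reflect zero    r {l} f l+0≡N with ≡.trans (≡.sym (ℕₚ.+-identityʳ l)) l+0≡N
    ... | refl = trans (X-top r f) (sym (*-identityˡ _))
    X-reflect (suc i) r {l} f eq = begin
      X (suc i + suc r) l f              ≈⟨ X-step (i + suc r) f (l+[1+i]≡N⇒l<N eq) ⟩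
      q ⊛ X (i + suc r) (suc l) f        ≈⟨ *-congˡ (X-reflect i r f (≡.trans (≡.sym (ℕₚ.+-suc l i)) eq)) ⟩
      q ⊛ (q ^ i ⊛ (ρ ⊛ Y r N f))        ≈⟨ *-assoc _ _ _ ⟨
      q ^ suc i ⊛ (ρ ⊛ Y r N f)          ∎

    -- The inhomogeneous term in the recursion for `Y`. For `f = δ j` it can differ from zero only
    -- when d is j, j - 1 or j - 2, so on basis vectors the recursion is almost homogeneous.
    defect : Vect → ℕ → Carrier
    defect f d = (f d ⊕ p ⊛ f (suc d)) - q ⊛ f (2 + d)

    -- Y (suc r) l - q Y r (suc l) only depends on l - r: the X-terms cancel in its recursion.
    Y-diagonal : ∀ r d f → suc (r + suc d) ≤ N →
                 Y (suc r) (r + suc d) f ≈ q ⊛ Y r (suc (r + suc d)) f ⊕ defect f d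
    Y-diagonal zero    d f _ = begin
      Y 1 (suc d) f                        ≈⟨ Y-step 0 d f ⟩
      f d ⊕ p ⊛ f (suc d)                  ≈⟨ solve 2 (λ x y → x := y :+ (x :- y)) ≈-refl _ (q ⊛ f (2 + d)) ⟩
      q ⊛ f (2 + d) ⊕ defect f d           ∎
    Y-diagonal (suc r) d f 2+l≤N = begin
      Y (2 + r) (suc l) f
        ≈⟨ Y-step (suc r) l f ⟩
      Y (suc r) l f ⊕ p ⊛ X (suc r) (suc l) f
        ≈⟨ +-cong (Y-diagonal r d f (ℕₚ.<⇒≤ 2+l≤N)) (*-congˡ (X-step r f 2+l≤N)) ⟩
      (q ⊛ Y r (suc l) f ⊕ defect f d) ⊕ p ⊛ (q ⊛ X r (2 + l) f)
        ≈⟨ solve 5 (λ q p x v y → (q :* x :+ v) :+ p :* (q :* y) := q :* (x :+ p :* y) :+ v) ≈-refl q p (Y r (suc l) f) (defect f d) (X r (2 + l) f) ⟩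
      q ⊛ (Y r (suc l) f ⊕ p ⊛ X r (2 + l) f) ⊕ defect f d
        ≈⟨ +-congʳ (*-congˡ (Y-step r (suc l) f)) ⟨
      q ⊛ Y (suc r) (2 + l) f ⊕ defect f d ∎
      where
      l = r + suc d

    -- The top end closes the recursion: the stay is reflected by `X-top` into p ρ times `Y r N f`,
    -- the descent contributes q times the same entry by `Y-diagonal`, and p ρ + q = ρ².
    Y-top : ∀ r {d} f → d + (2 + r) ≡ N → Y (2 + r) N f ≈ (ρ ⊛ ρ) ⊛ Y r N f ⊕ defect f d
    -- `N` is a fixed parameter and cannot be matched against a successor, so the argument is run at
    -- `suc l` and transported along `suc l ≡ N`.
    Y-top r {d} f eq = ≡.subst (λ n → n ≡ N → Y (2 + r) n f ≈ (ρ ⊛ ρ) ⊛ Y r n f ⊕ defect f d) eq′ step refl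
      where
      l = r + suc d
      eq′ : suc l ≡ N
      eq′ = ≡.trans (≡.cong suc (≡.trans (ℕₚ.+-suc r d) (≡.cong suc (ℕₚ.+-comm r d)))) (≡.trans (≡.sym (≡.trans (ℕₚ.+-suc d (suc r)) (≡.cong suc (ℕₚ.+-suc d r)))) eq)
      step : suc l ≡ N → Y (2 + r) (suc l) f ≈ (ρ ⊛ ρ) ⊛ Y r (suc l) f ⊕ defect f d
      step 1+l≡N = begin
        Y (2 + r) (suc l) f
          ≈⟨ Y-step (suc r) l f ⟩
        Y (suc r) l f ⊕ p ⊛ X (suc r) (suc l) f
          ≈⟨ +-cong (Y-diagonal r d f (ℕₚ.≤-reflexive 1+l≡N)) (*-congˡ (≡.subst (λ n → X (suc r) n f ≈ ρ ⊛ Y r n f) (≡.sym 1+l≡N) (X-top r f))) ⟩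
        (q ⊛ Y r (suc l) f ⊕ defect f d) ⊕ p ⊛ (ρ ⊛ Y r (suc l) f)
          ≈⟨ solve 5 (λ q p ρ y v → (q :* y :+ v) :+ p :* (ρ :* y) := (p :* ρ :+ q) :* y :+ v) ≈-refl q p ρ (Y r (suc l) f) (defect f d) ⟩
        (p ⊛ ρ ⊕ q) ⊛ Y r (suc l) f ⊕ defect f d
          ≈⟨ +-congʳ (*-congʳ ρ²≈pρ+q) ⟨
        (ρ ⊛ ρ) ⊛ Y r (suc l) f ⊕ defect f d ∎

    δ-off : ∀ {j i x i′} → j + i ≡ N → x + i′ ≡ N → i ≢ i′ → δ j x ≈ 0#
    δ-off {j} {x = x} j+i≡N x+i′≡N i≢i′ = δ-≢ {j} {x} λ { refl → i≢i′ (ℕₚ.+-cancelˡ-≡ j _ _ (≡.trans j+i≡N (≡.sym x+i′≡N))) }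

    δ-on : ∀ {j i x} → j + i ≡ N → x + i ≡ N → δ j x ≈ 1#
    δ-on {j} {i} {x} j+i≡N x+i≡N with ℕₚ.+-cancelʳ-≡ i j x (≡.trans j+i≡N (≡.sym x+i≡N))
    ... | refl = δ-refl j

    -- Positions are measured by their distance from the top: j lies at distance i, and the entries
    -- read by `defect` lie at distances 2 + r, 1 + r and r.
    defect-off : ∀ {j i d r} → j + i ≡ N → d + (2 + r) ≡ N → i ≢ 2 + r → i ≢ 1 + r → i ≢ r → defect (δ j) d ≈ 0#
    defect-off {j} {i} {d} {r} j+i d+2+r i≢₂ i≢₁ i≢₀ = begin
      defect (δ j) d
        ≈⟨ +-cong (+-cong (δ-off j+i d+2+r i≢₂) (*-congˡ (δ-off j+i 1+d+1+r i≢₁))) (-‿cong (*-congˡ (δ-off j+i 2+d+r i≢₀))) ⟩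
      (0# ⊕ p ⊛ 0#) - q ⊛ 0#
        ≈⟨ solve 2 (λ p q → (:0 :+ p :* :0) :- q :* :0 := :0) ≈-refl p q ⟩
      0# ∎
      where
      1+d+1+r : suc d + suc r ≡ N
      1+d+1+r = ≡.trans (≡.sym (ℕₚ.+-suc d (suc r))) d+2+r
      2+d+r : 2 + d + r ≡ N
      2+d+r = ≡.trans (≡.cong suc (≡.sym (ℕₚ.+-suc d r))) 1+d+1+r

    ∃[d]d+n≡N : ∀ {n} → n ≤ N → ∃ λ d → d + n ≡ N
    ∃[d]d+n≡N {n} n≤N = N ∸ n , ℕₚ.m∸n+n≡m n≤N

    i≤N : ∀ {j i} → j + i ≡ N → i ≤ N
    i≤N {j} {i} j+i≡N = ℕₚ.≤-trans (ℕₚ.m≤n+m i j) (ℕₚ.≤-reflexive j+i≡N)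

    Y-one-top : ∀ f {d} → d + 1 ≡ N → Y 1 N f ≈ f d ⊕ p ⊛ f N
    Y-one-top f {d} d+1≡N = ≡.subst (λ n → Y 1 n f ≈ f d ⊕ p ⊛ f n) (≡.trans (ℕₚ.+-comm 1 d) d+1≡N) (Y-step 0 d f)

    -- A walk of r steps from the top stays within distance r of it and cannot reach j. `Y-top`
    -- moves by two letters, hence the two base cases.
    Y-top-zero : ∀ r {j i} → j + i ≡ N → r < i → Y r N (δ j) ≈ 0#
    Y-top-zero zero          {j} {i} j+i i>0 = δ-off j+i (ℕₚ.+-identityʳ N) (ℕₚ.>⇒≢ i>0)
    Y-top-zero (suc zero)    {j} {i} j+i i>1 with ∃[d]d+n≡N {1} (ℕₚ.≤-trans (ℕₚ.<⇒≤ i>1) (i≤N j+i))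
    ... | d , d+1≡N = begin
      Y 1 N (δ j)               ≈⟨ Y-one-top (δ j) d+1≡N ⟩
      δ j d ⊕ p ⊛ δ j N         ≈⟨ +-cong (δ-off j+i d+1≡N (ℕₚ.>⇒≢ i>1)) (*-congˡ (δ-off j+i (ℕₚ.+-identityʳ N) (ℕₚ.>⇒≢ (ℕₚ.<-trans z<s i>1)))) ⟩
      0# ⊕ p ⊛ 0#               ≈⟨ trans (+-identityˡ _) (zeroʳ p) ⟩
      0#                        ∎
    Y-top-zero (suc (suc r)) {j} {i} j+i i>2+r with ∃[d]d+n≡N {2 + r} (ℕₚ.≤-trans (ℕₚ.<⇒≤ i>2+r) (i≤N j+i))
    ... | d , d+2+r≡N = begin
      Y (2 + r) N (δ j)                            ≈⟨ Y-top r (δ j) d+2+r≡N ⟩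
      (ρ ⊛ ρ) ⊛ Y r N (δ j) ⊕ defect (δ j) d       ≈⟨ +-cong (*-congˡ (Y-top-zero r j+i i>r)) (defect-off j+i d+2+r≡N (ℕₚ.>⇒≢ i>2+r) (ℕₚ.>⇒≢ i>1+r) (ℕₚ.>⇒≢ i>r)) ⟩
      (ρ ⊛ ρ) ⊛ 0# ⊕ 0#                            ≈⟨ trans (+-identityʳ _) (zeroʳ _) ⟩
      0#                                           ∎
      where
      i>1+r : 1 + r < i
      i>1+r = ℕₚ.<-trans (ℕₚ.n<1+n (1 + r)) i>2+r
      i>r : r < i
      i>r = ℕₚ.<-trans (ℕₚ.n<1+n r) i>1+r

    -- A single walk contributes: i letters descend to j and the last one stays there with weight
    -- `p`. In the recursion this is the middle entry of `defect`.
    Y-top-next : ∀ {j i} → j + i ≡ N → suc i ≤ N → Y (suc i) N (δ j) ≈ p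
    Y-top-next {j} {zero} j+i 1≤N with ∃[d]d+n≡N {1} 1≤N
    ... | d , d+1≡N = begin
      Y 1 N (δ j)               ≈⟨ Y-one-top (δ j) d+1≡N ⟩
      δ j d ⊕ p ⊛ δ j N         ≈⟨ +-cong (δ-off {j} {0} {d} {1} j+i d+1≡N (λ ())) (*-congˡ (δ-on {j} {0} j+i (ℕₚ.+-identityʳ N))) ⟩
      0# ⊕ p ⊛ 1#               ≈⟨ trans (+-identityˡ _) (*-identityʳ p) ⟩
      p                         ∎
    Y-top-next {j} {suc i} j+i 2+i≤N with ∃[d]d+n≡N {2 + i} 2+i≤N
    ... | d , d+2+i≡N = begin
      Y (2 + i) N (δ j)
        ≈⟨ Y-top i (δ j) d+2+i≡N ⟩
      (ρ ⊛ ρ) ⊛ Y i N (δ j) ⊕ defect (δ j) d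
        ≈⟨ +-cong (*-congˡ (Y-top-zero i j+i (ℕₚ.n<1+n i))) (+-cong (+-cong (δ-off j+i d+2+i≡N (ℕₚ.<⇒≢ (ℕₚ.n<1+n (1 + i))))
             (*-congˡ (δ-on {i = 1 + i} {x = suc d} j+i (≡.trans (≡.sym (ℕₚ.+-suc d (suc i))) d+2+i≡N))))
             (-‿cong (*-congˡ (δ-off {x = 2 + d} {i′ = i} j+i (≡.trans (≡.cong suc (≡.sym (ℕₚ.+-suc d i))) (≡.trans (≡.sym (ℕₚ.+-suc d (suc i))) d+2+i≡N)) ℕₚ.1+n≢n)))) ⟩
      (ρ ⊛ ρ) ⊛ 0# ⊕ ((0# ⊕ p ⊛ 1#) - q ⊛ 0#)
        ≈⟨ solve 3 (λ r p q → r :* :0 :+ ((:0 :+ p :* :1) :- q :* :0) := p) ≈-refl (ρ ⊛ ρ) p q ⟩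
      p ∎

    -- Once the number of letters exceeds i, `Y-top` has no defect at `δ j`, and each further pair
    -- of letters only multiplies by ρ².
    Y-top-odd : ∀ s {j i} → j + i ≡ N → i + suc (2 * s) ≤ N → Y (i + suc (2 * s)) N (δ j) ≈ p ⊛ (ρ ⊛ ρ) ^ s
    Y-top-odd zero    {j} {i} j+i 1+i≤N rewrite ℕₚ.+-comm i 1 = trans (Y-top-next j+i 1+i≤N) (sym (*-identityʳ p))
    Y-top-odd (suc s) {j} {i} j+i ≤N with ∃[d]d+n≡N {2 + (i + suc (2 * s))} (≡.subst (_≤ N) (i+[1+2*[1+s]] i s) ≤N)
    ... | d , d+2+r≡N = begin
      Y (i + suc (2 * suc s)) N (δ j)              ≡⟨ ≡.cong (λ n → Y n N (δ j)) (i+[1+2*[1+s]] i s) ⟩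
      Y (2 + r) N (δ j)                            ≈⟨ Y-top r (δ j) d+2+r≡N ⟩
      (ρ ⊛ ρ) ⊛ Y r N (δ j) ⊕ defect (δ j) d       ≈⟨ +-cong (*-congˡ (Y-top-odd s j+i r≤N)) (defect-off j+i d+2+r≡N (ℕₚ.<⇒≢ (ℕₚ.m<n⇒m<1+n (ℕₚ.m<n⇒m<1+n i<r))) (ℕₚ.<⇒≢ (ℕₚ.m<n⇒m<1+n i<r)) (ℕₚ.<⇒≢ i<r)) ⟩
      (ρ ⊛ ρ) ⊛ (p ⊛ (ρ ⊛ ρ) ^ s) ⊕ 0#             ≈⟨ solve 3 (λ x p y → x :* (p :* y) :+ :0 := p :* (x :* y)) ≈-refl (ρ ⊛ ρ) p _ ⟩
      p ⊛ (ρ ⊛ ρ) ^ suc s                          ∎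
      where
      r : ℕ
      r = i + suc (2 * s)
      i<r : i < r
      i<r = ℕₚ.m<m+n i z<s
      r≤N : r ≤ N
      r≤N = ℕₚ.≤-trans (ℕₚ.m≤n+m r 2) (≡.subst (_≤ N) (i+[1+2*[1+s]] i s) ≤N)

    -- This is `Y-diagonal` with vanishing defect: the entries it reads lie at distance at least i +
    -- r from the top, where `δ N` is zero as soon as i + r is positive. The length bound gives l at
    -- least r + 1, as `Y-diagonal` requires.
    Y-δN-step : ∀ r {i l} → l + suc i ≡ N → suc r + suc i ≤ N → i + r ≢ 0 → Y (suc r) l (δ N) ≈ q ⊛ Y r (suc l) (δ N)
    Y-δN-step r {i} {l} l+1+i≡N ≤N i+r≢0 with ℕₚ.m≤n⇒∃[o]m+o≡n (ℕₚ.+-cancelʳ-≤ (suc i) (suc r) l (ℕₚ.≤-trans ≤N (ℕₚ.≤-reflexive (≡.sym l+1+i≡N))))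
    ... | d , refl = begin
      Y (suc r) (suc r + d) (δ N)                              ≡⟨ ≡.cong (λ x → Y (suc r) x (δ N)) (ℕₚ.+-suc r d) ⟨
      Y (suc r) (r + suc d) (δ N)                              ≈⟨ Y-diagonal r d (δ N) (≡.subst (λ x → suc x ≤ N) (≡.sym (ℕₚ.+-suc r d)) (l+[1+i]≡N⇒l<N l+1+i≡N)) ⟩
      q ⊛ Y r (suc (r + suc d)) (δ N) ⊕ defect (δ N) d         ≈⟨ +-cong (*-congˡ (reflexive (≡.cong (λ x → Y r (suc x) (δ N)) (ℕₚ.+-suc r d))))
                                                                   (defect-off {r = i + r} (ℕₚ.+-identityʳ N) (≡.trans d+ l+1+i≡N) (λ ()) (λ ()) (i+r≢0 ∘ ≡.sym)) ⟩
      q ⊛ Y r (2 + r + d) (δ N) ⊕ 0#                           ≈⟨ +-identityʳ _ ⟩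
      q ⊛ Y r (2 + r + d) (δ N)                                ∎
      where
      open +-*-Solver using () renaming (solve to solveℕ; con to conℕ; _:+_ to _⟨+⟩_; _:=_ to _⟨=⟩_)
      d+ : d + (2 + (i + r)) ≡ suc r + d + suc i
      d+ = solveℕ 3 (λ d i r → d ⟨+⟩ (conℕ 2 ⟨+⟩ (i ⟨+⟩ r)) ⟨=⟩ conℕ 1 ⟨+⟩ r ⟨+⟩ d ⟨+⟩ (conℕ 1 ⟨+⟩ i)) refl d i r

    Y-δN-zero : ∀ r {i l} → l + i ≡ N → r + i ≤ N → r < i → Y r l (δ N) ≈ 0#
    Y-δN-zero zero    {i}     l+i _ i>0 = δ-≢ λ N≡l → ℕₚ.>⇒≢ i>0 (ℕₚ.+-cancelˡ-≡ N i 0 (≡.trans (≡.cong (_+ i) N≡l) (≡.trans l+i (≡.sym (ℕₚ.+-identityʳ N)))))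
    Y-δN-zero (suc r) {suc i} {l} l+i ≤N (s≤s r<i) = begin
      Y (suc r) l (δ N)              ≈⟨ Y-δN-step r l+i ≤N (λ i+r≡0 → ℕₚ.>⇒≢ (ℕₚ.≤-trans (ℕₚ.≤-trans (s≤s z≤n) r<i) (ℕₚ.m≤m+n i r)) i+r≡0) ⟩
      q ⊛ Y r (suc l) (δ N)          ≈⟨ *-congˡ (Y-δN-zero r (≡.trans (≡.sym (ℕₚ.+-suc l i)) l+i) (ℕₚ.≤-trans (ℕₚ.+-mono-≤ (ℕₚ.n≤1+n r) (ℕₚ.n≤1+n i)) ≤N) r<i) ⟩
      q ⊛ 0#                         ≈⟨ zeroʳ q ⟩
      0#                             ∎

    Y-δN : ∀ i r {l} → l + i ≡ N → (i + suc r) + i ≤ N → Y (i + suc r) l (δ N) ≈ q ^ i ⊛ Y (suc r) N (δ N)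
    Y-δN zero    r {l} l+0≡N _ with ≡.trans (≡.sym (ℕₚ.+-identityʳ l)) l+0≡N
    ... | refl = sym (*-identityˡ _)
    Y-δN (suc i) r {l} l+i ≤N = begin
      Y (suc i + suc r) l (δ N)             ≈⟨ Y-δN-step (i + suc r) l+i ≤N (λ eq → ℕₚ.1+n≢0 (ℕₚ.m+n≡0⇒n≡0 i (ℕₚ.m+n≡0⇒n≡0 i eq))) ⟩
      q ⊛ Y (i + suc r) (suc l) (δ N)       ≈⟨ *-congˡ (Y-δN i r (≡.trans (≡.sym (ℕₚ.+-suc l i)) l+i) (ℕₚ.≤-trans (ℕₚ.+-mono-≤ (ℕₚ.n≤1+n (i + suc r)) (ℕₚ.n≤1+n i)) ≤N)) ⟩
      q ⊛ (q ^ i ⊛ Y (suc r) N (δ N))       ≈⟨ *-assoc _ _ _ ⟨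
      q ^ suc i ⊛ Y (suc r) N (δ N)         ∎

    -- The rule T_s T_d = T_{sd} for a letter that increases the length. Letters absorbed from the
    -- right end therefore climb without a factor `q`, unlike those read from the left.
    act-δ : ∀ {j} → j < N → act (other (downLetter j)) (δ j) ≋ δ (suc j)
    act-δ {j} j<N l l≤N with other (downLetter j) ≟G downLetter l
    act-δ {zero}  j<N zero    l≤N | yes s≡ = contradiction s≡ (other-≢ c)
    act-δ {suc j} j<N zero    l≤N | yes s≡ = zeroʳ ρ
    act-δ {j}     j<N (suc l) l≤N | yes s≡ = begin
      δ j l ⊕ p ⊛ δ j (suc l)     ≈⟨ +-congˡ (*-congˡ (δ-≢ {j} {suc l} λ { refl → other-≢ _ s≡ })) ⟩
      δ j l ⊕ p ⊛ 0#              ≈⟨ trans (+-congˡ (zeroʳ p)) (+-identityʳ _) ⟩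
      δ j l                       ∎
    act-δ {j}     j<N l       l≤N | no s≢ with l ℕₚ.<? N
    ... | yes l<N = begin
      q ⊛ δ j (suc l)             ≈⟨ *-congˡ (δ-≢ {j} {suc l} λ { refl → s≢ (other-involutive _) }) ⟩
      q ⊛ 0#                      ≈⟨ zeroʳ q ⟩
      0#                          ≈⟨ δ-≢ {suc j} {l} (λ { refl → s≢ refl }) ⟨
      δ (suc j) l                 ∎
    ... | no  l≮N = begin
      ρ ⊛ δ j l                   ≈⟨ *-congˡ (δ-≢ {j} {l} λ { refl → l≮N j<N }) ⟩
      ρ ⊛ 0#                      ≈⟨ zeroʳ ρ ⟩
      0#                          ≈⟨ δ-≢ {suc j} {l} (λ { refl → s≢ refl }) ⟨
      δ (suc j) l                 ∎

    act-δN : act (other (downLetter N)) (δ N) ≋ (λ l → ρ ⊛ δ N l)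
    act-δN l l≤N with other (downLetter N) ≟G downLetter l
    act-δN zero    l≤N | yes s≡ = ≈-refl
    act-δN (suc l) l≤N | yes s≡ = begin
      δ N l ⊕ p ⊛ δ N (suc l)     ≈⟨ +-cong (δ-≢ {N} {l} (ℕₚ.>⇒≢ l≤N)) (*-congˡ (δ-≢ N≢1+l)) ⟩
      0# ⊕ p ⊛ 0#                 ≈⟨ solve 2 (λ p ρ → :0 :+ p :* :0 := ρ :* :0) ≈-refl p ρ ⟩
      ρ ⊛ 0#                      ≈⟨ *-congˡ (δ-≢ N≢1+l) ⟨
      ρ ⊛ δ N (suc l)             ∎
      where
      N≢1+l : N ≢ suc l
      N≢1+l eq = other-≢ _ (≡.trans s≡ (≡.cong downLetter (≡.sym eq)))
    act-δN l       l≤N | no s≢ with l ℕₚ.<? N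
    ... | no  _   = ≈-refl
    ... | yes l<N = begin
      q ⊛ δ N (suc l)             ≈⟨ *-congˡ (δ-≢ {N} {suc l} λ eq → s≢ (≡.trans (≡.cong (other ∘ downLetter) eq) (other-involutive _))) ⟩
      q ⊛ 0#                      ≈⟨ solve 2 (λ q ρ → q :* :0 := ρ :* :0) ≈-refl q ρ ⟩
      ρ ⊛ 0#                      ≈⟨ *-congˡ (δ-≢ {N} {l} (ℕₚ.>⇒≢ l<N)) ⟨
      ρ ⊛ δ N l                   ∎

    -- The condition on `letter s (suc n)` concerns the letter that would follow the word; by
    -- alternation the last letter of the word, which acts first, then raises j.
    altAct-strip : ∀ s n {j} t f → letter s (suc n) ≡ downLetter j → act (other (downLetter j)) (δ j) ≋ f →
                   t ≡ suc n → altAct s t (δ j) ≋ altAct s n f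
    altAct-strip s n {j} _ f s≡ act≋f refl l l≤N = trans
      (reflexive (≡.cong (λ g → g l) (≡.trans (altAct-last s n (δ j)) (≡.cong (λ t → altAct s n (act t (δ j))) letter≡))))
      (cong (altAct-linear s n) act≋f l l≤N)
      where
      letter≡ : letter s n ≡ other (downLetter j)
      letter≡ = ≡.trans (≡.sym (other-involutive _)) (≡.cong other s≡)

    strip-up : ∀ s a {j} → j + a ≤ N → letter s a ≡ downLetter j → altAct s a (δ j) ≋ δ (j + a)
    strip-up s zero    {j} _   _  l l≤N = reflexive (≡.cong (λ x → δ x l) (≡.sym (ℕₚ.+-identityʳ j)))
    strip-up s (suc a) {j} j+a≤N s≡ l l≤N = begin
      altAct s (suc a) (δ j) l       ≈⟨ altAct-strip s a {j} (suc a) (δ (suc j)) s≡ (act-δ (ℕₚ.m+n≤o⇒m≤o (suc j) 1+j+a≤N)) refl l l≤N ⟩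
      altAct s a (δ (suc j)) l       ≈⟨ strip-up s a {suc j} 1+j+a≤N (≡.trans (≡.sym (other-involutive _)) (≡.cong other s≡)) l l≤N ⟩
      δ (suc j + a) l                ≡⟨ ≡.cong (λ x → δ x l) (ℕₚ.+-suc j a) ⟨
      δ (j + suc a) l                ∎
      where
      1+j+a≤N : suc j + a ≤ N
      1+j+a≤N = ≡.subst (_≤ N) (ℕₚ.+-suc j a) j+a≤N

    strip-top : ∀ s i r {j} → j + i ≡ N → letter s (i + suc r) ≡ downLetter j →
                altAct s (i + suc r) (δ j) ≋ (λ l → ρ ⊛ altAct s r (δ N) l)
    strip-top s zero r {j} j+0≡N s≡ l l≤N with ≡.trans (≡.sym (ℕₚ.+-identityʳ j)) j+0≡N
    ... | refl = trans (altAct-strip s r {N} (suc r) _ s≡ act-δN refl l l≤N) (⊛-homo (altAct-linear s r) ρ (δ N) l l≤N)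
    strip-top s (suc i) r {j} j+i≡N s≡ l l≤N = trans
      (altAct-strip s (i + suc r) {j} (suc i + suc r) (δ (suc j)) s≡ (act-δ (l+[1+i]≡N⇒l<N j+i≡N)) refl l l≤N)
      (strip-top s i r (≡.trans (≡.sym (ℕₚ.+-suc j i)) j+i≡N) (≡.trans (≡.sym (other-involutive _)) (≡.cong other s≡)) l l≤N)

    -- Explicitly q^i p ρ^(2(k-i)-1) for i < k and 0 otherwise: the diagonal entry of a word of
    -- length 2k at distance i from the top, whichever letter comes first. The recursive form turns
    -- the telescoping sum into an induction.
    evenDiagonal : ℕ → ℕ → Carrier
    evenDiagonal zero    i       = 0#
    evenDiagonal (suc k) zero    = p ⊛ (ρ ⊛ (ρ ⊛ ρ) ^ k)
    evenDiagonal (suc k) (suc i) = q ⊛ evenDiagonal k i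

    evenDiagonal-zero : ∀ {k i} → k ≤ i → evenDiagonal k i ≈ 0#
    evenDiagonal-zero z≤n       = ≈-refl
    evenDiagonal-zero (s≤s k≤i) = trans (*-congˡ (evenDiagonal-zero k≤i)) (zeroʳ q)

    evenDiagonal-value : ∀ i s → evenDiagonal (i + suc s) i ≈ q ^ i ⊛ (p ⊛ (ρ ⊛ (ρ ⊛ ρ) ^ s))
    evenDiagonal-value zero    s = sym (*-identityˡ _)
    evenDiagonal-value (suc i) s = trans (*-congˡ (evenDiagonal-value i s)) (sym (*-assoc _ _ _))

    ∑-evenDiagonal : ∀ n k → k ≤ n → ∑ n (evenDiagonal k) ≈ (ρ ⊛ ρ) ^ k - q ^ k
    ∑-evenDiagonal n       zero    _         = trans (∑-zero n) (sym (-‿inverseʳ 1#))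
    ∑-evenDiagonal (suc n) (suc k) (s≤s k≤n) = begin
      ∑ (suc n) (evenDiagonal (suc k))
        ≈⟨ ∑-first n _ ⟩
      p ⊛ (ρ ⊛ (ρ ⊛ ρ) ^ k) ⊕ ∑ n (λ i → q ⊛ evenDiagonal k i)
        ≈⟨ +-congˡ (trans (∑-*ˡ n q _) (*-congˡ (∑-evenDiagonal n k k≤n))) ⟩
      p ⊛ (ρ ⊛ (ρ ⊛ ρ) ^ k) ⊕ q ⊛ ((ρ ⊛ ρ) ^ k - q ^ k)
        ≈⟨ solve 5 (λ p ρ q x y → p :* (ρ :* x) :+ q :* (x :- y) := (p :* ρ :+ q) :* x :- q :* y) ≈-refl p ρ q _ _ ⟩
      (p ⊛ ρ ⊕ q) ⊛ (ρ ⊛ ρ) ^ k - q ⊛ q ^ k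
        ≈⟨ +-congʳ (*-congʳ ρ²≈pρ+q) ⟨
      (ρ ⊛ ρ) ^ suc k - q ^ suc k ∎

    private
      k≤2k : ∀ k → k ≤ 2 * k
      k≤2k k = ℕₚ.m≤m+n k _

      reflect-bound : ∀ {i r n} → n ≤ suc N → n ≡ i + suc r → r + i ≤ N
      reflect-bound {i} {r} n≤ refl = ℕₚ.≤-pred (≡.subst (_≤ suc N) (≡.trans (ℕₚ.+-suc i r) (≡.cong suc (ℕₚ.+-comm i r))) n≤)

      2k≰i⇒2k≡i+1+r : ∀ {k i} → k ≤ i → ¬ 2 * k ≤ i → ∃ λ r → 2 * k ≡ i + suc r × r < i
      2k≰i⇒2k≡i+1+r {k} {i} k≤i 2k≰i with ℕₚ.m≤n⇒∃[o]m+o≡n (ℕₚ.≰⇒> 2k≰i)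
      ... | r , 1+i+r≡2k = r , eq , ℕₚ.+-cancelˡ-≤ i _ _ (≡.subst₂ _≤_ eq (≡.cong (i +_) (ℕₚ.+-identityʳ i)) (ℕₚ.*-monoʳ-≤ 2 k≤i))
        where
        eq : 2 * k ≡ i + suc r
        eq = ≡.trans (≡.sym 1+i+r≡2k) (≡.sym (ℕₚ.+-suc i r))

      l≢l+2k : ∀ l {k} → 1 ≤ k → l ≢ l + 2 * k
      l≢l+2k l {suc k} _ = ℕₚ.m≢1+m+n l ∘ (λ eq → ≡.trans eq (ℕₚ.+-suc l _))

      ≤⊎+ : ∀ k i → k ≤ i ⊎ ∃ λ s → k ≡ i + suc s
      ≤⊎+ k i with k ℕₚ.≤? i
      ... | yes k≤i = inj₁ k≤i
      ... | no  k≰i with ℕₚ.m≤n⇒∃[o]m+o≡n (ℕₚ.≰⇒> k≰i)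
      ... | s , 1+i+s≡k = inj₂ (s , ≡.trans (≡.sym 1+i+s≡k) (≡.sym (ℕₚ.+-suc i s)))

    -- Three regimes. If 2k ≤ i the walk ends above l. If k ≤ i < 2k it is reflected, but the r < i
    -- remaining letters cannot bring it back. If k > i it comes back with an odd number of letters
    -- to spare, and `Y-top-odd` gives the weight.
    X-diagonal : ∀ k l i → l + i ≡ N → 1 ≤ k → 2 * k ≤ suc N → X (2 * k) l (δ l) ≈ evenDiagonal k i
    X-diagonal k l i l+i≡N 1≤k 2k≤1+N with ≤⊎+ k i
    ... | inj₂ (s , refl) = begin
      X (2 * (i + suc s)) l (δ l)                       ≡⟨ ≡.cong (λ n → X n l (δ l)) (2*[i+1+s] i s) ⟩
      X (i + suc (i + suc (2 * s))) l (δ l)             ≈⟨ X-reflect i (i + suc (2 * s)) (δ l) l+i≡N ⟩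
      q ^ i ⊛ (ρ ⊛ Y (i + suc (2 * s)) N (δ l))         ≈⟨ *-congˡ (*-congˡ (Y-top-odd s {l} {i} l+i≡N (ℕₚ.m+n≤o⇒m≤o _ (reflect-bound 2k≤1+N (2*[i+1+s] i s))))) ⟩
      q ^ i ⊛ (ρ ⊛ (p ⊛ (ρ ⊛ ρ) ^ s))                   ≈⟨ *-congˡ (solve 3 (λ ρ p x → ρ :* (p :* x) := p :* (ρ :* x)) ≈-refl ρ p _) ⟩
      q ^ i ⊛ (p ⊛ (ρ ⊛ (ρ ⊛ ρ) ^ s))                   ≈⟨ evenDiagonal-value i s ⟨
      evenDiagonal (i + suc s) i                        ∎
    ... | inj₁ k≤i with 2 * k ℕₚ.≤? i
    ... | yes 2k≤i = begin
      X (2 * k) l (δ l)                    ≈⟨ X-iterate (2 * k) l (δ l) (ℕₚ.≤-trans (ℕₚ.+-monoʳ-≤ l 2k≤i) (ℕₚ.≤-reflexive l+i≡N)) ⟩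
      q ^ (2 * k) ⊛ δ l (l + 2 * k)        ≈⟨ *-congˡ (δ-≢ (l≢l+2k l 1≤k)) ⟩
      q ^ (2 * k) ⊛ 0#                     ≈⟨ trans (zeroʳ _) (sym (evenDiagonal-zero k≤i)) ⟩
      evenDiagonal k i                     ∎
    ... | no 2k≰i with 2k≰i⇒2k≡i+1+r k≤i 2k≰i
    ... | r , 2k≡i+1+r , r<i = begin
      X (2 * k) l (δ l)                    ≡⟨ ≡.cong (λ n → X n l (δ l)) 2k≡i+1+r ⟩
      X (i + suc r) l (δ l)                ≈⟨ X-reflect i r (δ l) l+i≡N ⟩
      q ^ i ⊛ (ρ ⊛ Y r N (δ l))            ≈⟨ *-congˡ (*-congˡ (Y-top-zero r l+i≡N r<i)) ⟩
      q ^ i ⊛ (ρ ⊛ 0#)                     ≈⟨ trans (*-congˡ (zeroʳ ρ)) (zeroʳ _) ⟩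
      0#                                   ≈⟨ evenDiagonal-zero k≤i ⟨
      evenDiagonal k i                     ∎

    -- The same regimes seen from the right end: the last letter raises l, so `δ l` climbs towards
    -- `δ N` and takes the factor `ρ` at the top. The powers of `q` now come from `Y-δN`, when the
    -- remaining letters are read at l.
    Y-diagonal-even : ∀ k l i → l + i ≡ N → 1 ≤ k → 2 * k ≤ suc N → Y (2 * k) l (δ l) ≈ evenDiagonal k i
    Y-diagonal-even k l i l+i≡N 1≤k 2k≤1+N with ≤⊎+ k i
    ... | inj₂ (s , refl) = begin
      Y (2 * (i + suc s)) l (δ l)                       ≡⟨ ≡.cong (λ n → Y n l (δ l)) (2*[i+1+s] i s) ⟩
      Y (i + suc (i + suc (2 * s))) l (δ l)             ≈⟨ strip-top (downLetter l) i (i + suc (2 * s)) l+i≡N (≡.trans (≡.cong (letter _) (≡.sym (2*[i+1+s] i s))) (letter-2* _ (i + suc s))) l l≤N ⟩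
      ρ ⊛ Y (i + suc (2 * s)) l (δ N)                   ≈⟨ *-congˡ (Y-δN i (2 * s) l+i≡N bound) ⟩
      ρ ⊛ (q ^ i ⊛ Y (suc (2 * s)) N (δ N))             ≈⟨ *-congˡ (*-congˡ (Y-top-odd s {N} {0} (ℕₚ.+-identityʳ N) (ℕₚ.m+n≤o⇒n≤o i (ℕₚ.m+n≤o⇒m≤o (i + suc (2 * s)) bound)))) ⟩
      ρ ⊛ (q ^ i ⊛ (p ⊛ (ρ ⊛ ρ) ^ s))                   ≈⟨ solve 4 (λ ρ y p x → ρ :* (y :* (p :* x)) := y :* (p :* (ρ :* x))) ≈-refl ρ (q ^ i) p _ ⟩
      q ^ i ⊛ (p ⊛ (ρ ⊛ (ρ ⊛ ρ) ^ s))                   ≈⟨ evenDiagonal-value i s ⟨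
      evenDiagonal (i + suc s) i                        ∎
      where
      bound : (i + suc (2 * s)) + i ≤ N
      bound = reflect-bound 2k≤1+N (2*[i+1+s] i s)
      l≤N : l ≤ N
      l≤N = ℕₚ.≤-trans (ℕₚ.m≤m+n l i) (ℕₚ.≤-reflexive l+i≡N)
    ... | inj₁ k≤i with 2 * k ℕₚ.≤? i
    ... | yes 2k≤i = begin
      Y (2 * k) l (δ l)                    ≈⟨ strip-up (downLetter l) (2 * k) {l} (ℕₚ.≤-trans (ℕₚ.+-monoʳ-≤ l 2k≤i) (ℕₚ.≤-reflexive l+i≡N)) (letter-2* _ k) l l≤N ⟩
      δ (l + 2 * k) l                      ≈⟨ δ-≢ (l≢l+2k l 1≤k ∘ ≡.sym) ⟩
      0#                                   ≈⟨ evenDiagonal-zero k≤i ⟨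
      evenDiagonal k i                     ∎
      where
      l≤N : l ≤ N
      l≤N = ℕₚ.≤-trans (ℕₚ.m≤m+n l i) (ℕₚ.≤-reflexive l+i≡N)
    ... | no 2k≰i with 2k≰i⇒2k≡i+1+r k≤i 2k≰i
    ... | r , 2k≡i+1+r , r<i = begin
      Y (2 * k) l (δ l)                    ≡⟨ ≡.cong (λ n → Y n l (δ l)) 2k≡i+1+r ⟩
      Y (i + suc r) l (δ l)                ≈⟨ strip-top (downLetter l) i r l+i≡N (≡.trans (≡.cong (letter _) (≡.sym 2k≡i+1+r)) (letter-2* _ k)) l (ℕₚ.≤-trans (ℕₚ.m≤m+n l i) (ℕₚ.≤-reflexive l+i≡N)) ⟩
      ρ ⊛ Y r l (δ N)                      ≈⟨ *-congˡ (Y-δN-zero r l+i≡N (reflect-bound 2k≤1+N 2k≡i+1+r) r<i) ⟩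
      ρ ⊛ 0#                               ≈⟨ zeroʳ ρ ⟩
      0#                                   ≈⟨ evenDiagonal-zero k≤i ⟨
      evenDiagonal k i                     ∎

    tr-even : ∀ s k → 1 ≤ k → 2 * k ≤ suc N → tr s (2 * k) ≈ (ρ ⊛ ρ) ^ k - q ^ k
    tr-even s k 1≤k 2k≤1+N = begin
      tr s (2 * k)                                         ≈⟨ ∑-cong (suc N) diagonal ⟩
      ∑ (suc N) (λ l → evenDiagonal k (N ∸ l))             ≈⟨ ∑-reverse (suc N) (evenDiagonal k) ⟨
      ∑ (suc N) (evenDiagonal k)                           ≈⟨ ∑-evenDiagonal (suc N) k (ℕₚ.≤-trans (k≤2k k) 2k≤1+N) ⟩
      (ρ ⊛ ρ) ^ k - q ^ k                                  ∎
      where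
      diagonal : ∀ l → l < suc N → altAct s (2 * k) (δ l) l ≈ evenDiagonal k (N ∸ l)
      diagonal l l<1+N with s ≟G downLetter l
      ... | yes refl = Y-diagonal-even k l (N ∸ l) (ℕₚ.m+[n∸m]≡n (ℕₚ.≤-pred l<1+N)) 1≤k 2k≤1+N
      ... | no  s≢ with ≢⇒≡other s≢
      ... | refl = X-diagonal k l (N ∸ l) (ℕₚ.m+[n∸m]≡n (ℕₚ.≤-pred l<1+N)) 1≤k 2k≤1+N

    -- Induction by `tr-odd-step`. Of the even trace times p, the power of ρ joins q times the
    -- previous one through p ρ + q = ρ², and the power of q adds one more `- p` to the bracket. The
    -- middle letter is preserved, since dropping both outer letters keeps the centre.
    tr-odd : ∀ s k → suc (2 * k) ≤ suc N →
             tr s (suc (2 * k)) ≈ ρ ⊛ (ρ ⊛ ρ) ^ k ⊕ q ^ k ⊛ ((tr (letter s k) 1 - ρ) - k ⋆ p)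
    tr-odd s zero    _ = solve 2 (λ ρ t → t := ρ :* :1 :+ :1 :* ((t :- ρ) :- :0)) ≈-refl ρ (tr s 1)
    tr-odd s (suc k) bound = begin
      tr s (suc (2 * suc k))
        ≡⟨ ≡.cong (tr s ∘ suc) (ℕₚ.*-suc 2 k) ⟩
      tr s (3 + 2 * k)
        ≈⟨ tr-odd-step s k ⟩
      p ⊛ tr (other s) (2 + 2 * k) ⊕ q ⊛ tr (other s) (1 + 2 * k)
        ≈⟨ +-cong (*-congˡ even) (*-congˡ odd) ⟩
      p ⊛ ((ρ ⊛ ρ) ^ suc k - q ^ suc k) ⊕ q ⊛ (ρ ⊛ (ρ ⊛ ρ) ^ k ⊕ q ^ k ⊛ ((t - ρ) - k ⋆ p))
        ≈⟨ solve 7 (λ p ρ q x y t z → p :* ((ρ :* ρ) :* x :- q :* y) :+ q :* (ρ :* x :+ y :* ((t :- ρ) :- z))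
             := (ρ :* x) :* (p :* ρ :+ q) :+ (q :* y) :* ((t :- ρ) :- (p :+ z))) ≈-refl p ρ q _ _ t (k ⋆ p) ⟩
      (ρ ⊛ (ρ ⊛ ρ) ^ k) ⊛ (p ⊛ ρ ⊕ q) ⊕ q ^ suc k ⊛ ((t - ρ) - suc k ⋆ p)
        ≈⟨ +-congʳ (*-congˡ (sym ρ²≈pρ+q)) ⟩
      (ρ ⊛ (ρ ⊛ ρ) ^ k) ⊛ (ρ ⊛ ρ) ⊕ q ^ suc k ⊛ ((t - ρ) - suc k ⋆ p)
        ≈⟨ +-congʳ (solve 2 (λ ρ x → (ρ :* x) :* (ρ :* ρ) := ρ :* ((ρ :* ρ) :* x)) ≈-refl ρ _) ⟩
      ρ ⊛ (ρ ⊛ ρ) ^ suc k ⊕ q ^ suc k ⊛ ((t - ρ) - suc k ⋆ p) ∎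
      where
      t : Carrier
      t = tr (letter s (suc k)) 1
      bound′ : 3 + 2 * k ≤ suc N
      bound′ = ≡.subst (λ x → suc x ≤ suc N) (ℕₚ.*-suc 2 k) bound
      even : tr (other s) (2 + 2 * k) ≈ (ρ ⊛ ρ) ^ suc k - q ^ suc k
      even = trans (reflexive (≡.cong (tr (other s)) (≡.sym (ℕₚ.*-suc 2 k))))
        (tr-even (other s) (suc k) (s≤s z≤n) (ℕₚ.<⇒≤ bound))
      odd : tr (other s) (1 + 2 * k) ≈ ρ ⊛ (ρ ⊛ ρ) ^ k ⊕ q ^ k ⊛ ((t - ρ) - k ⋆ p)
      odd = trans (tr-odd (other s) k (ℕₚ.≤-trans (ℕₚ.m≤n+m (1 + 2 * k) 2) bound′))
        (reflexive (≡.cong (λ u → ρ ⊛ (ρ ⊛ ρ) ^ k ⊕ q ^ k ⊛ ((tr u 1 - ρ) - k ⋆ p)) (letter-other s k)))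

  -- Trace of a single generator.

  trTerm-top : ∀ s → s ≡ other (downLetter N) → act s (δ N) N ≈ ρ
  trTerm-top s s≡ = trans (reflexive (≡.trans (act-up (δ N) N s≡) (up-top (δ N)))) (trans (*-congˡ (δ-refl N)) (*-identityʳ ρ))

  trTerm-bottom : ∀ s → s ≡ downLetter 0 → act s (δ 0) 0 ≈ ρ
  trTerm-bottom s s≡ = trans (reflexive (act-down (δ 0) 0 s≡)) (*-identityʳ ρ)

  trTerm-up : ∀ s l → l < N → s ≡ other (downLetter l) → act s (δ l) l ≈ 0#
  trTerm-up s l l<N s≡ = trans (reflexive (≡.trans (act-up (δ l) l s≡) (up-< (δ l) l<N)))
    (trans (*-congˡ (δ-≢ {l} {suc l} (ℕₚ.1+n≢n ∘ ≡.sym))) (zeroʳ q))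

  trTerm-down : ∀ s l → s ≡ downLetter (suc l) → act s (δ (suc l)) (suc l) ≈ p
  trTerm-down s l s≡ = trans (reflexive (act-down (δ (suc l)) (suc l) s≡))
    (trans (+-cong (δ-≢ {suc l} {l} ℕₚ.1+n≢n) (trans (*-congˡ (δ-refl l)) (*-identityʳ p))) (+-identityˡ p))

  trTerm : Gen → ℕ → Carrier
  trTerm s l = act s (δ l) l

  -- Vertex 0 is fixed by `c` and gives `ρ`; the remaining vertices pair up into the edges of `c`,
  -- each with diagonal entries 0 below and `p` above.
  ∑-trTerm-c : ∀ a → suc (2 * a) ≤ N → ∑ (suc (2 * a)) (trTerm c) ≈ ρ ⊕ a ⋆ p
  ∑-trTerm-c zero    _ = +-congʳ (trTerm-bottom c refl)
  ∑-trTerm-c (suc a) bound = begin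
    ∑ (suc (2 * suc a)) (trTerm c)
      ≡⟨ ≡.cong (λ n → ∑ (suc n) (trTerm c)) (ℕₚ.*-suc 2 a) ⟩
    trTerm c (2 + 2 * a) ⊕ (trTerm c (1 + 2 * a) ⊕ ∑ (suc (2 * a)) (trTerm c))
      ≈⟨ +-cong (trTerm-down c (suc (2 * a)) (≡.sym (≡.trans (other-involutive _) (letter-2* c a))))
           (+-cong (trTerm-up c (suc (2 * a)) (ℕₚ.<⇒≤ bound′) (≡.sym (≡.trans (other-involutive _) (letter-2* c a))))
             (∑-trTerm-c a (ℕₚ.≤-trans (ℕₚ.m≤n+m _ 2) bound′))) ⟩
    p ⊕ (0# ⊕ (ρ ⊕ a ⋆ p))
      ≈⟨ solve 3 (λ p ρ x → p :+ (:0 :+ (ρ :+ x)) := ρ :+ (p :+ x)) ≈-refl p ρ (a ⋆ p) ⟩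
    ρ ⊕ suc a ⋆ p ∎
    where
    bound′ : 3 + 2 * a ≤ N
    bound′ = ≡.subst (λ n → suc n ≤ N) (ℕₚ.*-suc 2 a) bound

  ∑-trTerm-c′ : ∀ a → 2 * a ≤ N → ∑ (2 * a) (trTerm (other c)) ≈ a ⋆ p
  ∑-trTerm-c′ zero    _ = ≈-refl
  ∑-trTerm-c′ (suc a) bound = begin
    ∑ (2 * suc a) (trTerm (other c))
      ≡⟨ ≡.cong (λ n → ∑ n (trTerm (other c))) (ℕₚ.*-suc 2 a) ⟩
    trTerm (other c) (1 + 2 * a) ⊕ (trTerm (other c) (2 * a) ⊕ ∑ (2 * a) (trTerm (other c)))
      ≈⟨ +-cong (trTerm-down (other c) (2 * a) (≡.cong other (≡.sym (letter-2* c a))))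
           (+-cong (trTerm-up (other c) (2 * a) (ℕₚ.<⇒≤ bound′) (≡.cong other (≡.sym (letter-2* c a))))
             (∑-trTerm-c′ a (ℕₚ.≤-trans (ℕₚ.m≤n+m _ 2) bound′))) ⟩
    p ⊕ (0# ⊕ a ⋆ p)
      ≈⟨ +-congˡ (+-identityˡ _) ⟩
    suc a ⋆ p ∎
    where
    bound′ : 2 + 2 * a ≤ N
    bound′ = ≡.subst (_≤ N) (ℕₚ.*-suc 2 a) bound

  downLetter-N-even : ∀ {r} → N ≡ 2 * r → downLetter N ≡ c
  downLetter-N-even {r} N≡2r = ≡.trans (≡.cong downLetter N≡2r) (letter-2* c r)

  downLetter-N-odd : ∀ {r} → N ≡ suc (2 * r) → downLetter N ≡ other c
  downLetter-N-odd {r} N≡1+2r = ≡.trans (≡.cong downLetter N≡1+2r) (≡.cong other (letter-2* c r))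

  -- The number of vertices is odd, so each letter has exactly one free end, `c` at the bottom and
  -- `other c` at the top, besides r edges.
  tr-one-odd : ∀ s r → 1 ≤ N → N ≡ 2 * r → tr s 1 ≈ ρ ⊕ r ⋆ p
  tr-one-odd s zero    1≤N N≡0 with () ← ℕₚ.<⇒≢ 1≤N (≡.sym N≡0)
  tr-one-odd s (suc r) _   N≡2r with s ≟G c
  ... | yes refl = begin
    trTerm c N ⊕ ∑ N (trTerm c)
      ≡⟨ ≡.cong (λ n → trTerm c n ⊕ ∑ n (trTerm c)) N≡2+2r ⟩
    trTerm c (2 + 2 * r) ⊕ (trTerm c (1 + 2 * r) ⊕ ∑ (suc (2 * r)) (trTerm c))
      ≈⟨ +-cong (trTerm-down c (suc (2 * r)) (≡.sym (≡.trans (other-involutive _) (letter-2* c r))))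
           (+-cong (trTerm-up c (suc (2 * r)) 2+2r≤N (≡.sym (≡.trans (other-involutive _) (letter-2* c r))))
             (∑-trTerm-c r (ℕₚ.<⇒≤ 2+2r≤N))) ⟩
    p ⊕ (0# ⊕ (ρ ⊕ r ⋆ p))
      ≈⟨ solve 3 (λ p ρ x → p :+ (:0 :+ (ρ :+ x)) := ρ :+ (p :+ x)) ≈-refl p ρ (r ⋆ p) ⟩
    ρ ⊕ suc r ⋆ p ∎
    where
    N≡2+2r : N ≡ 2 + 2 * r
    N≡2+2r = ≡.trans N≡2r (ℕₚ.*-suc 2 r)
    2+2r≤N : 2 + 2 * r ≤ N
    2+2r≤N = ℕₚ.≤-reflexive (≡.sym N≡2+2r)
  ... | no s≢c with ≢⇒≡other s≢c
  ... | refl = +-cong (trTerm-top (other c) (≡.cong other (≡.sym (downLetter-N-even {suc r} N≡2r))))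
    (trans (reflexive (≡.cong (λ n → ∑ n (trTerm (other c))) N≡2r)) (∑-trTerm-c′ (suc r) (ℕₚ.≤-reflexive (≡.sym N≡2r))))

  -- With an even number of vertices both free ends belong to `c`, and `other c` matches the
  -- vertices perfectly. This asymmetry is the case distinction on conjugacy in the statement.
  tr-one-even-c : ∀ r → N ≡ suc (2 * r) → tr c 1 ≈ (ρ ⊕ ρ) ⊕ r ⋆ p
  tr-one-even-c r N≡1+2r = trans
    (+-cong (trTerm-top c (≡.sym (≡.trans (≡.cong other (downLetter-N-odd {r} N≡1+2r)) (other-involutive c))))
      (trans (reflexive (≡.cong (λ n → ∑ n (trTerm c)) N≡1+2r)) (∑-trTerm-c r (ℕₚ.≤-reflexive (≡.sym N≡1+2r)))))
    (sym (+-assoc _ _ _))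

  tr-one-even-c′ : ∀ r → N ≡ suc (2 * r) → tr (other c) 1 ≈ suc r ⋆ p
  tr-one-even-c′ r N≡1+2r = begin
    trTerm (other c) N ⊕ ∑ N (trTerm (other c))
      ≡⟨ ≡.cong (λ n → trTerm (other c) n ⊕ ∑ n (trTerm (other c))) N≡1+2r ⟩
    trTerm (other c) (suc (2 * r)) ⊕ (trTerm (other c) (2 * r) ⊕ ∑ (2 * r) (trTerm (other c)))
      ≈⟨ +-cong (trTerm-down (other c) (2 * r) (≡.cong other (≡.sym (letter-2* c r))))
           (+-cong (trTerm-up (other c) (2 * r) 2r<N (≡.cong other (≡.sym (letter-2* c r))))
             (∑-trTerm-c′ r (ℕₚ.<⇒≤ 2r<N))) ⟩
    p ⊕ (0# ⊕ r ⋆ p)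
      ≈⟨ +-congˡ (+-identityˡ _) ⟩
    suc r ⋆ p ∎
    where
    2r<N : 2 * r < N
    2r<N = ℕₚ.≤-reflexive (≡.sym N≡1+2r)

-- Normal forms, cosets and conjugacy in the dihedral group.

module DihedralGroup (N : ℕ) where
  open Dihedral (suc N)
  open ≡.≡-Reasoning

  alt-injective : ∀ {s t} {i : Fin N} → alt {suc N} s i ≡ alt t i → s ≡ t
  alt-injective refl = refl

  mkWord-< : ∀ s {n} (n<N : n < N) → mkWord s (suc n) ≡ alt s (fromℕ< n<N)
  mkWord-< s {n} n<N with n ℕ.<? N
  ... | yes _   = refl
  ... | no  n≮N = contradiction n<N n≮N

  mkWord-top : ∀ s → mkWord s (suc N) ≡ w₀
  mkWord-top s with N ℕ.<? N
  ... | yes N<N = contradiction N<N (ℕₚ.<-irrefl refl)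
  ... | no  _   = refl

  data Bounded (n : ℕ) : Set where
    below : n < N → Bounded n
    top   : n ≡ N → Bounded n

  bounded : ∀ {n} → n ≤ N → Bounded n
  bounded {n} n≤N with n ℕₚ.≟ N
  ... | yes n≡N = top n≡N
  ... | no  n≢N = below (ℕₚ.≤∧≢⇒< n≤N n≢N)

  leftMul-ascend : ∀ s n → n ≤ N → leftMul s (mkWord (other s) n) ≡ mkWord s (suc n)
  leftMul-ascend s zero    _   = refl
  leftMul-ascend s (suc n) n<N rewrite mkWord-< (other s) n<N with s ≟G other s
  ... | yes s≡ = contradiction (≡.sym s≡) (other-≢ s)
  ... | no  _  = ≡.cong (λ x → mkWord s (2 + x)) (toℕ-fromℕ< n<N)

  leftMul-descend : ∀ s n → n ≤ N → leftMul s (mkWord s (suc n)) ≡ mkWord (other s) n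
  leftMul-descend s n n≤N with bounded n≤N
  ... | top refl  rewrite mkWord-top s = refl
  ... | below n<N rewrite mkWord-< s n<N with s ≟G s
  ...   | yes _  = ≡.cong (mkWord (other s)) (toℕ-fromℕ< n<N)
  ...   | no s≢s = contradiction refl s≢s

  len-mkWord : ∀ s n → n ≤ suc N → len (mkWord s n) ≡ n
  len-mkWord s zero    _         = refl
  len-mkWord s (suc n) (s≤s n≤N) with bounded n≤N
  ... | top refl  rewrite mkWord-top s = refl
  ... | below n<N rewrite mkWord-< s n<N = ≡.cong suc (toℕ-fromℕ< n<N)

  word-mkWord : ∀ s n → n ≤ N → word (mkWord s n) ≡ altList s n
  word-mkWord s zero    _   = refl
  word-mkWord s (suc n) n<N rewrite mkWord-< s n<N = ≡.cong (altList s ∘ suc) (toℕ-fromℕ< n<N)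

  data IsWord : El (suc N) → Set where
    isWord : ∀ s n → n ≤ N → IsWord (mkWord s (suc n))
    isE    : IsWord e

  isWord? : ∀ x → IsWord x
  isWord? e         = isE
  isWord? (alt s i) = ≡.subst IsWord (≡.trans (mkWord-< s (toℕ<n i)) (≡.cong (alt s) (fromℕ<-toℕ i (toℕ<n i))))
    (isWord s (toℕ i) (ℕₚ.<⇒≤ (toℕ<n i)))
  isWord? w₀        = ≡.subst IsWord (mkWord-top s₁) (isWord s₁ N ℕₚ.≤-refl)

  -- Every element with the letter that `s` would add or cancel made visible. The longest element
  -- has a word starting with either letter and is filed under `descends`.
  data Side (s : Gen) : El (suc N) → Set where
    ascends  : ∀ n → n ≤ N → Side s (mkWord (other s) n)
    descends : ∀ n → n ≤ N → Side s (mkWord s (suc n))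

  side : ∀ s x → Side s x
  side s x with isWord? x
  ... | isE = ascends 0 z≤n
  ... | isWord t n n≤N with t ≟G s
  ... | yes refl = descends n n≤N
  ... | no t≢s with ≢⇒≡other t≢s
  ... | refl with bounded n≤N
  ... | below n<N = ascends (suc n) n<N
  ... | top refl  = ≡.subst (Side s) (≡.trans (mkWord-top s) (≡.sym (mkWord-top (other s)))) (descends N ℕₚ.≤-refl)

  leftMul-involutive : ∀ s x → leftMul s (leftMul s x) ≡ x
  leftMul-involutive s x with side s x
  ... | ascends n n≤N  = ≡.trans (≡.cong (leftMul s) (leftMul-ascend s n n≤N)) (leftMul-descend s n n≤N)
  ... | descends n n≤N = ≡.trans (≡.cong (leftMul s) (leftMul-descend s n n≤N)) (leftMul-ascend s n n≤N)

  ascends? : Gen → El (suc N) → Bool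
  ascends? s x = len x <ᵇ len (leftMul s x)

  <ᵇ-true : ∀ {m n} → m < n → (m <ᵇ n) ≡ true
  <ᵇ-true m<n = Equivalence.to T-≡ (ℕₚ.<⇒<ᵇ m<n)

  <ᵇ-false : ∀ {m n} → n ≤ m → (m <ᵇ n) ≡ false
  <ᵇ-false {m} {n} n≤m with m <ᵇ n in eq
  ... | false = refl
  ... | true  = contradiction (ℕₚ.<ᵇ⇒< m n (Equivalence.from T-≡ eq)) (ℕₚ.≤⇒≯ n≤m)

  ascends?-ascend : ∀ s n → n ≤ N → ascends? s (mkWord (other s) n) ≡ true
  ascends?-ascend s n n≤N = <ᵇ-true (≡.subst₂ _<_
    (≡.sym (len-mkWord (other s) n (ℕₚ.m≤n⇒m≤1+n n≤N)))
    (≡.sym (≡.trans (≡.cong len (leftMul-ascend s n n≤N)) (len-mkWord s (suc n) (s≤s n≤N)))) (ℕₚ.n<1+n n))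

  ascends?-descend : ∀ s n → n ≤ N → ascends? s (mkWord s (suc n)) ≡ false
  ascends?-descend s n n≤N = <ᵇ-false (≡.subst₂ _≤_
    (≡.sym (≡.trans (≡.cong len (leftMul-descend s n n≤N)) (len-mkWord (other s) n (ℕₚ.m≤n⇒m≤1+n n≤N))))
    (≡.sym (len-mkWord s (suc n) (s≤s n≤N))) (ℕₚ.n≤1+n n))

  ascends?-leftMul : ∀ s x → ascends? s (leftMul s x) ≡ not (ascends? s x)
  ascends?-leftMul s x with side s x
  ... | ascends n n≤N  = ≡.trans (≡.cong (ascends? s) (leftMul-ascend s n n≤N))
    (≡.trans (ascends?-descend s n n≤N) (≡.cong not (≡.sym (ascends?-ascend s n n≤N))))
  ... | descends n n≤N = ≡.trans (≡.cong (ascends? s) (leftMul-descend s n n≤N))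
    (≡.trans (ascends?-ascend s n n≤N) (≡.cong not (≡.sym (ascends?-descend s n n≤N))))

  word-altList : ∀ w → ∃ λ s → word w ≡ altList s (len w)
  word-altList e         = s₁ , refl
  word-altList (alt s i) = s , refl
  word-altList w₀        = s₁ , refl

  len≤ : ∀ w → len w ≤ suc N
  len≤ e         = z≤n
  len≤ (alt s i) = ℕₚ.m≤n⇒m≤1+n (toℕ<n i)
  len≤ w₀        = ℕₚ.≤-refl

  -- The cosets of ⟨c⟩: D l is the minimal representative of length l, and
  -- Dc l = D l · c; both start with letter c l, the s with T_s moving l down.
  module Cosets (c : Gen) where

    D Dc : ℕ → El (suc N)
    D  l = mkWord (letter c l) l
    Dc l = mkWord (letter c l) (suc l)

    data Coset : El (suc N) → Set where
      inD  : ∀ l → l ≤ N → Coset (D l)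
      inDc : ∀ l → l ≤ N → Coset (Dc l)

    coset : ∀ x → Coset x
    coset x with isWord? x
    ... | isE = inD 0 z≤n
    ... | isWord t n n≤N with t ≟G letter c n
    ... | yes refl = inDc n n≤N
    ... | no t≢ with ≢⇒≡other t≢
    ... | refl with bounded n≤N
    ... | below n<N = inD (suc n) n<N
    ... | top refl  = ≡.subst Coset (≡.trans (mkWord-top _) (≡.sym (mkWord-top _))) (inDc N ℕₚ.≤-refl)

    len-D : ∀ l → l ≤ N → len (D l) ≡ l
    len-D l l≤N = len-mkWord _ l (ℕₚ.m≤n⇒m≤1+n l≤N)

    len-Dc : ∀ l → l ≤ N → len (Dc l) ≡ suc l
    len-Dc l l≤N = len-mkWord _ (suc l) (s≤s l≤N)

    D-injective : ∀ {l j} → l ≤ N → j ≤ N → D l ≡ D j → l ≡ j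
    D-injective {l} {j} l≤N j≤N eq = ≡.trans (≡.sym (len-D l l≤N)) (≡.trans (≡.cong len eq) (len-D j j≤N))

    Dc-injective : ∀ {l j} → l ≤ N → j ≤ N → Dc l ≡ Dc j → l ≡ j
    Dc-injective {l} {j} l≤N j≤N eq = ℕₚ.suc-injective (≡.trans (≡.sym (len-Dc l l≤N)) (≡.trans (≡.cong len eq) (len-Dc j j≤N)))

    D≢Dc : ∀ {l j} → l ≤ N → j ≤ N → D l ≢ Dc j
    D≢Dc {l} {j} l≤N j≤N eq with ≡.trans (≡.sym (len-D l l≤N)) (≡.trans (≡.cong len eq) (len-Dc j j≤N))
    ... | refl rewrite mkWord-< (letter c l) l≤N | mkWord-< (letter c j) l≤N = other-≢ (letter c j) (alt-injective eq)

    altList-c : ∀ s n → n ≤ N → letter s n ≡ c → foldr leftMul (gen c) (altList s n) ≡ mkWord s (suc n)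
    altList-c s zero    _   refl = refl
    altList-c s (suc n) n<N eq = ≡.trans (≡.cong (leftMul s) (altList-c (other s) n (ℕₚ.<⇒≤ n<N) (≡.trans (letter-other s n) eq)))
      (leftMul-ascend s (suc n) n<N)

    altList-c-cancel : ∀ s n → n ≤ N → letter s n ≡ c → foldr leftMul (gen c) (altList s (suc n)) ≡ mkWord s n
    altList-c-cancel s zero    n≤N refl = leftMul-descend s 0 n≤N
    altList-c-cancel s (suc n) n<N eq = ≡.trans (≡.cong (leftMul s) (altList-c-cancel (other s) n (ℕₚ.<⇒≤ n<N) (≡.trans (letter-other s n) eq)))
      (leftMul-ascend s n (ℕₚ.<⇒≤ n<N))

    letter-letter : ∀ l → letter (letter c l) l ≡ c
    letter-letter l = ≡.trans (≡.sym (letter-+ c l l)) (≡.trans (≡.cong (λ x → letter c (l + x)) (≡.sym (ℕₚ.+-identityʳ l))) (letter-2* c l))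

    D·c : ∀ l → l ≤ N → D l · gen c ≡ Dc l
    D·c l l≤N = ≡.trans (≡.cong (foldr leftMul (gen c)) (word-mkWord _ l l≤N)) (altList-c _ l l≤N (letter-letter l))

    Dc·c : ∀ l → l ≤ N → Dc l · gen c ≡ D l
    Dc·c l l≤N with bounded l≤N
    ... | below l<N = ≡.trans (≡.cong (foldr leftMul (gen c)) (word-mkWord _ (suc l) l<N)) (altList-c-cancel _ l l≤N (letter-letter l))
    -- The stored word of `w₀` starts with `s₁`. If `letter c N` is `s₁`, this word ends in `c`,
    -- which cancels. Otherwise its tail is the word of `D N`, so the product is `s₁` times D N · c,
    -- that is `s₁` times the longest element.
    ... | top refl with s₁ ≟G letter c N
    ... | yes eq = begin
      mkWord (letter c N) (suc N) · gen c         ≡⟨ ≡.cong (_· gen c) (mkWord-top _) ⟩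
      foldr leftMul (gen c) (altList s₁ (suc N))  ≡⟨ ≡.cong (λ s → foldr leftMul (gen c) (altList s (suc N))) eq ⟩
      foldr leftMul (gen c) (altList (letter c N) (suc N)) ≡⟨ altList-c-cancel _ N ℕₚ.≤-refl (letter-letter N) ⟩
      D N                                         ∎
    ... | no neq = begin
      mkWord (letter c N) (suc N) · gen c                              ≡⟨ ≡.cong (_· gen c) (mkWord-top _) ⟩
      leftMul s₁ (foldr leftMul (gen c) (altList (other s₁) N))        ≡⟨ ≡.cong (λ s → leftMul s₁ (foldr leftMul (gen c) (altList s N))) other≡ ⟩
      leftMul s₁ (foldr leftMul (gen c) (altList (letter c N) N))      ≡⟨ ≡.cong (leftMul s₁) (altList-c _ N ℕₚ.≤-refl (letter-letter N)) ⟩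
      leftMul s₁ (mkWord (letter c N) (suc N))                         ≡⟨ ≡.cong (leftMul s₁) (≡.trans (mkWord-top _) (≡.sym (mkWord-top s₁))) ⟩
      leftMul s₁ (mkWord s₁ (suc N))                                   ≡⟨ leftMul-descend s₁ N ℕₚ.≤-refl ⟩
      mkWord (other s₁) N                                              ≡⟨ ≡.cong (λ s → mkWord s N) other≡ ⟩
      D N                                                              ∎
      where
      other≡ : other s₁ ≡ letter c N
      other≡ = ≡.trans (≡.cong other (≢⇒≡other neq)) (other-involutive _)

  -- The class invariant of reflections for even m.

  module Conjugacy (r : ℕ) (1+N≡2r : suc N ≡ 2 * r) (c : Gen) where

    isC : Gen → Bool
    isC s with s ≟G c
    ... | yes _ = true
    ... | no  _ = false

    isC-c : isC c ≡ true
    isC-c with c ≟G c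
    ... | yes _  = refl
    ... | no c≢c = contradiction refl c≢c

    isC⇒≡c : ∀ {s} → isC s ≡ true → s ≡ c
    isC⇒≡c {s} eq with s ≟G c
    ... | yes s≡c = s≡c

    isC-other : ∀ s → isC (other s) ≡ not (isC s)
    isC-other s with s ≟G c | other s ≟G c
    ... | yes refl | yes eq  = contradiction eq (other-≢ s)
    ... | yes refl | no  _   = refl
    ... | no  _    | yes _   = refl
    ... | no  s≢c  | no  s′≢c = contradiction (≡.trans (≡.cong other (≢⇒≡other s≢c)) (other-involutive c)) s′≢c

    -- Additive form of the character of the group that sends `c` to -1 and the other generator to
    -- 1; it separates the two classes of reflections.
    parity : List Gen → Bool
    parity = foldr (λ s b → isC s xor b) false

    parity-++ : ∀ xs ys → parity (xs ++ ys) ≡ parity xs xor parity ys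
    parity-++ []       ys = refl
    parity-++ (x ∷ xs) ys = ≡.trans (≡.cong (isC x xor_) (parity-++ xs ys)) (≡.sym (xor-assoc (isC x) (parity xs) (parity ys)))

    parity-reverse : ∀ xs → parity (reverse xs) ≡ parity xs
    parity-reverse []       = refl
    parity-reverse (x ∷ xs) = begin
      parity (reverse (x ∷ xs))                ≡⟨ ≡.cong parity (unfold-reverse x xs) ⟩
      parity (reverse xs ++ (x ∷ []))          ≡⟨ parity-++ (reverse xs) (x ∷ []) ⟩
      parity (reverse xs) xor (isC x xor false) ≡⟨ ≡.cong₂ _xor_ (parity-reverse xs) (xor-identityʳ (isC x)) ⟩
      parity xs xor isC x                      ≡⟨ xor-comm (parity xs) (isC x) ⟩
      isC x xor parity xs                      ∎

    parity-pair : ∀ s xs → parity (s ∷ other s ∷ xs) ≡ not (parity xs)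
    parity-pair s xs rewrite isC-other s with isC s
    ... | true  = refl
    ... | false = refl

    parity-swap : ∀ k s → parity (altList (other s) (2 * k)) ≡ parity (altList s (2 * k))
    parity-swap zero    s = refl
    parity-swap (suc k) s = ≡.subst (λ n → parity (altList (other s) n) ≡ parity (altList s n)) (≡.sym (ℕₚ.*-suc 2 k)) (begin
      parity (altList (other s) (2 + 2 * k))                    ≡⟨ parity-pair (other s) (altList (other (other (other s))) (2 * k)) ⟩
      not (parity (altList (other (other (other s))) (2 * k)))  ≡⟨ ≡.cong (λ t → not (parity (altList t (2 * k)))) (other-involutive (other s)) ⟩
      not (parity (altList (other s) (2 * k)))                  ≡⟨ ≡.cong not (parity-swap k s) ⟩
      not (parity (altList s (2 * k)))                          ≡⟨ ≡.cong (λ t → not (parity (altList t (2 * k)))) (other-involutive s) ⟨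
      not (parity (altList (other (other s)) (2 * k)))          ≡⟨ parity-pair s (altList (other (other s)) (2 * k)) ⟨
      parity (altList s (2 + 2 * k))                            ∎)

    -- The word has k + 1 copies of its first letter and k of the other one. Exactly one of these
    -- numbers is odd, and it belongs to the middle letter.
    parity-altList-odd : ∀ k s → parity (altList s (suc (2 * k))) ≡ isC (letter s k)
    parity-altList-odd zero    s = xor-identityʳ (isC s)
    parity-altList-odd (suc k) s = begin
      parity (altList s (suc (2 * suc k)))                                ≡⟨ ≡.cong (parity ∘ altList s ∘ suc) (ℕₚ.*-suc 2 k) ⟩
      parity (altList s (3 + 2 * k))                                      ≡⟨ parity-pair s (altList (other (other s)) (suc (2 * k))) ⟩
      not (parity (altList (other (other s)) (suc (2 * k))))              ≡⟨ ≡.cong (λ t → not (parity (altList t (suc (2 * k))))) (other-involutive s) ⟩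
      not (parity (altList s (suc (2 * k))))                              ≡⟨ ≡.cong not (parity-altList-odd k s) ⟩
      not (isC (letter s k))                                              ≡⟨ isC-other (letter s k) ⟨
      isC (other (letter s k))                                            ∎

    -- The two words of w₀ agree in parity because m = 2 r is even.
    parity-mkWord : ∀ s n → n ≤ suc N → parity (word (mkWord s n)) ≡ parity (altList s n)
    parity-mkWord s zero    _         = refl
    parity-mkWord s (suc n) (s≤s n≤N) with bounded n≤N
    ... | below n<N = ≡.cong parity (word-mkWord s (suc n) n<N)
    ... | top refl rewrite mkWord-top s with s₁ ≟G s
    ...   | yes refl = refl
    ...   | no  s₁≢s = begin
      parity (altList s₁ (suc N))         ≡⟨ ≡.cong₂ (λ t n → parity (altList t n)) (≢⇒≡other s₁≢s) 1+N≡2r ⟩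
      parity (altList (other s) (2 * r))  ≡⟨ parity-swap r s ⟩
      parity (altList s (2 * r))          ≡⟨ ≡.cong (parity ∘ altList s) 1+N≡2r ⟨
      parity (altList s (suc N))          ∎

    parity-leftMul : ∀ s x → parity (word (leftMul s x)) ≡ isC s xor parity (word x)
    parity-leftMul s x with side s x
    ... | ascends n n≤N = begin
      parity (word (leftMul s (mkWord (other s) n)))        ≡⟨ ≡.cong (parity ∘ word) (leftMul-ascend s n n≤N) ⟩
      parity (word (mkWord s (suc n)))                      ≡⟨ parity-mkWord s (suc n) (s≤s n≤N) ⟩
      isC s xor parity (altList (other s) n)                ≡⟨ ≡.cong (isC s xor_) (parity-mkWord (other s) n (ℕₚ.m≤n⇒m≤1+n n≤N)) ⟨
      isC s xor parity (word (mkWord (other s) n))          ∎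
    ... | descends n n≤N = begin
      parity (word (leftMul s (mkWord s (suc n))))          ≡⟨ ≡.cong (parity ∘ word) (leftMul-descend s n n≤N) ⟩
      parity (word (mkWord (other s) n))                    ≡⟨ parity-mkWord (other s) n (ℕₚ.m≤n⇒m≤1+n n≤N) ⟩
      parity (altList (other s) n)                          ≡⟨ xor-cancel (isC s) _ ⟨
      isC s xor (isC s xor parity (altList (other s) n))    ≡⟨ ≡.cong (isC s xor_) (parity-mkWord s (suc n) (s≤s n≤N)) ⟨
      isC s xor parity (word (mkWord s (suc n)))            ∎
      where
      xor-cancel : ∀ x y → x xor (x xor y) ≡ y
      xor-cancel true  true  = refl
      xor-cancel true  false = refl
      xor-cancel false _     = refl

    parity-foldr : ∀ xs y → parity (word (foldr leftMul y xs)) ≡ parity xs xor parity (word y)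
    parity-foldr []       y = refl
    parity-foldr (x ∷ xs) y = ≡.trans (parity-leftMul x (foldr leftMul y xs))
      (≡.trans (≡.cong (isC x xor_) (parity-foldr xs y)) (≡.sym (xor-assoc (isC x) (parity xs) (parity (word y)))))

    parity-conjugate : ∀ g w → parity (word ((g · w) · inv g)) ≡ parity (word w)
    parity-conjugate g w = begin
      parity (word ((g · w) · inv g))                  ≡⟨ parity-foldr (word (g · w)) (inv g) ⟩
      parity (word (g · w)) xor parity (word (inv g))  ≡⟨ ≡.cong₂ _xor_ (parity-foldr (word g) w)
                                                           (≡.trans (parity-foldr (reverse (word g)) e) (≡.trans (xor-identityʳ _) (parity-reverse (word g)))) ⟩
      (x xor y) xor x                                  ≡⟨ xor-conjugate x y ⟩
      y                                                ∎
      where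
      x y : Bool
      x = parity (word g)
      y = parity (word w)
      xor-conjugate : ∀ x y → (x xor y) xor x ≡ y
      xor-conjugate true  true  = refl
      xor-conjugate true  false = refl
      xor-conjugate false y     = xor-identityʳ y

    parity-gen : parity (word (gen c)) ≡ true
    parity-gen = ≡.trans (parity-mkWord c 1 (s≤s z≤n)) (≡.trans (xor-identityʳ (isC c)) isC-c)

    ∼c⇒letter≡c : ∀ {w s} k → word w ≡ altList s (suc (2 * k)) → w ∼ gen c → letter s k ≡ c
    ∼c⇒letter≡c {w} {s} k word≡ (g , gwg⁻¹≡c) = isC⇒≡c (begin
      isC (letter s k)                     ≡⟨ parity-altList-odd k s ⟨
      parity (altList s (suc (2 * k)))     ≡⟨ ≡.cong parity word≡ ⟨
      parity (word w)                      ≡⟨ parity-conjugate g w ⟨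
      parity (word ((g · w) · inv g))      ≡⟨ ≡.cong (parity ∘ word) gwg⁻¹≡c ⟩
      parity (word (gen c))                ≡⟨ parity-gen ⟩
      true                                 ∎)

  foldr-leftMul-reverse : ∀ xs y → foldr leftMul (foldr leftMul y (reverse xs)) xs ≡ y
  foldr-leftMul-reverse []       y = refl
  foldr-leftMul-reverse (x ∷ xs) y = begin
    leftMul x (foldr leftMul (foldr leftMul y (reverse (x ∷ xs))) xs)
      ≡⟨ ≡.cong (λ zs → leftMul x (foldr leftMul (foldr leftMul y zs) xs)) (unfold-reverse x xs) ⟩
    leftMul x (foldr leftMul (foldr leftMul y (reverse xs ++ (x ∷ []))) xs)
      ≡⟨ ≡.cong (λ z → leftMul x (foldr leftMul z xs)) (foldr-++ leftMul y (reverse xs) (x ∷ [])) ⟩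
    leftMul x (foldr leftMul (foldr leftMul (leftMul x y) (reverse xs)) xs)
      ≡⟨ ≡.cong (leftMul x) (foldr-leftMul-reverse xs (leftMul x y)) ⟩
    leftMul x (leftMul x y)
      ≡⟨ leftMul-involutive x y ⟩
    y ∎

  -- Prepends the inverse of an alternating word letter by letter; the bound keeps every step
  -- length-increasing. With a = k it presents a word of length 2k+1 as g⁻¹ c g.
  grow : ∀ c k a → k + a ≤ N → foldr leftMul (mkWord c (suc a)) (reverse (altList (other c) k)) ≡ mkWord (letter c k) (suc (k + a))
  grow c zero    a _ = refl
  grow c (suc k) a k+a<N = begin
    foldr leftMul (mkWord c (suc a)) (reverse (other c ∷ altList (other (other c)) k))
      ≡⟨ ≡.cong (foldr leftMul (mkWord c (suc a))) (unfold-reverse (other c) (altList (other (other c)) k)) ⟩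
    foldr leftMul (mkWord c (suc a)) (reverse (altList (other (other c)) k) ++ (other c ∷ []))
      ≡⟨ foldr-++ leftMul (mkWord c (suc a)) (reverse (altList (other (other c)) k)) (other c ∷ []) ⟩
    foldr leftMul (leftMul (other c) (mkWord c (suc a))) (reverse (altList (other (other c)) k))
      ≡⟨ ≡.cong (λ z → foldr leftMul z (reverse (altList (other (other c)) k))) step ⟩
    foldr leftMul (mkWord (other c) (2 + a)) (reverse (altList (other (other c)) k))
      ≡⟨ grow (other c) k (suc a) (≡.subst (_≤ N) (≡.sym (ℕₚ.+-suc k a)) k+a<N) ⟩
    mkWord (letter (other c) k) (suc (k + suc a))
      ≡⟨ ≡.cong₂ (λ s n → mkWord s (suc n)) (letter-other c k) (ℕₚ.+-suc k a) ⟩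
    mkWord (letter c (suc k)) (2 + (k + a)) ∎
    where
    step : leftMul (other c) (mkWord c (suc a)) ≡ mkWord (other c) (2 + a)
    step = ≡.trans (≡.cong (λ s → leftMul (other c) (mkWord s (suc a))) (≡.sym (other-involutive c)))
      (leftMul-ascend (other c) (suc a) (ℕₚ.≤-trans (s≤s (ℕₚ.m≤n+m a k)) k+a<N))

  -- Conjugating by g = mkWord (other c) k cancels the first and the last k letters.
  odd∼c : ∀ c k → suc (2 * k) ≤ N → mkWord (letter c k) (suc (2 * k)) ∼ gen c
  odd∼c c k bound = g , (begin
    (g · mkWord (letter c k) (suc (2 * k))) · inv g
      ≡⟨ ≡.cong (λ z → (g · z) · inv g) (≡.trans (≡.cong (λ n → mkWord (letter c k) (suc (k + n))) (ℕₚ.+-identityʳ k)) (≡.sym (grow c k k 2k≤N))) ⟩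
    (g · foldr leftMul (mkWord c (suc k)) (reverse (altList (other c) k))) · inv g
      ≡⟨ ≡.cong (λ zs → (g · foldr leftMul (mkWord c (suc k)) (reverse zs)) · inv g) word-g ⟨
    (g · foldr leftMul (mkWord c (suc k)) (reverse (word g))) · inv g
      ≡⟨ ≡.cong (_· inv g) (foldr-leftMul-reverse (word g) (mkWord c (suc k))) ⟩
    mkWord c (suc k) · inv g
      ≡⟨ ≡.cong (foldr leftMul (inv g)) (≡.trans (word-mkWord c (suc k) (ℕₚ.≤-trans (s≤s (ℕₚ.m≤m+n k _)) bound)) (≡.cong (c ∷_) (≡.sym word-g))) ⟩
    leftMul c (foldr leftMul (inv g) (word g))
      ≡⟨ ≡.cong (leftMul c) (foldr-leftMul-reverse (word g) e) ⟩
    gen c ∎)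
    where
    2k≤N : k + k ≤ N
    2k≤N = ≡.subst (_≤ N) (≡.cong (k +_) (ℕₚ.+-identityʳ k)) (ℕₚ.<⇒≤ bound)
    g : El (suc N)
    g = mkWord (other c) k
    word-g : word g ≡ altList (other c) k
    word-g = word-mkWord (other c) k (ℕₚ.m+n≤o⇒m≤o k 2k≤N)

  -- Only for w₀ can word w and mkWord disagree, and its length exceeds N.
  mkWord-altList : ∀ w → len w ≤ N → ∃ λ s → word w ≡ altList s (len w) × w ≡ mkWord s (len w)
  mkWord-altList e         _   = s₁ , refl , refl
  mkWord-altList (alt s i) _   = s , refl , ≡.sym (≡.trans (mkWord-< s (toℕ<n i)) (≡.cong (alt s) (fromℕ<-toℕ i (toℕ<n i))))
  mkWord-altList w₀        N<N = contradiction N<N ℕₚ.1+n≰n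

module _ {a} {A : Set a} {b : Bool} {x y : A} where

  if-true : b ≡ true → (if b then x else y) ≡ x
  if-true refl = refl

  if-false : b ≡ false → (if b then x else y) ≡ y
  if-false refl = refl

-- Left multiplication in the Hecke algebra, in coordinates.

module HeckeAlgebra {a ℓ : Level} (R : CommutativeRing a ℓ) (q : CommutativeRing.Carrier R) (N : ℕ) where
  open CommutativeRing R renaming (_+_ to _⊕_; _*_ to _⊛_; refl to ≈-refl) hiding (zero)
  open Algebra.Properties.Ring ring
  open Relation.Binary.Reasoning.Setoid setoid
  open IntegerCoefficients R
  open Sums R
  open Hecke R (suc N) q
  open DihedralGroup N

  p : Carrier
  p = q - 1#

  sumList : (El (suc N) → Carrier) → List (El (suc N)) → Carrier
  sumList f = foldr (λ x acc → f x ⊕ acc) 0#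

  sumList-++ : ∀ f xs ys → sumList f (xs ++ ys) ≈ sumList f xs ⊕ sumList f ys
  sumList-++ f []       ys = sym (+-identityˡ _)
  sumList-++ f (x ∷ xs) ys = trans (+-congˡ (sumList-++ f xs ys)) (sym (+-assoc _ _ _))

  sumList-cong : ∀ {f g} → (∀ x → f x ≈ g x) → ∀ xs → sumList f xs ≈ sumList g xs
  sumList-cong f≈g []       = ≈-refl
  sumList-cong f≈g (x ∷ xs) = +-cong (f≈g x) (sumList-cong f≈g xs)

  sumList-+ : ∀ f g xs → sumList (λ x → f x ⊕ g x) xs ≈ sumList f xs ⊕ sumList g xs
  sumList-+ f g []       = sym (+-identityˡ _)
  sumList-+ f g (x ∷ xs) = trans (+-congˡ (sumList-+ f g xs))
    (solve 4 (λ x y s t → (x :+ y) :+ (s :+ t) := (x :+ s) :+ (y :+ t)) ≈-refl _ _ _ _)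

  sumList-tabulate : ∀ f n (x : Fin n → El (suc N)) (g : ℕ → Carrier) → (∀ i → f (x i) ≈ g (toℕ i)) →
                     sumList f (tabulate x) ≈ ∑ n g
  sumList-tabulate f zero    x g fx≈g = ≈-refl
  sumList-tabulate f (suc n) x g fx≈g =
    trans (+-cong (fx≈g Fin.zero) (sumList-tabulate f n (x ∘ Fin.suc) (g ∘ suc) (fx≈g ∘ Fin.suc))) (sym (∑-first n g))

  sumList-alt : ∀ f s → sumList f (map (alt s) (allFin N)) ≈ ∑ N (λ l → f (mkWord s (suc l)))
  sumList-alt f s = trans (reflexive (≡.cong (sumList f) (map-tabulate id (alt s))))
    (sumList-tabulate f N (alt s) _ (λ i → reflexive (≡.cong f (≡.sym
      (≡.trans (mkWord-< s (toℕ<n i)) (≡.cong (alt s) (fromℕ<-toℕ i (toℕ<n i))))))))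

  T-refl : ∀ x → T x x ≈ 1#
  T-refl x with x ≟E x
  ... | yes _  = ≈-refl
  ... | no x≢x = contradiction refl x≢x

  T-≢ : ∀ {x y} → x ≢ y → T x y ≈ 0#
  T-≢ {x} {y} x≢y with x ≟E y
  ... | yes x≡y = contradiction x≡y x≢y
  ... | no  _   = ≈-refl

  module _ (c : Gen) where
    open Cosets c

    -- The two words of length l + 1 < m are `Dc l` and `D (suc l)` in some order, while `e` is
    -- `D 0` and `w₀` is `Dc N`; regrouping the list by length and shifting one family gives the
    -- cosets.
    sumEl-cosets : ∀ f → sumEl f ≈ ∑ (suc N) (λ l → f (D l) ⊕ f (Dc l))
    sumEl-cosets f = begin
      f e ⊕ sumList f (map (alt s₁) (allFin N) ++ map (alt s₂) (allFin N) ++ (w₀ ∷ []))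
        ≈⟨ +-congˡ (trans (sumList-++ f (map (alt s₁) (allFin N)) _) (+-congˡ (sumList-++ f (map (alt s₂) (allFin N)) _))) ⟩
      f e ⊕ (sumList f (map (alt s₁) (allFin N)) ⊕ (sumList f (map (alt s₂) (allFin N)) ⊕ (f w₀ ⊕ 0#)))
        ≈⟨ solve 4 (λ x y z t → x :+ (y :+ (z :+ (t :+ :0))) := (x :+ t) :+ (y :+ z)) ≈-refl _ _ _ _ ⟩
      (f e ⊕ f w₀) ⊕ (sumList f (map (alt s₁) (allFin N)) ⊕ sumList f (map (alt s₂) (allFin N)))
        ≈⟨ +-cong (+-congˡ (reflexive (≡.cong f (≡.sym (mkWord-top _))))) (trans (+-cong (sumList-alt f s₁) (sumList-alt f s₂)) (sym (∑-+ N _ _))) ⟩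
      (f (D 0) ⊕ f (Dc N)) ⊕ ∑ N (λ l → f (mkWord s₁ (suc l)) ⊕ f (mkWord s₂ (suc l)))
        ≈⟨ +-congˡ (trans (∑-cong N (λ l _ → swap l (letter c l))) (∑-+ N _ _)) ⟩
      (f (D 0) ⊕ f (Dc N)) ⊕ (∑ N (f ∘ Dc) ⊕ ∑ N (f ∘ D ∘ suc))
        ≈⟨ solve 4 (λ x y s t → (x :+ y) :+ (s :+ t) := (x :+ t) :+ (y :+ s)) ≈-refl _ _ _ _ ⟩
      (f (D 0) ⊕ ∑ N (f ∘ D ∘ suc)) ⊕ ∑ (suc N) (f ∘ Dc)
        ≈⟨ +-congʳ (∑-first N (f ∘ D)) ⟨
      ∑ (suc N) (f ∘ D) ⊕ ∑ (suc N) (f ∘ Dc)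
        ≈⟨ ∑-+ (suc N) _ _ ⟨
      ∑ (suc N) (λ l → f (D l) ⊕ f (Dc l)) ∎
      where
      swap : ∀ l s → f (mkWord s₁ (suc l)) ⊕ f (mkWord s₂ (suc l)) ≈ f (mkWord s (suc l)) ⊕ f (mkWord (other s) (suc l))
      swap l s₁ = ≈-refl
      swap l s₂ = +-comm _ _

    T-D-D : ∀ {l j} → l ≤ N → j ≤ N → T (D l) (D j) ≈ δ l j
    T-D-D {l} {j} l≤N j≤N with l ℕₚ.≟ j
    ... | yes refl = trans (T-refl (D l)) (sym (δ-refl l))
    ... | no  l≢j  = trans (T-≢ (l≢j ∘ D-injective l≤N j≤N)) (sym (δ-≢ l≢j))

    T-Dc-Dc : ∀ {l j} → l ≤ N → j ≤ N → T (Dc l) (Dc j) ≈ δ l j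
    T-Dc-Dc {l} {j} l≤N j≤N with l ℕₚ.≟ j
    ... | yes refl = trans (T-refl (Dc l)) (sym (δ-refl l))
    ... | no  l≢j  = trans (T-≢ (l≢j ∘ Dc-injective l≤N j≤N)) (sym (δ-≢ l≢j))

    T-D-Dc : ∀ {l j} → l ≤ N → j ≤ N → T (D l) (Dc j) ≈ 0#
    T-D-Dc l≤N j≤N = T-≢ (D≢Dc l≤N j≤N)

    T-Dc-D : ∀ {l j} → l ≤ N → j ≤ N → T (Dc l) (D j) ≈ 0#
    T-Dc-D l≤N j≤N = T-≢ (D≢Dc j≤N l≤N ∘ ≡.sym)

  sumEl-T : ∀ h y → sumEl (λ x → h x ⊛ T x y) ≈ h y
  sumEl-T h y with Cosets.coset s₁ y
  ... | Cosets.inD j j≤N = begin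
    sumEl (λ x → h x ⊛ T x (D j))
      ≈⟨ sumEl-cosets s₁ _ ⟩
    ∑ (suc N) (λ l → h (D l) ⊛ T (D l) (D j) ⊕ h (Dc l) ⊛ T (Dc l) (D j))
      ≈⟨ ∑-cong (suc N) (λ l l<1+N → trans (+-cong (*-congˡ (T-D-D s₁ (ℕₚ.≤-pred l<1+N) j≤N))
           (trans (*-congˡ (T-Dc-D s₁ (ℕₚ.≤-pred l<1+N) j≤N)) (zeroʳ _))) (+-identityʳ _)) ⟩
    ∑ (suc N) (λ l → h (D l) ⊛ δ l j)
      ≈⟨ ∑-δ (suc N) (h ∘ D) (s≤s j≤N) ⟩
    h (D j) ∎
    where open Cosets s₁
  ... | Cosets.inDc j j≤N = begin
    sumEl (λ x → h x ⊛ T x (Dc j))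
      ≈⟨ sumEl-cosets s₁ _ ⟩
    ∑ (suc N) (λ l → h (D l) ⊛ T (D l) (Dc j) ⊕ h (Dc l) ⊛ T (Dc l) (Dc j))
      ≈⟨ ∑-cong (suc N) (λ l l<1+N → trans (+-cong (trans (*-congˡ (T-D-Dc s₁ (ℕₚ.≤-pred l<1+N) j≤N)) (zeroʳ _))
           (*-congˡ (T-Dc-Dc s₁ (ℕₚ.≤-pred l<1+N) j≤N))) (+-identityˡ _)) ⟩
    ∑ (suc N) (λ l → h (Dc l) ⊛ δ l j)
      ≈⟨ ∑-δ (suc N) (h ∘ Dc) (s≤s j≤N) ⟩
    h (Dc j) ∎
    where open Cosets s₁

  T-leftMul : ∀ s x y → T (leftMul s x) y ≈ T x (leftMul s y)
  T-leftMul s x y with x ≟E leftMul s y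
  ... | yes refl = trans (reflexive (≡.cong (λ z → T z y) (leftMul-involutive s y))) (T-refl y)
  ... | no  x≢sy = T-≢ {leftMul s x} {y} λ sx≡y → x≢sy (≡.trans (≡.sym (leftMul-involutive s x)) (≡.cong (leftMul s) sx≡y))

  -- Separates scalars that depend on x alone from the indicator of a single point, so that
  -- `sumEl-T` can evaluate the sum over x.
  TgenT-split : ∀ s x y → TgenT s x y ≈ (if ascends? s x then 0# else p) ⊛ T x y
                                       ⊕ (if ascends? s x then 1# else q) ⊛ T x (leftMul s y)
  TgenT-split s x y with ascends? s x
  ... | true  = trans (T-leftMul s x y) (solve 2 (λ t u → u := :0 :* t :+ :1 :* u) ≈-refl (T x y) _)
  ... | false = +-congˡ (*-congˡ (T-leftMul s x y))

  -- Only `y` and `leftMul s y` contribute to the coefficient at y, and `s` raises exactly one of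
  -- the two.
  Tgen·-apply : ∀ s h y → Tgen· s h y ≈ (if ascends? s y then q ⊛ h (leftMul s y) else h (leftMul s y) ⊕ p ⊛ h y)
  Tgen·-apply s h y = begin
    sumEl (λ x → h x ⊛ TgenT s x y)
      ≈⟨ sumList-cong (λ x → trans (*-congˡ (TgenT-split s x y))
           (solve 5 (λ h x y z t → h :* (x :* y :+ z :* t) := (h :* x) :* y :+ (h :* z) :* t) ≈-refl (h x) (α x) _ (β x) _)) allEl ⟩
    sumEl (λ x → (h x ⊛ α x) ⊛ T x y ⊕ (h x ⊛ β x) ⊛ T x (leftMul s y))
      ≈⟨ trans (sumList-+ _ _ allEl) (+-cong (sumEl-T (λ x → h x ⊛ α x) y) (sumEl-T (λ x → h x ⊛ β x) (leftMul s y))) ⟩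
    h y ⊛ α y ⊕ h (leftMul s y) ⊛ β (leftMul s y)
      ≡⟨ ≡.cong (λ b → h y ⊛ α y ⊕ h (leftMul s y) ⊛ (if b then 1# else q)) (ascends?-leftMul s y) ⟩
    h y ⊛ α y ⊕ h (leftMul s y) ⊛ (if not (ascends? s y) then 1# else q)
      ≈⟨ final (ascends? s y) ⟩
    (if ascends? s y then q ⊛ h (leftMul s y) else h (leftMul s y) ⊕ p ⊛ h y) ∎
    where
    α β : El (suc N) → Carrier
    α x = if ascends? s x then 0# else p
    β x = if ascends? s x then 1# else q
    final : ∀ b → h y ⊛ (if b then 0# else p) ⊕ h (leftMul s y) ⊛ (if not b then 1# else q)
                ≈ (if b then q ⊛ h (leftMul s y) else h (leftMul s y) ⊕ p ⊛ h y)
    final true  = solve 3 (λ x y q → x :* :0 :+ y :* q := q :* y) ≈-refl (h y) _ q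
    final false = solve 3 (λ x y p → x :* p :+ y :* :1 := y :+ p :* x) ≈-refl (h y) _ p

  Tgen·-ascend : ∀ t h n → n ≤ N → Tgen· (other t) h (mkWord t n) ≈ q ⊛ h (mkWord (other t) (suc n))
  Tgen·-ascend t h n n≤N = ≡.subst (λ u → Tgen· (other t) h (mkWord u n) ≈ q ⊛ h (mkWord (other t) (suc n))) (other-involutive t)
    (trans (Tgen·-apply (other t) h _) (reflexive (≡.trans
      (if-true (ascends?-ascend (other t) n n≤N))
      (≡.cong (λ x → q ⊛ h x) (leftMul-ascend (other t) n n≤N)))))

  Tgen·-descend : ∀ s h n → n ≤ N → Tgen· s h (mkWord s (suc n)) ≈ h (mkWord (other s) n) ⊕ p ⊛ h (mkWord s (suc n))
  Tgen·-descend s h n n≤N = trans (Tgen·-apply s h _) (reflexive (≡.trans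
    (if-false (ascends?-descend s n n≤N))
    (≡.cong (λ x → h x ⊕ p ⊛ h (mkWord s (suc n))) (leftMul-descend s n n≤N))))

  -- Right multiplication by T_c and the identification with the path.

  module InducedModule (c : Gen) where
    open Cosets c

    Tgen·-D-top : ∀ h → Tgen· (other (letter c N)) h (D N) ≈ q ⊛ h (Dc N)
    Tgen·-D-top h = trans (Tgen·-ascend (letter c N) h N ℕₚ.≤-refl)
      (*-congˡ (reflexive (≡.cong h (≡.trans (mkWord-top _) (≡.sym (mkWord-top _))))))

    Tgen·-Dc-top : ∀ h → Tgen· (other (letter c N)) h (Dc N) ≈ h (D N) ⊕ p ⊛ h (Dc N)
    Tgen·-Dc-top h = begin
      Tgen· t h (mkWord (letter c N) (suc N))            ≡⟨ ≡.cong (Tgen· t h) w₀≡ ⟩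
      Tgen· t h (mkWord t (suc N))                       ≈⟨ Tgen·-descend t h N ℕₚ.≤-refl ⟩
      h (mkWord (other t) N) ⊕ p ⊛ h (mkWord t (suc N))  ≡⟨ ≡.cong₂ (λ s x → h (mkWord s N) ⊕ p ⊛ h x) (other-involutive _) (≡.sym w₀≡) ⟩
      h (D N) ⊕ p ⊛ h (Dc N)                             ∎
      where
      t : Gen
      t = other (letter c N)
      w₀≡ : mkWord (letter c N) (suc N) ≡ mkWord t (suc N)
      w₀≡ = ≡.trans (mkWord-top _) (≡.sym (mkWord-top _))

    Tgen·-D-down : ∀ h l → l < N → Tgen· (letter c (suc l)) h (D (suc l)) ≈ h (D l) ⊕ p ⊛ h (D (suc l))
    Tgen·-D-down h l l<N = trans (Tgen·-descend _ h l (ℕₚ.<⇒≤ l<N))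
      (+-congʳ (reflexive (≡.cong (λ s → h (mkWord s l)) (other-involutive _))))

    Tgen·-Dc-down : ∀ h l → l < N → Tgen· (letter c (suc l)) h (Dc (suc l)) ≈ h (Dc l) ⊕ p ⊛ h (Dc (suc l))
    Tgen·-Dc-down h l l<N = trans (Tgen·-descend _ h (suc l) l<N)
      (+-congʳ (reflexive (≡.cong (λ s → h (mkWord s (suc l))) (other-involutive _))))

    Tgen·-D-bottom : ∀ h → Tgen· c h (D 0) ≈ q ⊛ h (Dc 0)
    Tgen·-D-bottom h = ≡.subst (λ s → Tgen· s h e ≈ q ⊛ h (mkWord s 1)) (other-involutive c) (Tgen·-ascend (other c) h 0 z≤n)

    -- Coordinates of h′ = h T_c, from T_d T_c = T_{dc} and T_{dc} T_c = p T_{dc} + q T_d for a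
    -- minimal representative d.
    record RightMultiple (h h′ : H) : Set ℓ where
      field
        at-D  : ∀ l → l ≤ N → h′ (D l) ≈ q ⊛ h (Dc l)
        at-Dc : ∀ l → l ≤ N → h′ (Dc l) ≈ h (D l) ⊕ p ⊛ h (Dc l)
    open RightMultiple

    T-rightMultiple : ∀ {j} → j ≤ N → RightMultiple (T (D j)) (T (Dc j))
    T-rightMultiple {j} j≤N .at-D l l≤N = trans (T-Dc-D c j≤N l≤N) (sym (trans (*-congˡ (T-D-Dc c j≤N l≤N)) (zeroʳ q)))
    T-rightMultiple {j} j≤N .at-Dc l l≤N = begin
      T (Dc j) (Dc l)                        ≈⟨ trans (T-Dc-Dc c j≤N l≤N) (sym (T-D-D c j≤N l≤N)) ⟩
      T (D j) (D l)                          ≈⟨ +-identityʳ _ ⟨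
      T (D j) (D l) ⊕ 0#                     ≈⟨ +-congˡ (trans (*-congˡ (T-D-Dc c j≤N l≤N)) (zeroʳ p)) ⟨
      T (D j) (D l) ⊕ p ⊛ T (D j) (Dc l)     ∎

    -- Left multiplication by T_s commutes with right multiplication by T_c. Between two cosets both
    -- `D` and `Dc` move alike and the check is formal; at the two ends s d = d c, so both
    -- operations act on the coset in the same way. At the top this is the braid relation.
    Tgen·-rightMultiple : ∀ s {h h′} → RightMultiple h h′ → RightMultiple (Tgen· s h) (Tgen· s h′)
    Tgen·-rightMultiple s {h} {h′} rm .at-D l l≤N with s ≟G letter c l
    Tgen·-rightMultiple s {h} {h′} rm .at-D zero l≤N | yes refl = begin
      Tgen· c h′ (D 0)                  ≈⟨ Tgen·-D-bottom h′ ⟩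
      q ⊛ h′ (Dc 0)                     ≈⟨ *-congˡ (at-Dc rm 0 l≤N) ⟩
      q ⊛ (h (D 0) ⊕ p ⊛ h (Dc 0))      ≈⟨ *-congˡ (Tgen·-descend c h 0 z≤n) ⟨
      q ⊛ Tgen· c h (Dc 0)              ∎
    Tgen·-rightMultiple s {h} {h′} rm .at-D (suc l) l<N | yes refl = begin
      Tgen· s h′ (D (suc l))                          ≈⟨ Tgen·-D-down h′ l l<N ⟩
      h′ (D l) ⊕ p ⊛ h′ (D (suc l))                   ≈⟨ +-cong (at-D rm l (ℕₚ.<⇒≤ l<N)) (*-congˡ (at-D rm (suc l) l<N)) ⟩
      q ⊛ h (Dc l) ⊕ p ⊛ (q ⊛ h (Dc (suc l)))         ≈⟨ solve 4 (λ q p x y → q :* x :+ p :* (q :* y) := q :* (x :+ p :* y)) ≈-refl q p _ _ ⟩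
      q ⊛ (h (Dc l) ⊕ p ⊛ h (Dc (suc l)))             ≈⟨ *-congˡ (Tgen·-Dc-down h l l<N) ⟨
      q ⊛ Tgen· s h (Dc (suc l))                      ∎
    Tgen·-rightMultiple s {h} {h′} rm .at-D l l≤N | no s≢ with ≢⇒≡other s≢
    ... | refl with bounded l≤N
    ...   | below l<N = begin
      Tgen· s h′ (D l)                  ≈⟨ Tgen·-ascend (letter c l) h′ l l≤N ⟩
      q ⊛ h′ (D (suc l))                ≈⟨ *-congˡ (at-D rm (suc l) l<N) ⟩
      q ⊛ (q ⊛ h (Dc (suc l)))          ≈⟨ *-congˡ (Tgen·-ascend (letter c l) h (suc l) l<N) ⟨
      q ⊛ Tgen· s h (Dc l)              ∎
    ...   | top refl = begin
      Tgen· s h′ (D N)                  ≈⟨ Tgen·-D-top h′ ⟩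
      q ⊛ h′ (Dc N)                     ≈⟨ *-congˡ (at-Dc rm N l≤N) ⟩
      q ⊛ (h (D N) ⊕ p ⊛ h (Dc N))      ≈⟨ *-congˡ (Tgen·-Dc-top h) ⟨
      q ⊛ Tgen· s h (Dc N)              ∎
    Tgen·-rightMultiple s {h} {h′} rm .at-Dc l l≤N with s ≟G letter c l
    Tgen·-rightMultiple s {h} {h′} rm .at-Dc zero l≤N | yes refl = begin
      Tgen· c h′ (Dc 0)                                  ≈⟨ Tgen·-descend c h′ 0 z≤n ⟩
      h′ (D 0) ⊕ p ⊛ h′ (Dc 0)                           ≈⟨ +-cong (at-D rm 0 l≤N) (*-congˡ (at-Dc rm 0 l≤N)) ⟩
      q ⊛ h (Dc 0) ⊕ p ⊛ (h (D 0) ⊕ p ⊛ h (Dc 0))        ≈⟨ +-cong (Tgen·-D-bottom h) (*-congˡ (Tgen·-descend c h 0 z≤n)) ⟨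
      Tgen· c h (D 0) ⊕ p ⊛ Tgen· c h (Dc 0)             ∎
    Tgen·-rightMultiple s {h} {h′} rm .at-Dc (suc l) l<N | yes refl = begin
      Tgen· s h′ (Dc (suc l))
        ≈⟨ Tgen·-Dc-down h′ l l<N ⟩
      h′ (Dc l) ⊕ p ⊛ h′ (Dc (suc l))
        ≈⟨ +-cong (at-Dc rm l (ℕₚ.<⇒≤ l<N)) (*-congˡ (at-Dc rm (suc l) l<N)) ⟩
      (h (D l) ⊕ p ⊛ h (Dc l)) ⊕ p ⊛ (h (D (suc l)) ⊕ p ⊛ h (Dc (suc l)))
        ≈⟨ solve 5 (λ p x y z t → (x :+ p :* y) :+ p :* (z :+ p :* t) := (x :+ p :* z) :+ p :* (y :+ p :* t)) ≈-refl p _ _ _ _ ⟩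
      (h (D l) ⊕ p ⊛ h (D (suc l))) ⊕ p ⊛ (h (Dc l) ⊕ p ⊛ h (Dc (suc l)))
        ≈⟨ +-cong (Tgen·-D-down h l l<N) (*-congˡ (Tgen·-Dc-down h l l<N)) ⟨
      Tgen· s h (D (suc l)) ⊕ p ⊛ Tgen· s h (Dc (suc l)) ∎
    Tgen·-rightMultiple s {h} {h′} rm .at-Dc l l≤N | no s≢ with ≢⇒≡other s≢
    ... | refl with bounded l≤N
    ...   | below l<N = begin
      Tgen· s h′ (Dc l)                                  ≈⟨ Tgen·-ascend (letter c l) h′ (suc l) l<N ⟩
      q ⊛ h′ (Dc (suc l))                                ≈⟨ *-congˡ (at-Dc rm (suc l) l<N) ⟩
      q ⊛ (h (D (suc l)) ⊕ p ⊛ h (Dc (suc l)))           ≈⟨ solve 4 (λ q p x y → q :* (x :+ p :* y) := q :* x :+ p :* (q :* y)) ≈-refl q p _ _ ⟩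
      q ⊛ h (D (suc l)) ⊕ p ⊛ (q ⊛ h (Dc (suc l)))       ≈⟨ +-cong (Tgen·-ascend (letter c l) h l l≤N) (*-congˡ (Tgen·-ascend (letter c l) h (suc l) l<N)) ⟨
      Tgen· s h (D l) ⊕ p ⊛ Tgen· s h (Dc l)             ∎
    ...   | top refl = begin
      Tgen· s h′ (Dc N)                                  ≈⟨ Tgen·-Dc-top h′ ⟩
      h′ (D N) ⊕ p ⊛ h′ (Dc N)                           ≈⟨ +-cong (at-D rm N l≤N) (*-congˡ (at-Dc rm N l≤N)) ⟩
      q ⊛ h (Dc N) ⊕ p ⊛ (h (D N) ⊕ p ⊛ h (Dc N))        ≈⟨ +-cong (Tgen·-D-top h) (*-congˡ (Tgen·-Dc-top h)) ⟨
      Tgen· s h (D N) ⊕ p ⊛ Tgen· s h (Dc N)             ∎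

    foldr-rightMultiple : ∀ xs {j} → j ≤ N → RightMultiple (foldr Tgen· (T (D j)) xs) (foldr Tgen· (T (Dc j)) xs)
    foldr-rightMultiple []       j≤N = T-rightMultiple j≤N
    foldr-rightMultiple (x ∷ xs) j≤N = Tgen·-rightMultiple x (foldr-rightMultiple xs j≤N)

    decomp-D : ∀ l → l ≤ N → decomp H[ c ] (D l) ≡ (D l , false)
    decomp-D l l≤N rewrite D·c l l≤N | len-D l l≤N | len-Dc l l≤N | <ᵇ-false (ℕₚ.n≤1+n l) = refl

    decomp-Dc : ∀ l → l ≤ N → decomp H[ c ] (Dc l) ≡ (D l , true)
    decomp-Dc l l≤N rewrite Dc·c l l≤N | len-D l l≤N | len-Dc l l≤N | <ᵇ-true (ℕₚ.n<1+n l) = refl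

    indChar-H[c] : ∀ rep w → indChar rep H[ c ] w
                   ≈ ∑ (suc N) (λ l → mulT w (T (D l)) (D l) ⊕ mulT w (T (D l)) (Dc l) ⊛ onTc rep)
    indChar-H[c] rep w = trans (sumEl-cosets c _) (∑-cong (suc N) (λ l l<1+N → +-cong
      (trans (reflexive (≡.cong (weight (D l)) (decomp-D l (ℕₚ.≤-pred l<1+N)))) (*-identityʳ _))
      (reflexive (≡.cong (weight (Dc l)) (decomp-Dc l (ℕₚ.≤-pred l<1+N))))))
      where
      weight : El (suc N) → El (suc N) × Bool → Carrier
      weight x (d , u) = mulT w (T d) x ⊛ (if u then onTc rep else 1#)

    -- T_c acts on the right with trace q-1 = q + (-1), so inducing from H₀ to H_c
    -- splits the trace into a trivial and a sign part.
    indChar-H₀ : ∀ rep w → indChar rep H₀ w ≈ indChar trivial H[ c ] w ⊕ indChar sign H[ c ] w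
    indChar-H₀ rep w = begin
      indChar rep H₀ w
        ≈⟨ sumEl-cosets c _ ⟩
      ∑ (suc N) (λ l → mulT w (T (D l)) (D l) ⊛ 1# ⊕ mulT w (T (Dc l)) (Dc l) ⊛ 1#)
        ≈⟨ ∑-cong (suc N) (λ l l<1+N → trans
             (+-cong (*-identityʳ _) (trans (*-identityʳ _) (at-Dc (foldr-rightMultiple (word w) (ℕₚ.≤-pred l<1+N)) l (ℕₚ.≤-pred l<1+N))))
             (solve 3 (λ q x y → x :+ (x :+ (q :- :1) :* y) := (x :+ y :* q) :+ (x :+ y :* (:- :1))) ≈-refl q _ _)) ⟩
      ∑ (suc N) (λ l → (mulT w (T (D l)) (D l) ⊕ mulT w (T (D l)) (Dc l) ⊛ q) ⊕ (mulT w (T (D l)) (D l) ⊕ mulT w (T (D l)) (Dc l) ⊛ - 1#))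
        ≈⟨ ∑-+ (suc N) _ _ ⟩
      _ ⊕ _
        ≈⟨ +-cong (indChar-H[c] trivial w) (indChar-H[c] sign w) ⟨
      indChar trivial H[ c ] w ⊕ indChar sign H[ c ] w ∎

    module _ (ρ : Carrier) (ρ²≈pρ+q : ρ ⊛ ρ ≈ p ⊛ ρ ⊕ q) where
      open PathModule R q ρ N c hiding (p)

      -- The image of h in the induced module, in the basis T_d ⊗ 1: the factor T_c of T_{dc} passes
      -- through the tensor sign and becomes `ρ`.
      coord : H → Vect
      coord h l = h (D l) ⊕ h (Dc l) ⊛ ρ

      -- At an end of the path T_s acts on the pair of coefficients (x, y) as right multiplication
      -- by T_c does, hence as the scalar `ρ` after tensoring.
      coord-fixed : ∀ x y → q ⊛ y ⊕ (x ⊕ p ⊛ y) ⊛ ρ ≈ ρ ⊛ (x ⊕ y ⊛ ρ)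
      coord-fixed x y = begin
        q ⊛ y ⊕ (x ⊕ p ⊛ y) ⊛ ρ       ≈⟨ solve 5 (λ q p ρ x y → q :* y :+ (x :+ p :* y) :* ρ := ρ :* x :+ y :* (p :* ρ :+ q)) ≈-refl q p ρ x y ⟩
        ρ ⊛ x ⊕ y ⊛ (p ⊛ ρ ⊕ q)       ≈⟨ +-congˡ (*-congˡ ρ²≈pρ+q) ⟨
        ρ ⊛ x ⊕ y ⊛ (ρ ⊛ ρ)           ≈⟨ solve 3 (λ ρ x y → ρ :* x :+ y :* (ρ :* ρ) := ρ :* (x :+ y :* ρ)) ≈-refl ρ x y ⟩
        ρ ⊛ (x ⊕ y ⊛ ρ)               ∎

      coord-Tgen· : ∀ s h → coord (Tgen· s h) ≋ act s (coord h)
      coord-Tgen· s h l l≤N with s ≟G letter c l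
      coord-Tgen· s h zero    l≤N | yes refl = trans (+-cong (Tgen·-D-bottom h) (*-congʳ (Tgen·-descend c h 0 z≤n))) (coord-fixed _ _)
      coord-Tgen· s h (suc l) l<N | yes refl = trans (+-cong (Tgen·-D-down h l l<N) (*-congʳ (Tgen·-Dc-down h l l<N)))
        (solve 6 (λ p ρ x y z t → (x :+ p :* y) :+ (z :+ p :* t) :* ρ := (x :+ z :* ρ) :+ p :* (y :+ t :* ρ)) ≈-refl p ρ _ _ _ _)
      coord-Tgen· s h l       l≤N | no s≢ with ≢⇒≡other s≢
      ... | refl with bounded l≤N
      ...   | top refl = trans (trans (+-cong (Tgen·-D-top h) (*-congʳ (Tgen·-Dc-top h))) (coord-fixed _ _))
        (reflexive (≡.sym (up-top (coord h))))
      ...   | below l<N = begin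
        coord (Tgen· s h) l                              ≈⟨ +-cong (Tgen·-ascend (letter c l) h l l≤N) (*-congʳ (Tgen·-ascend (letter c l) h (suc l) l<N)) ⟩
        q ⊛ h (D (suc l)) ⊕ (q ⊛ h (Dc (suc l))) ⊛ ρ     ≈⟨ solve 4 (λ q ρ x y → q :* x :+ (q :* y) :* ρ := q :* (x :+ y :* ρ)) ≈-refl q ρ _ _ ⟩
        q ⊛ coord h (suc l)                              ≡⟨ up-< (coord h) l<N ⟨
        up (coord h) l                                   ∎

      coord-altList : ∀ s n h → coord (foldr Tgen· h (altList s n)) ≋ altAct s n (coord h)
      coord-altList s zero    h l l≤N = ≈-refl
      coord-altList s (suc n) h l l≤N = trans (coord-Tgen· s _ l l≤N)
        (IsLinear.cong (act-linear s) (coord-altList (other s) n h) l l≤N)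

      coord-T : ∀ {j} → j ≤ N → coord (T (D j)) ≋ δ j
      coord-T j≤N l l≤N = trans (+-cong (T-D-D c j≤N l≤N) (trans (*-congʳ (T-D-Dc c j≤N l≤N)) (zeroˡ ρ))) (+-identityʳ _)

      indChar≈tr : ∀ rep → onTc rep ≡ ρ → ∀ w {s n} → word w ≡ altList s n → indChar rep H[ c ] w ≈ tr s n
      indChar≈tr rep refl w {s} {n} word≡ = trans (indChar-H[c] rep w) (∑-cong (suc N) (λ l l<1+N → begin
        coord (mulT w (T (D l))) l                         ≡⟨ ≡.cong (λ xs → coord (foldr Tgen· (T (D l)) xs) l) word≡ ⟩
        coord (foldr Tgen· (T (D l)) (altList s n)) l      ≈⟨ coord-altList s n (T (D l)) l (ℕₚ.≤-pred l<1+N) ⟩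
        altAct s n (coord (T (D l))) l                     ≈⟨ IsLinear.cong (altAct-linear s n) (coord-T (ℕₚ.≤-pred l<1+N)) l (ℕₚ.≤-pred l<1+N) ⟩
        altAct s n (δ l) l                                 ∎))

even⊎odd : ∀ n → ∃ λ r → n ≡ 2 * r ⊎ n ≡ suc (2 * r)
even⊎odd zero = 0 , inj₁ refl
even⊎odd (suc n) with even⊎odd n
... | r , inj₁ refl = r , inj₂ refl
... | r , inj₂ refl = suc r , inj₁ (≡.sym (ℕₚ.*-suc 2 r))

-- The character values, case by case.

module CharacterValues {a ℓ : Level} (R : CommutativeRing a ℓ) (q : CommutativeRing.Carrier R) (N : ℕ) (1≤N : 1 ≤ N) where
  open CommutativeRing R renaming (_+_ to _⊕_; _*_ to _⊛_; refl to ≈-refl) hiding (zero)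
  open Algebra.Properties.Semiring.Mult semiring renaming (_×_ to _⋆_)
  open Algebra.Properties.Semiring.Exp semiring
  open Relation.Binary.Reasoning.Setoid setoid
  open IntegerCoefficients R
  open Sums R
  open BinomialSums R q
  open ClosedForms R q (suc N)
  open Hecke R (suc N) q
  open DihedralGroup N
  open HeckeAlgebra R q N hiding (p)

  module Triv = PathModule R q q N
  module Sgn  = PathModule R q (- 1#) N

  triv-quadratic : q ⊛ q ≈ p ⊛ q ⊕ q
  triv-quadratic = solve 1 (λ q → q :* q := (q :- :1) :* q :+ q) ≈-refl q

  sgn-quadratic : - 1# ⊛ - 1# ≈ p ⊛ - 1# ⊕ q
  sgn-quadratic = solve 1 (λ q → :- :1 :* :- :1 := (q :- :1) :* :- :1 :+ q) ≈-refl q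

  [-1]²^k≈1 : ∀ k → (- 1# ⊛ - 1#) ^ k ≈ 1#
  [-1]²^k≈1 zero    = ≈-refl
  [-1]²^k≈1 (suc k) = trans (*-congˡ ([-1]²^k≈1 k)) (solve 0 ((:- :1 :* :- :1) :* :1 := :1) ≈-refl)

  triv-odd : Gen → ℕ → Gen → Carrier
  triv-odd c k s = q ⊛ q²^ k ⊕ q ^ k ⊛ ((Triv.tr c (letter s k) 1 - q) - k ⋆ p)

  sgn-odd : Gen → ℕ → Gen → Carrier
  sgn-odd c k s = - 1# ⊕ q ^ k ⊛ ((Sgn.tr c (letter s k) 1 - - 1#) - k ⋆ p)

  module _ (c : Gen) where
    open InducedModule c

    η≈tr : ∀ w {s n} → word w ≡ altList s n → η H[ c ] w ≈ Triv.tr c s n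
    η≈tr = indChar≈tr q triv-quadratic trivial refl

    ε≈tr : ∀ w {s n} → word w ≡ altList s n → ε H[ c ] w ≈ Sgn.tr c s n
    ε≈tr = indChar≈tr (- 1#) sgn-quadratic sign refl

    η-even : ∀ w {s} k → word w ≡ altList s (2 * k) → 1 ≤ k → 2 * k ≤ suc N → η H[ c ] w ≈ q²^ k - q ^ k
    η-even w {s} k word≡ 1≤k 2k≤ = trans (η≈tr w word≡) (Triv.Quadratic.tr-even c triv-quadratic s k 1≤k 2k≤)

    ε-even : ∀ w {s} k → word w ≡ altList s (2 * k) → 1 ≤ k → 2 * k ≤ suc N → ε H[ c ] w ≈ 1# - q ^ k
    ε-even w {s} k word≡ 1≤k 2k≤ = trans (ε≈tr w word≡)
      (trans (Sgn.Quadratic.tr-even c sgn-quadratic s k 1≤k 2k≤) (+-congʳ ([-1]²^k≈1 k)))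

    η-odd : ∀ w {s} k → word w ≡ altList s (suc (2 * k)) → suc (2 * k) ≤ suc N → η H[ c ] w ≈ triv-odd c k s
    η-odd w {s} k word≡ 2k< = trans (η≈tr w word≡) (Triv.Quadratic.tr-odd c triv-quadratic s k 2k<)

    ε-odd : ∀ w {s} k → word w ≡ altList s (suc (2 * k)) → suc (2 * k) ≤ suc N → ε H[ c ] w ≈ sgn-odd c k s
    ε-odd w {s} k word≡ 2k< = trans (ε≈tr w word≡) (trans (Sgn.Quadratic.tr-odd c sgn-quadratic s k 2k<)
      (+-congʳ (trans (*-congˡ ([-1]²^k≈1 k)) (*-identityʳ _))))

    η-e : η H[ c ] e ≈ ι (suc N)
    η-e = trans (η≈tr e {c} {0} refl) (∑δ (suc N))
      where
      ∑δ : ∀ n → ∑ n (λ l → δ l l) ≈ ι n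
      ∑δ zero    = ≈-refl
      ∑δ (suc n) = +-cong (δ-refl n) (∑δ n)

    ε-e : ε H[ c ] e ≈ ι (suc N)
    ε-e = trans (ε≈tr e {c} {0} refl) (trans (sym (η≈tr e {c} {0} refl)) η-e)

  n⋆p : ∀ n → n ⋆ p ≈ n ⋆ q - n ⋆ 1#
  n⋆p zero    = solve 0 (:0 := :0 :- :0) ≈-refl
  n⋆p (suc n) = trans (+-congˡ (n⋆p n)) (solve 3 (λ q x y → (q :- :1) :+ (x :- y) := (q :+ x) :- (:1 :+ y)) ≈-refl q _ _)

  lead≈ : ∀ a b k → lead a b k ≈ (a ⋆ q - b ⋆ 1#) ⊛ q ^ k
  lead≈ a b k = begin
    a ⋆ q ^ (k + 1) - b ⋆ q ^ k
      ≈⟨ +-cong (trans (reflexive (≡.cong (λ n → a ⋆ q ^ n) (ℕₚ.+-comm k 1))) (sym (×-assoc-* a q (q ^ k))))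
                (-‿cong (trans (×-congʳ b (sym (*-identityˡ _))) (sym (×-assoc-* b 1# (q ^ k))))) ⟩
    (a ⋆ q) ⊛ q ^ k - (b ⋆ 1#) ⊛ q ^ k
      ≈⟨ solve 3 (λ x y z → x :* z :- y :* z := (x :- y) :* z) ≈-refl _ _ _ ⟩
    (a ⋆ q - b ⋆ 1#) ⊛ q ^ k ∎

  -- The trace a q - b of the middle letter, multiplied by `q ^ k`, is the leading term of the
  -- statement; the rest of the value depends on k alone, so one lemma serves all three cases.
  triv-odd≈F : ∀ c k s a b → Triv.tr c (letter s k) 1 ≈ a ⋆ q - b ⋆ 1# → triv-odd c k s ≈ Fηodd (lead a b k) k
  triv-odd≈F c k s a b t≈ = begin
    q ⊛ q²^ k ⊕ q ^ k ⊛ ((Triv.tr c (letter s k) 1 - q) - k ⋆ p)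
      ≈⟨ +-congˡ (*-congˡ (+-congʳ (+-congʳ t≈))) ⟩
    q ⊛ q²^ k ⊕ q ^ k ⊛ (((a ⋆ q - b ⋆ 1#) - q) - k ⋆ p)
      ≈⟨ solve 5 (λ q x y t z → q :* x :+ y :* ((t :- q) :- z) := t :* y :+ ((q :* x :- q :* y) :- y :* z)) ≈-refl q (q²^ k) (q ^ k) (a ⋆ q - b ⋆ 1#) (k ⋆ p) ⟩
    (a ⋆ q - b ⋆ 1#) ⊛ q ^ k ⊕ ((q ⊛ q²^ k - q ⊛ q ^ k) - q ^ k ⊛ (k ⋆ p))
      ≈⟨ +-cong (sym (lead≈ a b k)) (+-congˡ (-‿cong (×-comm-* k (q ^ k) p))) ⟩
    lead a b k ⊕ ((q ⊛ q²^ k - q ⊛ q ^ k) - k ⋆ (q ^ k ⊛ p))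
      ≈⟨ Fηodd-closed (lead a b k) k ⟨
    Fηodd (lead a b k) k ∎

  sgn-odd≈F : ∀ c k s a b → Sgn.tr c (letter s k) 1 ≈ a ⋆ q - b ⋆ 1# → sgn-odd c k s ≈ Fεodd (lead a b k) k
  sgn-odd≈F c k s a b t≈ = begin
    - 1# ⊕ q ^ k ⊛ ((Sgn.tr c (letter s k) 1 - - 1#) - k ⋆ p)
      ≈⟨ +-congˡ (*-congˡ (+-congʳ (+-congʳ t≈))) ⟩
    - 1# ⊕ q ^ k ⊛ (((a ⋆ q - b ⋆ 1#) - - 1#) - k ⋆ p)
      ≈⟨ solve 3 (λ y t z → :- :1 :+ y :* ((t :- :- :1) :- z) := t :* y :+ ((y :- :1) :- y :* z)) ≈-refl (q ^ k) (a ⋆ q - b ⋆ 1#) (k ⋆ p) ⟩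
    (a ⋆ q - b ⋆ 1#) ⊛ q ^ k ⊕ ((q ^ k - 1#) - q ^ k ⊛ (k ⋆ p))
      ≈⟨ +-cong (sym (lead≈ a b k)) (+-congˡ (-‿cong (×-comm-* k (q ^ k) p))) ⟩
    lead a b k ⊕ ((q ^ k - 1#) - k ⋆ (q ^ k ⊛ p))
      ≈⟨ Fεodd-closed (lead a b k) k ⟨
    Fεodd (lead a b k) k ∎

  -- The trace of T_s on the whole algebra, where each of the m pairs {x, s x} contributes p. On the
  -- path each pair of free ends adds q + (-1) = p as well.
  tr-one-sum : ∀ c s → Triv.tr c s 1 ⊕ Sgn.tr c s 1 ≈ suc N ⋆ p
  tr-one-sum c s with even⊎odd N
  ... | r , inj₁ N≡2r = begin
    Triv.tr c s 1 ⊕ Sgn.tr c s 1                     ≈⟨ +-cong (Triv.tr-one-odd c s r 1≤N N≡2r) (Sgn.tr-one-odd c s r 1≤N N≡2r) ⟩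
    (q ⊕ r ⋆ p) ⊕ (- 1# ⊕ r ⋆ p)                     ≈⟨ solve 2 (λ q x → (q :+ x) :+ (:- :1 :+ x) := (q :- :1) :+ (x :+ x)) ≈-refl q (r ⋆ p) ⟩
    p ⊕ (r ⋆ p ⊕ r ⋆ p)                              ≈⟨ +-congˡ (trans (sym (×-homo-+ p r r)) (×-congˡ (≡.trans (≡.cong (r +_) (≡.sym (ℕₚ.+-identityʳ r))) (≡.sym N≡2r)))) ⟩
    suc N ⋆ p                                        ∎
  ... | r , inj₂ N≡1+2r = trans (half (s ≟G c))
    (trans (sym (×-homo-+ p (suc r) (suc r))) (×-congˡ (≡.cong suc (≡.trans (ℕₚ.+-suc r r) (≡.trans (≡.cong (λ n → suc (r + n)) (≡.sym (ℕₚ.+-identityʳ r))) (≡.sym N≡1+2r))))))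
    where
    half : Dec (s ≡ c) → Triv.tr c s 1 ⊕ Sgn.tr c s 1 ≈ suc r ⋆ p ⊕ suc r ⋆ p
    half (yes refl) = trans (+-cong (Triv.tr-one-even-c c r N≡1+2r) (Sgn.tr-one-even-c c r N≡1+2r))
      (solve 2 (λ q x → ((q :+ q) :+ x) :+ ((:- :1 :+ :- :1) :+ x) := ((q :- :1) :+ x) :+ ((q :- :1) :+ x)) ≈-refl q (r ⋆ p))
    half (no s≢c) with ≢⇒≡other s≢c
    ... | refl = +-cong (Triv.tr-one-even-c′ c r N≡1+2r) (Sgn.tr-one-even-c′ c r N≡1+2r)

  odd-sum≈F₀ : ∀ c k s → triv-odd c k s ⊕ sgn-odd c k s ≈ F₀odd k
  odd-sum≈F₀ c k s = begin
    triv-odd c k s ⊕ sgn-odd c k s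
      ≈⟨ solve 6 (λ q x y t u z → (q :* x :+ y :* ((t :- q) :- z)) :+ (:- :1 :+ y :* ((u :- :- :1) :- z))
           := (t :+ u) :* y :+ ((q :* x :- :1) :- ((y :* z :+ y :* z) :+ y :* (q :- :1)))) ≈-refl q (q²^ k) (q ^ k) _ _ (k ⋆ p) ⟩
    (Triv.tr c (letter s k) 1 ⊕ Sgn.tr c (letter s k) 1) ⊛ q ^ k ⊕ ((q ⊛ q²^ k - 1#) - ((q ^ k ⊛ (k ⋆ p) ⊕ q ^ k ⊛ (k ⋆ p)) ⊕ q ^ k ⊛ p))
      ≈⟨ +-cong (trans (*-congʳ (trans (tr-one-sum c (letter s k)) (n⋆p (suc N)))) (sym (lead≈ (suc N) (suc N) k)))
                (+-congˡ (-‿cong odd-multiple)) ⟩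
    lead (suc N) (suc N) k ⊕ ((q ⊛ q²^ k - 1#) - (2 * k + 1) ⋆ (q ^ k ⊛ p))
      ≈⟨ F₀odd-closed k ⟨
    F₀odd k ∎
    where
    odd-multiple : (q ^ k ⊛ (k ⋆ p) ⊕ q ^ k ⊛ (k ⋆ p)) ⊕ q ^ k ⊛ p ≈ (2 * k + 1) ⋆ (q ^ k ⊛ p)
    odd-multiple = sym (begin
      (2 * k + 1) ⋆ x                   ≈⟨ ×-homo-+ x (2 * k) 1 ⟩
      (2 * k) ⋆ x ⊕ 1 ⋆ x               ≈⟨ +-cong (trans (×-homo-+ x k (k + 0)) (+-congˡ (×-congˡ (ℕₚ.+-identityʳ k)))) (×-homo-1 x) ⟩
      (k ⋆ x ⊕ k ⋆ x) ⊕ x               ≈⟨ +-congʳ (+-cong (×-comm-* k (q ^ k) p) (×-comm-* k (q ^ k) p)) ⟨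
      (q ^ k ⊛ (k ⋆ p) ⊕ q ^ k ⊛ (k ⋆ p)) ⊕ x ∎)
      where
      x : Carrier
      x = q ^ k ⊛ p

  word-len : ∀ w {n} → len w ≡ n → ∃ λ s → word w ≡ altList s n
  word-len w refl = word-altList w

  2k+1≡1+2k : ∀ k → 2 * k + 1 ≡ suc (2 * k)
  2k+1≡1+2k k = ℕₚ.+-comm (2 * k) 1

  len-bound : ∀ w {n} → len w ≡ n → n ≤ suc N
  len-bound w refl = len≤ w

  values-e : (η H₀ e ≈ ι (2 * suc N)) × (ε H₀ e ≈ ι (2 * suc N)) × (∀ c → (η H[ c ] e ≈ ι (suc N)) × (ε H[ c ] e ≈ ι (suc N)))
  values-e = at-H₀ trivial , at-H₀ sign , λ c → η-e c , ε-e c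
    where
    at-H₀ : ∀ rep → indChar rep H₀ e ≈ ι (2 * suc N)
    at-H₀ rep = begin
      indChar rep H₀ e                ≈⟨ InducedModule.indChar-H₀ s₁ rep e ⟩
      η H[ s₁ ] e ⊕ ε H[ s₁ ] e       ≈⟨ +-cong (η-e s₁) (ε-e s₁) ⟩
      ι (suc N) ⊕ ι (suc N)           ≈⟨ ×-homo-+ 1# (suc N) (suc N) ⟨
      ι (suc N + suc N)               ≡⟨ ≡.cong (λ n → ι (suc N + n)) (ℕₚ.+-identityʳ (suc N)) ⟨
      ι (2 * suc N)                   ∎

  H₀-even : ∀ rep w k → len w ≡ 2 * k → 1 ≤ k → indChar rep H₀ w ≈ F₀even k
  H₀-even rep w k len≡ 1≤k with word-len w len≡
  ... | s , word≡ = begin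
    indChar rep H₀ w                          ≈⟨ InducedModule.indChar-H₀ s₁ rep w ⟩
    η H[ s₁ ] w ⊕ ε H[ s₁ ] w                 ≈⟨ +-cong (η-even s₁ w k word≡ 1≤k (len-bound w len≡)) (ε-even s₁ w k word≡ 1≤k (len-bound w len≡)) ⟩
    (q²^ k - q ^ k) ⊕ (1# - q ^ k)            ≈⟨ F₀even-closed k 1≤k ⟨
    F₀even k                                  ∎

  H₀-odd : ∀ rep w k → len w ≡ 2 * k + 1 → indChar rep H₀ w ≈ F₀odd k
  H₀-odd rep w k len≡ with word-len w (≡.trans len≡ (2k+1≡1+2k k))
  ... | s , word≡ = begin
    indChar rep H₀ w                          ≈⟨ InducedModule.indChar-H₀ s₁ rep w ⟩
    η H[ s₁ ] w ⊕ ε H[ s₁ ] w                 ≈⟨ +-cong (η-odd s₁ w k word≡ bound) (ε-odd s₁ w k word≡ bound) ⟩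
    triv-odd s₁ k s ⊕ sgn-odd s₁ k s          ≈⟨ odd-sum≈F₀ s₁ k s ⟩
    F₀odd k                                   ∎
    where
    bound : suc (2 * k) ≤ suc N
    bound = len-bound w (≡.trans len≡ (2k+1≡1+2k k))

  H[c]-even : ∀ c w k → len w ≡ 2 * k → 1 ≤ k → (η H[ c ] w ≈ Fηeven k) × (ε H[ c ] w ≈ Fεeven k)
  H[c]-even c w k len≡ 1≤k with word-len w len≡
  ... | s , word≡ = trans (η-even c w k word≡ 1≤k (len-bound w len≡)) (sym (Fηeven-closed k 1≤k))
                  , trans (ε-even c w k word≡ 1≤k (len-bound w len≡)) (sym (Fεeven-closed k 1≤k))

  H[c]-odd : ∀ c w k aη bη aε bε → len w ≡ 2 * k + 1 →
    (∀ s → word w ≡ altList s (suc (2 * k)) →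
      Triv.tr c (letter s k) 1 ≈ aη ⋆ q - bη ⋆ 1# × Sgn.tr c (letter s k) 1 ≈ aε ⋆ q - bε ⋆ 1#) →
    (η H[ c ] w ≈ Fηodd (lead aη bη k) k) × (ε H[ c ] w ≈ Fεodd (lead aε bε k) k)
  H[c]-odd c w k aη bη aε bε len≡ tr-one with word-len w (≡.trans len≡ (2k+1≡1+2k k))
  ... | s , word≡ = trans (η-odd c w k word≡ bound) (triv-odd≈F c k s aη bη (proj₁ (tr-one s word≡)))
                  , trans (ε-odd c w k word≡ bound) (sgn-odd≈F c k s aε bε (proj₂ (tr-one s word≡)))
    where
    bound : suc (2 * k) ≤ suc N
    bound = len-bound w (≡.trans len≡ (2k+1≡1+2k k))

  -- The coefficients come from q + r (q - 1) = (r + 1) q - r and -1 + r (q - 1) = r q - (r + 1).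
  H[c]-odd-m-odd : ∀ c w k r → len w ≡ 2 * k + 1 → suc N ≡ 2 * r + 1 →
    (η H[ c ] w ≈ Fηodd (lead (r + 1) r k) k) × (ε H[ c ] w ≈ Fεodd (lead r (r + 1) k) k)
  H[c]-odd-m-odd c w k r len≡ m≡ rewrite ℕₚ.+-comm r 1 = H[c]-odd c w k (suc r) r r (suc r) len≡ λ s _ →
      trans (Triv.tr-one-odd c (letter s k) r 1≤N N≡2r) (trans (+-congˡ (n⋆p r))
        (solve 3 (λ q x y → q :+ (x :- y) := (q :+ x) :- y) ≈-refl q (r ⋆ q) (r ⋆ 1#)))
    , trans (Sgn.tr-one-odd c (letter s k) r 1≤N N≡2r) (trans (+-congˡ (n⋆p r))
        (solve 2 (λ x y → :- :1 :+ (x :- y) := x :- (:1 :+ y)) ≈-refl (r ⋆ q) (r ⋆ 1#)))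
    where
    N≡2r : N ≡ 2 * r
    N≡2r = ℕₚ.suc-injective (≡.trans m≡ (2k+1≡1+2k r))

  1+N≡2r⇒N≡1+2r′ : ∀ {r} → suc N ≡ 2 * suc r → N ≡ suc (2 * r)
  1+N≡2r⇒N≡1+2r′ {r} m≡ = ℕₚ.suc-injective (≡.trans m≡ (ℕₚ.*-suc 2 r))

  -- The middle letter is `c`, with two free ends and r - 1 edges: 2 ρ + (r - 1)(q - 1) at ρ = q and
  -- at ρ = -1 yields the pairs r + 1, r - 1 and r - 1, r + 1.
  H[c]-odd-∼ : ∀ c w k r → len w ≡ 2 * k + 1 → suc N ≡ 2 * r → w ∼ gen c →
    (η H[ c ] w ≈ Fηodd (lead (r + 1) (r ∸ 1) k) k) × (ε H[ c ] w ≈ Fεodd (lead (r ∸ 1) (r + 1) k) k)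
  H[c]-odd-∼ c w k (suc r) len≡ m≡ w∼c rewrite ℕₚ.+-comm r 1 = H[c]-odd c w k (2 + r) r r (2 + r) len≡ λ s word≡ →
      trans (reflexive (≡.cong (λ t → Triv.tr c t 1) (Conjugacy.∼c⇒letter≡c (suc r) m≡ c k word≡ w∼c)))
        (trans (Triv.tr-one-even-c c r N≡) (trans (+-congˡ (n⋆p r))
          (solve 3 (λ q x y → (q :+ q) :+ (x :- y) := (q :+ (q :+ x)) :- y) ≈-refl q (r ⋆ q) (r ⋆ 1#))))
    , trans (reflexive (≡.cong (λ t → Sgn.tr c t 1) (Conjugacy.∼c⇒letter≡c (suc r) m≡ c k word≡ w∼c)))
        (trans (Sgn.tr-one-even-c c r N≡) (trans (+-congˡ (n⋆p r))
          (solve 2 (λ x y → (:- :1 :+ :- :1) :+ (x :- y) := x :- (:1 :+ (:1 :+ y))) ≈-refl (r ⋆ q) (r ⋆ 1#))))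
    where
    N≡ : N ≡ suc (2 * r)
    N≡ = 1+N≡2r⇒N≡1+2r′ m≡

  -- An odd length bounded by an even m is smaller than m, so `w` is not the longest element and its
  -- word determines it through `mkWord`.
  odd<even : ∀ w k r → len w ≡ suc (2 * k) → suc N ≡ 2 * suc r → suc (2 * k) ≤ N
  odd<even w k r len≡ m≡ = ℕₚ.≤-pred (≡.subst₂ _≤_ (ℕₚ.*-suc 2 k) (≡.sym m≡)
    (ℕₚ.*-monoʳ-≤ 2 (ℕₚ.*-cancelˡ-< 2 k (suc r) (≡.subst (suc (2 * k) ≤_) m≡ (len-bound w len≡)))))

  -- A reflection is conjugate to its own middle letter; contraposition then forces the middle
  -- letter to be `other c` when `w` is not conjugate to `c`.
  letter-∼ : ∀ w s k r → len w ≡ suc (2 * k) → word w ≡ altList s (suc (2 * k)) → suc N ≡ 2 * suc r → w ∼ gen (letter s k)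
  letter-∼ w s k r len≡ word≡ m≡ with mkWord-altList w (≡.subst (_≤ N) (≡.sym len≡) (odd<even w k r len≡ m≡))
  ... | t , word≡′ , w≡ = ≡.subst (_∼ gen (letter s k)) (≡.sym (≡.trans w≡ (≡.cong₂ mkWord t≡ len≡)))
    (odd∼c (letter s k) k (odd<even w k r len≡ m≡))
    where
    t≡ : t ≡ letter (letter s k) k
    t≡ = ≡.trans (∷-injectiveˡ (≡.trans (≡.sym (≡.trans word≡′ (≡.cong (altList t) len≡))) word≡)) (≡.sym (Cosets.letter-letter s k))

  H[c]-odd-≁ : ∀ c w k r → len w ≡ 2 * k + 1 → suc N ≡ 2 * r → ¬ (w ∼ gen c) →
    (η H[ c ] w ≈ Fηodd (lead r r k) k) × (ε H[ c ] w ≈ Fεodd (lead r r k) k)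
  H[c]-odd-≁ c w k (suc r) len≡ m≡ w≁c = H[c]-odd c w k (suc r) (suc r) (suc r) (suc r) len≡ λ s word≡ →
      trans (reflexive (≡.cong (λ t → Triv.tr c t 1) (letter≡ s word≡))) (trans (Triv.tr-one-even-c′ c r N≡) (n⋆p (suc r)))
    , trans (reflexive (≡.cong (λ t → Sgn.tr c t 1) (letter≡ s word≡))) (trans (Sgn.tr-one-even-c′ c r N≡) (n⋆p (suc r)))
    where
    N≡ : N ≡ suc (2 * r)
    N≡ = 1+N≡2r⇒N≡1+2r′ m≡
    letter≡ : ∀ s → word w ≡ altList s (suc (2 * k)) → letter s k ≡ other c
    letter≡ s word≡ = ≢⇒≡other λ { refl → w≁c (letter-∼ w s k r (≡.trans len≡ (2k+1≡1+2k k)) word≡ m≡) }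

theorem2p8 : {a ℓ : Level} (R : CommutativeRing a ℓ) (q : CommutativeRing.Carrier R) (m : ℕ) → 2 ≤ m →
    let open CommutativeRing R using (_≈_) in
    let open Hecke R m q in
    ((η H₀ e ≈ ι (2 * m)) × (ε H₀ e ≈ ι (2 * m))
    × (∀ c → (η H[ c ] e ≈ ι m) × (ε H[ c ] e ≈ ι m)))
    × (∀ w k → len w ≡ 2 * k → 1 ≤ k → (η H₀ w ≈ F₀even k) × (ε H₀ w ≈ F₀even k))
    × (∀ w k → len w ≡ 2 * k + 1 → (η H₀ w ≈ F₀odd k) × (ε H₀ w ≈ F₀odd k))
    × (∀ c w k → len w ≡ 2 * k → 1 ≤ k → (η H[ c ] w ≈ Fηeven k) × (ε H[ c ] w ≈ Fεeven k))
    × (∀ c w k r → len w ≡ 2 * k + 1 → m ≡ 2 * r + 1 →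
    (η H[ c ] w ≈ Fηodd (lead (r + 1) r k) k) × (ε H[ c ] w ≈ Fεodd (lead r (r + 1) k) k))
    × (∀ c w k r → len w ≡ 2 * k + 1 → m ≡ 2 * r → w ∼ gen c →
    (η H[ c ] w ≈ Fηodd (lead (r + 1) (r ∸ 1) k) k) × (ε H[ c ] w ≈ Fεodd (lead (r ∸ 1) (r + 1) k) k))
    × (∀ c w k r → len w ≡ 2 * k + 1 → m ≡ 2 * r → ¬ (w ∼ gen c) →
    (η H[ c ] w ≈ Fηodd (lead r r k) k) × (ε H[ c ] w ≈ Fεodd (lead r r k) k))
theorem2p8 R q (suc N) (s≤s 1≤N) =
    values-e
  , (λ w k len≡ 1≤k → H₀-even trivial w k len≡ 1≤k , H₀-even sign w k len≡ 1≤k)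
  , (λ w k len≡ → H₀-odd trivial w k len≡ , H₀-odd sign w k len≡)
  , H[c]-even
  , H[c]-odd-m-odd
  , H[c]-odd-∼
  , H[c]-odd-≁
  where open CharacterValues R q N 1≤N
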